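{- For every integer $k\geq 1$, the $k$-abelian complexity function $(\mathcal{P}^{(k)}_{\mathbf{c}}(n))_{n\geq1}$ of the Cantor sequence $\mathbf c$ is a $3$-regular sequence.
   Context: The Cantor sequence $\mathbf{c}=c_0c_1c_2\cdots\in\{0,1\}^{\mathbb N}$ is defined by $c_0=1$ and $c_{3n}=c_{3n+2}=c_n$, $c_{3n+1}=0$ for all $n\geq 0$. A factor of $\mathbf c$ is a finite word $c_ic_{i+1}\cdots c_{i+m-1}$; $\mathcal F_{\mathbf c}(n)$ is the set of factors of length $n$. For a word $u=u_0\cdots u_{n-1}$ and $\ell\geq1$, $\mathrm{pref}_\ell(u)=u_0\cdots u_{\ell-1}$, $\mathrm{suff}_\ell(u)=u_{n-\ell}\cdots u_{n-1}$; for $\ell\le0$ both are the empty word. $|u|_w$ is the number of occurrences of $w$ in $u$. Two words $u,v$ are $k$-abelian equivalent ($u\sim_k v$) if $\mathrm{pref}_{k-1}(u)=\mathrm{pref}_{k-1}(v)$, $\mathrm{suff}_{k-1}(u)=\mathrm{suff}_{k-1}(v)$ and $|u|_w=|v|_w$ for every word $w$ of length $k$. The $k$-abelian complexity is $\mathcal P^{(k)}_{\mathbf c}(n)=\mathrm{Card}(\mathcal F_{\mathbf c}(n)/\sim_k)$ for $n\ge1$. For an integer $b\geq2$, an integer sequence $\mathbf w=(w_n)$ is $b$-regular if the $\mathbb Z$-module generated by its $b$-kernel $\{(w_{b^en+r})_{n}\mid e\geq0,\ 0\le r<b^e\}$ is finitely generated. -}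

module Defs where

open import Data.Bool using (Bool; true; false; if_then_else_)
open import Data.Nat using (ℕ; zero; suc; _+_; _*_; _∸_; _^_; _≤_; _<_; _≡ᵇ_)
open import Data.Nat.DivMod using (_/_; _%_)
open import Data.Integer as ℤ using (ℤ)
open import Data.List as List using (List; []; _∷_; length; take; drop; upTo)
open import Data.List.Relation.Unary.All using (All)
open import Data.List.Relation.Unary.Any using (Any)
open import Data.List.Relation.Unary.AllPairs using (AllPairs)
open import Data.Vec as Vec using (Vec)
open import Data.Product using (Σ; ∃; ∃-syntax; _×_; _,_)
open import Relation.Binary.PropositionalEquality using (_≡_; refl)
open import Relation.Nullary using (¬_)

-- The Cantor sequence: c 0 = 1, c (3n) = c (3n+2) = c n, c (3n+1) = 0.
-- Computed by the recurrence with fuel (n / 3 < n for n > 0, so fuel n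
-- suffices).  true = 1, false = 0.

cantorAux : ℕ → ℕ → Bool
cantorAux zero    _ = true
cantorAux (suc f) n =
  if n ≡ᵇ 0 then true
  else if (n % 3) ≡ᵇ 1 then false
  else cantorAux f (n / 3)

cantor : ℕ → Bool
cantor n = cantorAux n n

private
  test : List.map cantor (upTo 10)
       ≡ true ∷ false ∷ true ∷ false ∷ false ∷ false ∷ true ∷ false ∷ true ∷ false ∷ []
  test = refl

Word : Set
Word = List Bool

factorAt : ℕ → ℕ → Word
factorAt i n = List.map (λ j → cantor (i + j)) (upTo n)

IsFactor : ℕ → Word → Set
IsFactor n u = ∃[ i ] u ≡ factorAt i n

pref : ℕ → Word → Word
pref ℓ u = take ℓ u

suff : ℕ → Word → Word
suff ℓ u = drop (length u ∸ ℓ) u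

eqBool : Bool → Bool → Bool
eqBool true  true  = true
eqBool false false = true
eqBool _     _     = false

isPrefix : Word → Word → Bool
isPrefix []       _        = true
isPrefix (_ ∷ _)  []       = false
isPrefix (a ∷ w)  (b ∷ u)  = if eqBool a b then isPrefix w u else false

occ : Word → Word → ℕ
occ w []       = if isPrefix w [] then 1 else 0
occ w (x ∷ u)  = (if isPrefix w (x ∷ u) then 1 else 0) + occ w u

_∼[_]_ : Word → ℕ → Word → Set
u ∼[ k ] v =
  (pref (k ∸ 1) u ≡ pref (k ∸ 1) v) ×
  (suff (k ∸ 1) u ≡ suff (k ∸ 1) v) ×
  (∀ (w : Word) → length w ≡ k → occ w u ≡ occ w v)

-- Card (F_c(n) / ∼_k) ≡ m : a list of m pairwise inequivalent factors of
-- length n representing every class.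
AbCard : ℕ → ℕ → ℕ → Set
AbCard k n m =
  Σ (List Word) λ L →
    (length L ≡ m) ×
    All (IsFactor n) L ×
    AllPairs (λ u v → ¬ (u ∼[ k ] v)) L ×
    (∀ u → IsFactor n u → Any (λ v → u ∼[ k ] v) L)

InSpan : ∀ {m} → Vec (ℕ → ℤ) m → (ℕ → ℤ) → Set
InSpan {m} gs f =
  Σ (Vec ℤ m) λ cs →
    ∀ n → f n ≡ Vec.foldr _ ℤ._+_ (ℤ.+ 0) (Vec.zipWith (λ a g → a ℤ.* g n) cs gs)

InKernel : ℕ → (ℕ → ℤ) → (ℕ → ℤ) → Set
InKernel b w f = ∃[ e ] ∃[ r ] (r < b ^ e) × (∀ n → f n ≡ w (b ^ e * n + r))

InKernelModule : ℕ → (ℕ → ℤ) → (ℕ → ℤ) → Set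
InKernelModule b w f =
  ∃[ m ] Σ (Vec (ℕ → ℤ) m) λ gs → All (InKernel b w) (Vec.toList gs) × InSpan gs f

Regular : ℕ → (ℕ → ℤ) → Set
Regular b w =
  ∃[ m ] Σ (Vec (ℕ → ℤ) m) λ gs →
    All (InKernelModule b w) (Vec.toList gs) ×
    (∀ e r → r < b ^ e → InSpan gs (λ n → w (b ^ e * n + r)))

{-# OPTIONS --safe #-}

-- Write k = Q + 1, let J be least with Q ≤ 3 ^ J, and put B = 3 ^ J, T = 2 * B. The 1s of the Cantor
-- sequence sit at the numbers 2 * digits h, where digits h reads the binary digits of h in base 3. Hence
-- the sequence is 0 except for copies of its prefix of length B at the positions T * digits g, and a factor
-- of length Q + n at i is described by the two cuts i and i + n: each lies in a gap or at one of finitely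
-- many offsets r around a block g. The counts of the words of length k only depend on the two offsets and
-- on the difference of the block numbers. If one of the cuts lies in a gap, the class is determined by the
-- number of windows of length k containing a 1 (and by the side of the gap); the possible numbers are
-- counted by #{h : T * digits h + r ≤ n}, since digits is superadditive. If neither cut lies in a gap, then
-- digits a + digits b determines a + b, so that n and the offsets determine the class, and the number of
-- classes depends on n modulo T only. So the complexity is a sum of sequences lying in modules that are
-- finitely generated and closed under n ↦ 3 n + d; the submodule generated by the 3-kernel is again
-- finitely generated because ℤ^m is Noetherian.

module Submission where

open import Defs
open import Data.Bool using (Bool; true; false; _∧_; if_then_else_)
import Data.Bool.Properties as Bool
open import Data.Fin using (Fin; zero; suc; toℕ; fromℕ<)
open import Data.Fin.Patterns using (0F; 1F; 2F)
import Data.Fin.Properties as Fin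
open import Data.Integer as ℤ using (ℤ; 0ℤ; 1ℤ; ∣_∣) renaming (+_ to pos)
import Data.Integer.DivMod as ℤ
import Data.Integer.Divisibility.Signed as ℤ
import Data.Integer.Properties as ℤ
open import Data.Integer.Tactic.RingSolver using () renaming (solve-∀ to ℤ-solve)
open import Data.List
  using (List; []; _∷_; _++_; map; length; take; drop; replicate; upTo; applyUpTo; deduplicate; filter)
open import Data.List.Membership.Propositional using (_∈_; find; lose)
open import Data.List.Membership.Propositional.Properties
import Data.List.Properties as List
open import Data.List.Relation.Unary.All as All using (All; []; _∷_)
import Data.List.Relation.Unary.All.Properties as All
open import Data.List.Relation.Unary.AllPairs as AllPairs using (AllPairs; []; _∷_)
import Data.List.Relation.Unary.AllPairs.Properties as AllPairs
open import Data.List.Relation.Unary.Any as Any using (here; there)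
import Data.List.Relation.Unary.Any.Properties as Any
import Data.List.Relation.Unary.Unique.DecSetoid.Properties as Unique
open import Data.Nat as ℕ using (ℕ; zero; suc; _+_; _*_; _∸_; _^_; _<_; _≤_; s≤s; z≤n; NonZero)
open import Data.Nat.DivMod
import Data.Nat.Divisibility as ℕ
open import Data.Nat.Divisibility using (n∣m*n)
open import Data.Nat.Induction using (<-rec)
import Data.Nat.Properties as ℕ
open import Data.Nat.Tactic.RingSolver using (solve-∀)
open import Data.Product using (Σ; ∃; ∃₂; _×_; _,_; proj₁; proj₂)
import Data.Product.Properties as Product
open import Data.Sum using (_⊎_; inj₁; inj₂)
open import Data.Vec as Vec using (Vec; []; _∷_)
import Data.Vec.Properties as Vec
open import Function using (_∘_; id; _⇔_; mk⇔; Equivalence)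
open import Relation.Binary using (DecidableEquality; tri<; tri≈; tri>)
import Relation.Binary.Construct.On as On
open import Relation.Binary.PropositionalEquality
import Relation.Binary.PropositionalEquality.Properties as ≡
open import Relation.Nullary using (¬_; Dec; yes; no; contradiction)
import Relation.Nullary.Decidable as Dec
open import Relation.Nullary.Decidable using (_×-dec_)

-- `Regular` asks for generators inside the module of the 3-kernel, while the sequences that
-- generate the summands need not lie there. So the Noetherian property is used constructively,
-- together with a decision whether a kernel sequence is still missing. Two demands fix J. From Q ≤
-- 3 ^ J it follows that a window of length Q + 1 meets at most one block, so all blocks look alike
-- locally. Minimality of J puts a 1 into every window of length Q at an offset strictly between two
-- gaps; hence prefix and suffix reveal the kind of each cut, and factors of different kinds are
-- never equivalent. Superadditivity of `digits` only bounds from below the length taken up by h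
-- blocks. That the bound is attained next to a long gap needs special blocks: those from index 2 ^
-- M on, and those whose index is complementary to h in the binary expansion of 2 ^ M ∸ 1. If
-- neither cut lies in a gap, equal end windows need not mean equal offsets. They leave a margin
-- below B at each end, and since both margins together stay below T = 2 * B, the difference of the
-- block positions is still determined.

-- Natural number arithmetic

-- The hypotheses are summed up to x ≤ y and a common term c is cancelled.
≤-cert : ∀ {x y a b} c → x ≤ y → x ≡ c + a → y ≡ c + b → a ≤ b
≤-cert {a = a} {b} c x≤y refl refl = ℕ.+-cancelˡ-≤ c a b x≤y

infixr 4 _⊕_
_⊕_ : ∀ {a b c d} → a ≤ b → c ≤ d → a + c ≤ b + d
_⊕_ = ℕ.+-mono-≤

/-shape : ∀ k q {r} .{{_ : NonZero k}} → r < k → (k * q + r) / k ≡ q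
/-shape k q {r} r< = begin
  (k * q + r) / k     ≡⟨ cong (_/ k) (trans (ℕ.+-comm (k * q) r) (cong (r +_) (ℕ.*-comm k q))) ⟩
  (r + q * k) / k     ≡⟨ +-distrib-/-∣ʳ r (n∣m*n q) ⟩
  r / k + q * k / k   ≡⟨ cong₂ _+_ (m<n⇒m/n≡0 r<) (m*n/n≡m q k) ⟩
  q                   ∎
  where open ≡-Reasoning

%-shape : ∀ k q {r} .{{_ : NonZero k}} → r < k → (k * q + r) % k ≡ r
%-shape k q {r} r< = trans (cong (_% k) (trans (ℕ.+-comm (k * q) r) (cong (r +_) (ℕ.*-comm k q))))
  (trans ([m+kn]%n≡m%n r q k) (m<n⇒m%n≡m r<))

shape-unique : ∀ k {q q′ r r′} .{{_ : NonZero k}} → r < k → r′ < k → k * q + r ≡ k * q′ + r′ → q ≡ q′ × r ≡ r′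
shape-unique k {q} {q′} r< r′< e =
  trans (sym (/-shape k q r<)) (trans (cong (_/ k) e) (/-shape k q′ r′<)) ,
  trans (sym (%-shape k q r<)) (trans (cong (_% k) e) (%-shape k q′ r′<))

/-suc-≤ : ∀ d .{{_ : NonZero d}} → 1 < d → ∀ {f h} → h ≤ suc f → h / d ≤ f
/-suc-≤ d 1<d {h = zero}  _  = ℕ.≤-trans (ℕ.≤-reflexive (0/n≡0 d)) z≤n
/-suc-≤ d 1<d {h = suc h} h≤ = ℕ.≤-pred (ℕ.≤-trans (m/n<m (suc h) d {{_}} 1<d) h≤)

odd≢even : ∀ x y → suc (2 * x) ≢ 2 * y
odd≢even x y e = contradiction (proj₂ (shape-unique 2 {x} {y} (s≤s (s≤s z≤n)) (s≤s z≤n)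
  (trans (ℕ.+-comm (2 * x) 1) (trans e (sym (ℕ.+-identityʳ (2 * y))))))) λ ()

n<2^n : ∀ n → n < 2 ^ n
n<2^n zero    = s≤s z≤n
n<2^n (suc n) = subst₂ _≤_ (ℕ.+-comm (suc n) 1) (lemma (2 ^ n)) (n<2^n n ⊕ ℕ.m^n>0 2 n)
  where
  lemma : ∀ p → p + p ≡ 2 * p
  lemma = solve-∀

n<3^n : ∀ n → n < 3 ^ n
n<3^n n = ℕ.<-≤-trans (n<2^n n) (ℕ.^-monoˡ-≤ n (s≤s (s≤s z≤n)))

-- Finitely generated subgroups of ℤ^m

-- A combination is kept as a derivation instead of a coefficient vector, and `ext` builds in
-- invariance under pointwise equality. For sequences, `coordinates` recovers the coefficients.
data Span {X : Set} (gs : List (X → ℤ)) : (X → ℤ) → Set where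
  gen   : ∀ {g} → g ∈ gs → Span gs g
  nil   : Span gs (λ _ → 0ℤ)
  add   : ∀ {f f′} → Span gs f → Span gs f′ → Span gs (λ x → f x ℤ.+ f′ x)
  scale : ∀ a {f} → Span gs f → Span gs (λ x → a ℤ.* f x)
  ext   : ∀ {f f′} → (∀ x → f x ≡ f′ x) → Span gs f → Span gs f′

_⊑_ : ∀ {X : Set} → List (X → ℤ) → List (X → ℤ) → Set
gs ⊑ hs = ∀ {g} → g ∈ gs → Span hs g

module _ {X : Set} where

  Span-bind : ∀ {gs hs : List (X → ℤ)} → gs ⊑ hs → ∀ {f} → Span gs f → Span hs f
  Span-bind σ (gen g∈)    = σ g∈
  Span-bind σ nil         = nil
  Span-bind σ (add p q)   = add (Span-bind σ p) (Span-bind σ q)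
  Span-bind σ (scale a p) = scale a (Span-bind σ p)
  Span-bind σ (ext e p)   = ext e (Span-bind σ p)

  ∷-⊑ : ∀ {gs hs : List (X → ℤ)} {g} → Span hs g → gs ⊑ hs → (g ∷ gs) ⊑ hs
  ∷-⊑ p σ (here refl) = p
  ∷-⊑ p σ (there g∈)  = σ g∈

  ⊑-there : ∀ {gs hs : List (X → ℤ)} {h} → gs ⊑ hs → gs ⊑ (h ∷ hs)
  ⊑-there σ = Span-bind (gen ∘ there) ∘ σ

  ∷-mono-⊑ : ∀ {gs hs : List (X → ℤ)} {g} → gs ⊑ hs → (g ∷ gs) ⊑ (g ∷ hs)
  ∷-mono-⊑ σ = ∷-⊑ (gen (here refl)) (⊑-there σ)

  ⊑-trans : ∀ {fs gs hs : List (X → ℤ)} → fs ⊑ gs → gs ⊑ hs → fs ⊑ hs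
  ⊑-trans σ τ = Span-bind τ ∘ σ

  Span-sub : ∀ {gs : List (X → ℤ)} a {f f′} → Span gs f → Span gs f′ → Span gs (λ x → f x ℤ.- a ℤ.* f′ x)
  Span-sub a {f} {f′} p q = ext (λ x → lemma a (f x) (f′ x)) (add p (scale (ℤ.- a) q))
    where
    lemma : ∀ a x y → x ℤ.+ (ℤ.- a) ℤ.* y ≡ x ℤ.- a ℤ.* y
    lemma = ℤ-solve

  infix 4 _≈_
  _≈_ : List (X → ℤ) → List (X → ℤ) → Set
  gs ≈ hs = gs ⊑ hs × hs ⊑ gs

  ≈-trans : ∀ {fs gs hs : List (X → ℤ)} → fs ≈ gs → gs ≈ hs → fs ≈ hs
  ≈-trans (σ , σ′) (τ , τ′) = ⊑-trans σ τ , ⊑-trans τ′ σ′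

  ∷-cong-≈ : ∀ {gs hs : List (X → ℤ)} {g} → gs ≈ hs → (g ∷ gs) ≈ (g ∷ hs)
  ∷-cong-≈ (σ , σ′) = ∷-mono-⊑ σ , ∷-mono-⊑ σ′

  swap-⊑ : ∀ {gs : List (X → ℤ)} {g h} → (g ∷ h ∷ gs) ⊑ (h ∷ g ∷ gs)
  swap-⊑ = ∷-⊑ (gen (there (here refl))) (∷-⊑ (gen (here refl)) (gen ∘ there ∘ there))

  swap-≈ : ∀ {gs : List (X → ℤ)} {g h} → (g ∷ h ∷ gs) ≈ (h ∷ g ∷ gs)
  swap-≈ = swap-⊑ , swap-⊑

-- The ascending chain condition as an inductive predicate: adjoining vectors from outside the span
-- has to stop. In this form it serves directly as the termination argument of `kernel-generators`.
data Noeth {X : Set} (gs : List (X → ℤ)) : Set where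
  noeth : (∀ v → ¬ Span gs v → Noeth (v ∷ gs)) → Noeth gs

Noeth-resp-≈ : ∀ {X : Set} {gs hs : List (X → ℤ)} → gs ≈ hs → Noeth gs → Noeth hs
Noeth-resp-≈ e@(σ , σ′) (noeth f) =
  noeth λ v v∉ → Noeth-resp-≈ (∷-cong-≈ e) (f v (v∉ ∘ Span-bind σ))

-- Echelon form over ℤ and decidable membership

module _ {m : ℕ} where

  cons₀ : (Fin m → ℤ) → Fin (suc m) → ℤ
  cons₀ v zero    = 0ℤ
  cons₀ v (suc i) = v i

  tail : (Fin (suc m) → ℤ) → Fin m → ℤ
  tail v = v ∘ suc

  Span-cons₀ : ∀ {K v} → Span K v → Span (map cons₀ K) (cons₀ v)
  Span-cons₀ (gen v∈)    = gen (∈-map⁺ cons₀ v∈)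
  Span-cons₀ nil         = ext (λ { zero → refl ; (suc i) → refl }) nil
  Span-cons₀ (add p q)   = ext (λ { zero → refl ; (suc i) → refl }) (add (Span-cons₀ p) (Span-cons₀ q))
  Span-cons₀ (scale a p) = ext (λ { zero → ℤ.*-zeroʳ a ; (suc i) → refl }) (scale a (Span-cons₀ p))
  Span-cons₀ (ext e p)   = ext (λ { zero → refl ; (suc i) → e i }) (Span-cons₀ p)

  Span-cons₀⁻ : ∀ {K v} → Span (map cons₀ K) v → v zero ≡ 0ℤ × Span K (tail v)
  Span-cons₀⁻ (gen v∈) with ∈-map⁻ cons₀ v∈
  ... | k , k∈ , refl     = refl , gen k∈
  Span-cons₀⁻ nil         = refl , nil
  Span-cons₀⁻ (add p q) with Span-cons₀⁻ p | Span-cons₀⁻ q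
  ... | e , p′ | e′ , q′  = cong₂ ℤ._+_ e e′ , add p′ q′
  Span-cons₀⁻ (scale a p) with Span-cons₀⁻ p
  ... | e , p′            = trans (cong (a ℤ.*_) e) (ℤ.*-zeroʳ a) , scale a p′
  Span-cons₀⁻ (ext e p) with Span-cons₀⁻ p
  ... | e′ , p′           = trans (sym (e zero)) e′ , ext (e ∘ suc) p′

  cons₀-tail : ∀ {v} → v zero ≡ 0ℤ → ∀ i → cons₀ (tail v) i ≡ v i
  cons₀-tail e zero    = sym e
  cons₀-tail e (suc i) = refl

  Span-tail : ∀ {K v} → v zero ≡ 0ℤ → Span K (tail v) → Span (map cons₀ K) v
  Span-tail e p = ext (cons₀-tail e) (Span-cons₀ p)

  pivot-coefficient : ∀ {p K v} → Span (p ∷ map cons₀ K) v →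
    ∃ λ c → v zero ≡ c ℤ.* p zero × Span K (λ i → v (suc i) ℤ.- c ℤ.* p (suc i))
  pivot-coefficient {p} (gen (here refl)) =
    1ℤ , sym (ℤ.*-identityˡ _) , ext (λ i → lemma (p (suc i))) nil
    where
    lemma : ∀ x → 0ℤ ≡ x ℤ.- 1ℤ ℤ.* x
    lemma = ℤ-solve
  pivot-coefficient {p} (gen (there v∈)) with ∈-map⁻ cons₀ v∈
  ... | k , k∈ , refl = 0ℤ , refl , ext (λ i → lemma (k i) (p (suc i))) (gen k∈)
    where
    lemma : ∀ x y → x ≡ x ℤ.- 0ℤ ℤ.* y
    lemma = ℤ-solve
  pivot-coefficient {p} nil = 0ℤ , refl , ext (λ i → lemma (p (suc i))) nil
    where
    lemma : ∀ y → 0ℤ ≡ 0ℤ ℤ.- 0ℤ ℤ.* y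
    lemma = ℤ-solve
  pivot-coefficient {p} (add {f} {f′} q q′) with pivot-coefficient q | pivot-coefficient q′
  ... | c , e , s | c′ , e′ , s′ =
    c ℤ.+ c′ , trans (cong₂ ℤ._+_ e e′) (sym (ℤ.*-distribʳ-+ (p zero) c c′)) ,
    ext (λ i → lemma (f (suc i)) (f′ (suc i)) c c′ (p (suc i))) (add s s′)
    where
    lemma : ∀ x y a b z → (x ℤ.- a ℤ.* z) ℤ.+ (y ℤ.- b ℤ.* z) ≡ (x ℤ.+ y) ℤ.- (a ℤ.+ b) ℤ.* z
    lemma = ℤ-solve
  pivot-coefficient {p} (scale a {f} q) with pivot-coefficient q
  ... | c , e , s =
    a ℤ.* c , trans (cong (a ℤ.*_) e) (sym (ℤ.*-assoc a c _)) ,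
    ext (λ i → lemma a (f (suc i)) c (p (suc i))) (scale a s)
    where
    lemma : ∀ a x c z → a ℤ.* (x ℤ.- c ℤ.* z) ≡ a ℤ.* x ℤ.- (a ℤ.* c) ℤ.* z
    lemma = ℤ-solve
  pivot-coefficient {p} (ext h q) with pivot-coefficient q
  ... | c , e , s = c , trans (sym (h zero)) e , ext (λ i → cong (ℤ._- c ℤ.* p (suc i)) (h (suc i))) s

  add-back : ∀ {hs : List (Fin (suc m) → ℤ)} {v p} c → Span hs p →
    Span hs (λ i → v i ℤ.- c ℤ.* p i) → Span hs v
  add-back {v = v} {p} c sp s = ext (λ i → lemma (v i) c (p i)) (add s (scale c sp))
    where
    lemma : ∀ x c z → (x ℤ.- c ℤ.* z) ℤ.+ c ℤ.* z ≡ x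
    lemma = ℤ-solve

  reduce-zero : ∀ (v p : Fin (suc m) → ℤ) c → v zero ≡ c ℤ.* p zero → v zero ℤ.- c ℤ.* p zero ≡ 0ℤ
  reduce-zero v p c e = trans (cong (ℤ._- c ℤ.* p zero) e) (ℤ.+-inverseʳ (c ℤ.* p zero))

  Echelon : List (Fin (suc m) → ℤ) → Set
  Echelon gs = ∃₂ λ p K → gs ≈ (p ∷ map cons₀ K)

  -- Euclid's algorithm on the leading coordinates of the new vector and the pivot.
  insert : ∀ n v p K → ∣ v zero ∣ ≡ n → Echelon (v ∷ p ∷ map cons₀ K)
  insert = <-rec (λ n → ∀ v p K → ∣ v zero ∣ ≡ n → Echelon (v ∷ p ∷ map cons₀ K)) go
    where
    go : ∀ n → (∀ {n′} → n′ ℕ.< n → ∀ v p K → ∣ v zero ∣ ≡ n′ → Echelon (v ∷ p ∷ map cons₀ K)) →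
         ∀ v p K → ∣ v zero ∣ ≡ n → Echelon (v ∷ p ∷ map cons₀ K)
    go zero rec v p K e = p , tail v ∷ K , ≈-trans swap-≈ (∷-cong-≈ v≈)
      where
      v₀ : v zero ≡ 0ℤ
      v₀ = ℤ.∣i∣≡0⇒i≡0 e
      v≈ : (v ∷ map cons₀ K) ≈ map cons₀ (tail v ∷ K)
      v≈ = ∷-⊑ (ext (cons₀-tail v₀) (gen (here refl))) (gen ∘ there) ,
           ∷-⊑ (ext (sym ∘ cons₀-tail v₀) (gen (here refl))) (gen ∘ there)
    go (suc n) rec v p K e with rec r< p₁ v K refl
      where
      instance
        nz : ℤ.NonZero (v zero)
        nz = subst ℕ.NonZero (sym e) _
      q : ℤ
      q = p zero ℤ./ v zero
      p₁ : Fin (suc m) → ℤ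
      p₁ i = p i ℤ.- q ℤ.* v i
      lemma : ∀ r x → (r ℤ.+ x) ℤ.- x ≡ r
      lemma = ℤ-solve
      p₁₀ : p₁ zero ≡ pos (p zero ℤ.% v zero)
      p₁₀ = trans (cong (ℤ._- q ℤ.* v zero) (ℤ.a≡a%n+[a/n]*n (p zero) (v zero))) (lemma _ (q ℤ.* v zero))
      r< : ∣ p₁ zero ∣ ℕ.< suc n
      r< = subst₂ ℕ._<_ (sym (cong ∣_∣ p₁₀)) e (ℤ.n%d<d (p zero) (v zero))
    ... | p′ , K′ , e′ = p′ , K′ , ≈-trans (swap-≈′ , swap-≈″) e′
      where
      instance
        nz : ℤ.NonZero (v zero)
        nz = subst ℕ.NonZero (sym e) _
      q : ℤ
      q = p zero ℤ./ v zero
      swap-≈′ : (v ∷ p ∷ map cons₀ K) ⊑ ((λ i → p i ℤ.- q ℤ.* v i) ∷ v ∷ map cons₀ K)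
      swap-≈′ = ∷-⊑ (gen (there (here refl)))
        (∷-⊑ (add-back q (gen (there (here refl))) (gen (here refl))) (gen ∘ there ∘ there))
      swap-≈″ : ((λ i → p i ℤ.- q ℤ.* v i) ∷ v ∷ map cons₀ K) ⊑ (v ∷ p ∷ map cons₀ K)
      swap-≈″ = ∷-⊑ (Span-sub q (gen (there (here refl))) (gen (here refl)))
        (∷-⊑ (gen (here refl)) (gen ∘ there ∘ there))

  echelon : ∀ gs → Echelon gs
  echelon []       = (λ _ → 0ℤ) , [] , (λ ()) , ∷-⊑ nil (λ ())
  echelon (v ∷ gs) with echelon gs
  ... | p , K , e with insert _ v p K refl
  ... | p′ , K′ , e′ = p′ , K′ , ≈-trans (∷-cong-≈ e) e′

  -- A pivot with leading coordinate 0 is demoted to the tails, so a pivot that remains can be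
  -- cancelled and its coefficient in a combination is unique.
  Reduced : List (Fin (suc m) → ℤ) → Set
  Reduced gs = (∃ λ K → gs ≈ map cons₀ K) ⊎ (∃₂ λ p K → p zero ≢ 0ℤ × gs ≈ (p ∷ map cons₀ K))

  reduced : ∀ gs → Reduced gs
  reduced gs with echelon gs
  ... | p , K , e with p zero ℤ.≟ 0ℤ
  ... | no  p₀ = inj₂ (p , K , p₀ , e)
  ... | yes p₀ = inj₁ (tail p ∷ K , ≈-trans e
    (∷-⊑ (ext (cons₀-tail p₀) (gen (here refl))) (gen ∘ there) ,
     ∷-⊑ (ext (sym ∘ cons₀-tail p₀) (gen (here refl))) (gen ∘ there)))

  pivot-reduce : ∀ {p K} → p zero ≢ 0ℤ → ∀ {v} c → v zero ≡ c ℤ.* p zero →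
    Span (p ∷ map cons₀ K) v → Span K (λ i → v (suc i) ℤ.- c ℤ.* p (suc i))
  pivot-reduce {p} p₀ c e s with pivot-coefficient s
  ... | c′ , e′ , s′ with ℤ.*-cancelʳ-≡ c c′ (p zero) {{ℤ.≢-nonZero p₀}} (trans (sym e) e′)
  ... | refl = s′

  pivot-restore : ∀ {p K v} c → v zero ≡ c ℤ.* p zero →
    Span K (λ i → v (suc i) ℤ.- c ℤ.* p (suc i)) → Span (p ∷ map cons₀ K) v
  pivot-restore {p} {v = v} c e s =
    add-back c (gen (here refl)) (Span-bind (gen ∘ there) (Span-tail (reduce-zero v p c e) s))

-- Recursion on the dimension: the leading coordinate of v forces the coefficient of the pivot, and
-- what remains is a question about tails. `kernel-generators` uses the answer to find a missing
-- decimation.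
Span? : ∀ {m} (gs : List (Fin m → ℤ)) v → Dec (Span gs v)
Span? {zero}  gs v = yes (ext (λ ()) nil)
Span? {suc m} gs v with reduced gs
... | inj₁ (K , σ , τ) with v zero ℤ.≟ 0ℤ
...   | no  v₀ = no (v₀ ∘ proj₁ ∘ Span-cons₀⁻ ∘ Span-bind σ)
...   | yes v₀ = Dec.map′ (Span-bind τ ∘ Span-tail v₀) (proj₂ ∘ Span-cons₀⁻ ∘ Span-bind σ) (Span? K (tail v))
Span? {suc m} gs v | inj₂ (p , K , p₀ , σ , τ) with p zero ℤ.∣? v zero
... | no  p∤v = no λ s → let c , e , _ = pivot-coefficient (Span-bind σ s) in p∤v (ℤ.divides c e)
... | yes (ℤ.divides c e) = Dec.map′ (Span-bind τ ∘ pivot-restore c e) (pivot-reduce p₀ c e ∘ Span-bind σ) (Span? K _)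

-- Ascending chains of subgroups of ℤ^m stop

module _ {m : ℕ} where

  -- A lexicographic descent. If the leading coordinate of the new vector is a multiple of the
  -- pivot's, subtracting that multiple leaves a new tail outside the span of K, and the chain for K
  -- advances. Otherwise the new pivot divides both leading coordinates and is strictly smaller,
  -- since equality would make the old one divide v.
  Noeth-pivot-step : (p : Fin (suc m) → ℤ) → p zero ≢ 0ℤ →
    (∀ p′ K → p′ zero ≢ 0ℤ → ∣ p′ zero ∣ ℕ.< ∣ p zero ∣ → Noeth (p′ ∷ map cons₀ K)) →
    ∀ K → Noeth K → Noeth (p ∷ map cons₀ K)
  Noeth-pivot-step p p₀ smaller K (noeth f) = noeth step
    where
    instance
      p₀-nonZero : ℤ.NonZero (p zero)
      p₀-nonZero = ℤ.≢-nonZero p₀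
    step : ∀ v → ¬ Span (p ∷ map cons₀ K) v → Noeth (v ∷ p ∷ map cons₀ K)
    step v v∉ with p zero ℤ.∣? v zero
    ... | yes (ℤ.divides c e) = Noeth-resp-≈
      ( ∷-⊑ (gen (there (here refl))) (∷-⊑ v₁∈ (gen ∘ there ∘ there))
      , ∷-⊑ v∈ (∷-⊑ (gen (here refl)) (gen ∘ there ∘ there)) )
      (Noeth-pivot-step p p₀ smaller (v₁ ∷ K) (f v₁ (v∉ ∘ pivot-restore c e)))
      where
      v₁ : Fin m → ℤ
      v₁ i = v (suc i) ℤ.- c ℤ.* p (suc i)
      v₁∈ : Span (v ∷ p ∷ map cons₀ K) (cons₀ v₁)
      v₁∈ = ext (sym ∘ cons₀-tail (reduce-zero v p c e))
        (Span-sub c (gen (here refl)) (gen (there (here refl))))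
      v∈ : Span (p ∷ map cons₀ (v₁ ∷ K)) v
      v∈ = pivot-restore {K = v₁ ∷ K} c e (gen (here refl))
    ... | no p∤v with reduced (v ∷ p ∷ map cons₀ K)
    ...   | inj₁ (K′ , σ , τ) =
      contradiction (proj₁ (Span-cons₀⁻ {K = K′} (σ (there (here refl))))) p₀
    ...   | inj₂ (p′ , K′ , p′₀ , σ , τ) = Noeth-resp-≈ (τ , σ) (smaller p′ K′ p′₀ p′<p)
      where
      p′∣p : ∣ p′ zero ∣ ℕ.∣ ∣ p zero ∣
      p′∣p = let c , e , _ = pivot-coefficient {K = K′} (σ (there (here refl))) in ℤ.∣⇒∣ᵤ (ℤ.divides c e)
      p′∣v : ∣ p′ zero ∣ ℕ.∣ ∣ v zero ∣
      p′∣v = let c , e , _ = pivot-coefficient {K = K′} (σ (here refl)) in ℤ.∣⇒∣ᵤ (ℤ.divides c e)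
      p′<p : ∣ p′ zero ∣ ℕ.< ∣ p zero ∣
      p′<p = ℕ.≤∧≢⇒< (ℕ.∣⇒≤ p′∣p) λ e → p∤v (ℤ.∣ᵤ⇒∣ (subst (ℕ._∣ ∣ v zero ∣) e p′∣v))

  Noeth-pivot : (∀ (K : List (Fin m → ℤ)) → Noeth K) →
    ∀ p K → p zero ≢ 0ℤ → Noeth (p ∷ map cons₀ K)
  Noeth-pivot all p K p₀ = go _ p K p₀ refl
    where
    go : ∀ n p K → p zero ≢ 0ℤ → ∣ p zero ∣ ≡ n → Noeth (p ∷ map cons₀ K)
    go = <-rec (λ n → ∀ p K → p zero ≢ 0ℤ → ∣ p zero ∣ ≡ n → Noeth (p ∷ map cons₀ K))
      λ n rec p K p₀ e → Noeth-pivot-step p p₀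
        (λ p′ K′ p′₀ p′<p → rec (subst (∣ p′ zero ∣ ℕ.<_) e p′<p) p′ K′ p′₀ refl) K (all K)

  -- As long as all leading coordinates are 0, the chain is a chain of tails; the first vector with
  -- a nonzero one becomes the pivot.
  Noeth-cons₀ : (∀ (K : List (Fin m → ℤ)) → Noeth K) → ∀ K → Noeth K → Noeth (map cons₀ K)
  Noeth-cons₀ all K (noeth f) = noeth step
    where
    step : ∀ v → ¬ Span (map cons₀ K) v → Noeth (v ∷ map cons₀ K)
    step v v∉ with v zero ℤ.≟ 0ℤ
    ... | no  v₀ = Noeth-pivot all v K v₀
    ... | yes v₀ = Noeth-resp-≈
      (∷-⊑ (ext (sym ∘ cons₀-tail v₀) (gen (here refl))) (gen ∘ there) ,
       ∷-⊑ (ext (cons₀-tail v₀) (gen (here refl))) (gen ∘ there))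
      (Noeth-cons₀ all (tail v ∷ K) (f (tail v) (v∉ ∘ Span-tail v₀)))

Noeth-all : ∀ {m} (gs : List (Fin m → ℤ)) → Noeth gs
Noeth-all {zero}  gs = noeth λ v v∉ → contradiction (ext (λ ()) nil) v∉
Noeth-all {suc m} gs with reduced gs
... | inj₁ (K , σ , τ)          = Noeth-resp-≈ (τ , σ) (Noeth-cons₀ Noeth-all K (Noeth-all K))
... | inj₂ (p , K , p₀ , σ , τ) = Noeth-resp-≈ (τ , σ) (Noeth-pivot Noeth-all p K p₀)

-- Regular sequences

Seq : Set
Seq = ℕ → ℤ

decimate : Seq → Fin 3 → Seq
decimate f d n = f (3 * n + toℕ d)

Closed : List Seq → Set
Closed gs = ∀ {g} → g ∈ gs → ∀ d → Span gs (decimate g d)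

-- The generators may be arbitrary sequences, which makes closure under sums, delays and
-- interleaving easy; only `LinRep⇒Regular` exchanges them for members of the 3-kernel of w.
LinRep : Seq → Set
LinRep w = Σ (List Seq) λ gs → Closed gs × Span gs w

Span-decimate : ∀ {gs hs} → (∀ {g} → g ∈ gs → ∀ d → Span hs (decimate g d)) →
  ∀ {f} → Span gs f → ∀ d → Span hs (decimate f d)
Span-decimate c (gen g∈) d    = c g∈ d
Span-decimate c nil d         = nil
Span-decimate c (add p q) d   = add (Span-decimate c p d) (Span-decimate c q d)
Span-decimate c (scale a p) d = scale a (Span-decimate c p d)
Span-decimate c (ext e p) d   = ext (λ n → e _) (Span-decimate c p d)

∑ : (gs : List Seq) → (Fin (length gs) → ℤ) → Seq
∑ []       v n = 0ℤ
∑ (g ∷ gs) v n = v zero ℤ.* g n ℤ.+ ∑ gs (v ∘ suc) n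

∑-zero : ∀ gs n → ∑ gs (λ _ → 0ℤ) n ≡ 0ℤ
∑-zero []       n = refl
∑-zero (g ∷ gs) n = trans (cong (λ x → 0ℤ ℤ.* g n ℤ.+ x) (∑-zero gs n)) refl

∑-add : ∀ gs u v n → ∑ gs (λ i → u i ℤ.+ v i) n ≡ ∑ gs u n ℤ.+ ∑ gs v n
∑-add []       u v n = refl
∑-add (g ∷ gs) u v n = trans (cong (λ x → (u zero ℤ.+ v zero) ℤ.* g n ℤ.+ x) (∑-add gs _ _ n))
  (lemma (u zero) (v zero) (g n) (∑ gs (u ∘ suc) n) (∑ gs (v ∘ suc) n))
  where
  lemma : ∀ a b x s t → (a ℤ.+ b) ℤ.* x ℤ.+ (s ℤ.+ t) ≡ (a ℤ.* x ℤ.+ s) ℤ.+ (b ℤ.* x ℤ.+ t)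
  lemma = ℤ-solve

∑-scale : ∀ gs a v n → ∑ gs (λ i → a ℤ.* v i) n ≡ a ℤ.* ∑ gs v n
∑-scale []       a v n = sym (ℤ.*-zeroʳ a)
∑-scale (g ∷ gs) a v n = trans (cong (λ x → (a ℤ.* v zero) ℤ.* g n ℤ.+ x) (∑-scale gs a _ n))
  (lemma a (v zero) (g n) (∑ gs (v ∘ suc) n))
  where
  lemma : ∀ a b x s → (a ℤ.* b) ℤ.* x ℤ.+ a ℤ.* s ≡ a ℤ.* (b ℤ.* x ℤ.+ s)
  lemma = ℤ-solve

∑-cong : ∀ gs {u v} → (∀ i → u i ≡ v i) → ∀ n → ∑ gs u n ≡ ∑ gs v n
∑-cong []       e n = refl
∑-cong (g ∷ gs) e n = cong₂ (λ a s → a ℤ.* g n ℤ.+ s) (e zero) (∑-cong gs (e ∘ suc) n)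

coordinates : ∀ {gs f} → Span gs f → ∃ λ v → ∀ n → f n ≡ ∑ gs v n
coordinates {gs} (gen g∈) = unit g∈
  where
  unit : ∀ {gs} {g : Seq} → g ∈ gs → ∃ λ v → ∀ n → g n ≡ ∑ gs v n
  unit {g ∷ gs} (here refl) =
    (λ { zero → 1ℤ ; (suc i) → 0ℤ }) ,
    λ n → trans (sym (ℤ.+-identityʳ (g n)))
      (cong₂ ℤ._+_ (sym (ℤ.*-identityˡ (g n))) (sym (∑-zero gs n)))
  unit {g ∷ gs} (there g∈) with unit g∈
  ... | v , e = (λ { zero → 0ℤ ; (suc i) → v i }) , λ n → trans (e n) (sym (ℤ.+-identityˡ _))
coordinates {gs} nil = (λ _ → 0ℤ) , λ n → sym (∑-zero gs n)
coordinates {gs} (add p q) with coordinates p | coordinates q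
... | u , e | v , e′ = (λ i → u i ℤ.+ v i) , λ n → trans (cong₂ ℤ._+_ (e n) (e′ n)) (sym (∑-add gs u v n))
coordinates {gs} (scale a p) with coordinates p
... | v , e = (λ i → a ℤ.* v i) , λ n → trans (cong (a ℤ.*_) (e n)) (sym (∑-scale gs a v n))
coordinates (ext h p) with coordinates p
... | v , e = v , λ n → trans (sym (h n)) (e n)

Span-∑ : ∀ gs v → Span gs (∑ gs v)
Span-∑ []       v = nil
Span-∑ (g ∷ gs) v = add (scale (v zero) (gen (here refl))) (Span-bind (gen ∘ there) (Span-∑ gs (v ∘ suc)))

Span-map-∑ : ∀ gs {L v} → Span L v → Span (map (∑ gs) L) (∑ gs v)
Span-map-∑ gs (gen v∈)            = gen (∈-map⁺ (∑ gs) v∈)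
Span-map-∑ gs nil                 = ext (λ n → sym (∑-zero gs n)) nil
Span-map-∑ gs (add {u} {v} p q)   = ext (λ n → sym (∑-add gs u v n)) (add (Span-map-∑ gs p) (Span-map-∑ gs q))
Span-map-∑ gs (scale a {v} p)     = ext (λ n → sym (∑-scale gs a v n)) (scale a (Span-map-∑ gs p))
Span-map-∑ gs (ext e p)           = ext (∑-cong gs e) (Span-map-∑ gs p)

InSpan-∑ : ∀ gs v → InSpan (Vec.fromList gs) (∑ gs v)
InSpan-∑ gs v = Vec.tabulate v , go gs v
  where
  go : ∀ gs v n → ∑ gs v n ≡
    Vec.foldr _ ℤ._+_ (pos 0) (Vec.zipWith (λ a g → a ℤ.* g n) (Vec.tabulate v) (Vec.fromList gs))
  go []       v n = refl
  go (g ∷ gs) v n = cong (λ x → v zero ℤ.* g n ℤ.+ x) (go gs (v ∘ suc) n)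

Span⇒InSpan : ∀ {gs f} → Span gs f → InSpan (Vec.fromList gs) f
Span⇒InSpan {gs} p with coordinates p
... | v , e with InSpan-∑ gs v
... | cs , e′ = cs , λ n → trans (e n) (e′ n)

module _ (w : Seq) where

  InKernel-self : InKernel 3 w w
  InKernel-self = 0 , 0 , s≤s z≤n , λ n → cong w (sym (trans (ℕ.+-identityʳ _) (ℕ.*-identityˡ n)))

  InKernel-decimate : ∀ {f} → InKernel 3 w f → ∀ d → InKernel 3 w (decimate f d)
  InKernel-decimate (e , r , r< , h) d =
    suc e , 3 ^ e * toℕ d + r , bound , λ n → trans (h _) (cong w (lemma (3 ^ e) n (toℕ d) r))
    where
    lemma : ∀ p n d r → p * (3 * n + d) + r ≡ 3 * p * n + (p * d + r)
    lemma = solve-∀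
    bound : 3 ^ e * toℕ d + r < 3 ^ suc e
    bound = begin-strict
      3 ^ e * toℕ d + r     <⟨ ℕ.+-monoʳ-< (3 ^ e * toℕ d) r< ⟩
      3 ^ e * toℕ d + 3 ^ e ≤⟨ ℕ.+-monoˡ-≤ (3 ^ e) (ℕ.*-monoʳ-≤ (3 ^ e) (ℕ.≤-pred (Fin.toℕ<n d))) ⟩
      3 ^ e * 2 + 3 ^ e     ≡⟨ lemma′ (3 ^ e) ⟩
      3 ^ suc e             ∎
      where
      open ℕ.≤-Reasoning
      lemma′ : ∀ p → p * 2 + p ≡ 3 * p
      lemma′ = solve-∀

  InKernel-ext : ∀ {f f′} → (∀ n → f n ≡ f′ n) → InKernel 3 w f → InKernel 3 w f′
  InKernel-ext h (e , r , r< , h′) = e , r , r< , λ n → trans (sym (h n)) (h′ n)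

  -- The digits of r are consumed from the most significant one.
  kernel⊆Span : ∀ {hs} → Closed hs → Span hs w → ∀ e r → r < 3 ^ e → Span hs (λ n → w (3 ^ e * n + r))
  kernel⊆Span c p zero zero r< =
    ext (λ n → cong w (sym (trans (ℕ.+-identityʳ _) (ℕ.*-identityˡ n)))) p
  kernel⊆Span c p zero (suc r) (s≤s ())
  kernel⊆Span {hs} c p (suc e) r r< =
    ext (λ n → cong w (eq n)) (Span-decimate c (kernel⊆Span c p e (r % 3 ^ e) (m%n<n r (3 ^ e))) d)
    where
    instance
      3^e≢0 : NonZero (3 ^ e)
      3^e≢0 = ℕ.m^n≢0 3 e
    d< : r / 3 ^ e < 3
    d< = m<n*o⇒m/o<n r<
    d : Fin 3
    d = fromℕ< d<
    eq : ∀ n → 3 ^ e * (3 * n + toℕ d) + r % 3 ^ e ≡ 3 ^ suc e * n + r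
    eq n = begin
      3 ^ e * (3 * n + toℕ d) + r % 3 ^ e                   ≡⟨ cong (λ x → 3 ^ e * (3 * n + x) + r % 3 ^ e) (Fin.toℕ-fromℕ< d<) ⟩
      3 ^ e * (3 * n + r / 3 ^ e) + r % 3 ^ e               ≡⟨ lemma (3 ^ e) n (r / 3 ^ e) (r % 3 ^ e) ⟩
      3 ^ suc e * n + (r % 3 ^ e + r / 3 ^ e * 3 ^ e)       ≡⟨ cong (3 ^ suc e * n +_) (m≡m%n+[m/n]*n r (3 ^ e)) ⟨
      3 ^ suc e * n + r                                     ∎
      where
      open ≡-Reasoning
      lemma : ∀ p n q s → p * (3 * n + q) + s ≡ 3 * p * n + (s + q * p)
      lemma = solve-∀

  module _ {gs : List Seq} (closed : Closed gs) where

    decimate-∑ : ∀ v (d : Fin 3) → ∃ λ v′ → ∀ n → decimate (∑ gs v) d n ≡ ∑ gs v′ n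
    decimate-∑ v d = coordinates (Span-decimate closed (Span-∑ gs v) d)

    -- Kernel sequences are adjoined as long as one of their decimations is missing.
    kernel-generators : ∀ L → Noeth L → Span (map (∑ gs) L) w → All (InKernel 3 w ∘ ∑ gs) L →
      ∃ λ hs → Closed hs × Span hs w × All (InKernel 3 w) hs
    kernel-generators L (noeth f) w∈ ks with All.decide (Dec.toSum ∘ Dec-all) L
      where
      Dec-all : ∀ v → Dec (∀ d → Span L (proj₁ (decimate-∑ v d)))
      Dec-all v = Fin.all? (λ d → Span? L (proj₁ (decimate-∑ v d)))
    ... | inj₁ all = map (∑ gs) L , closed′ , w∈ , All.map⁺ ks
      where
      closed′ : Closed (map (∑ gs) L)
      closed′ g∈ d with ∈-map⁻ (∑ gs) g∈
      ... | v , v∈ , refl = ext (sym ∘ proj₂ (decimate-∑ v d)) (Span-map-∑ gs (All.lookup all v∈ d))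
    ... | inj₂ any with find any
    ... | v , v∈ , ¬all with Fin.¬∀⟶∃¬ 3 _ (λ d → Span? L (proj₁ (decimate-∑ v d))) ¬all
    -- The coordinate vector of the missing decimation lies outside the span of L, so the `Noeth`
    -- proof descends along it.
    ... | d , v∉ = kernel-generators (v′ ∷ L) (f v′ v∉) (Span-bind (gen ∘ there) w∈)
      (InKernel-ext (proj₂ (decimate-∑ v d)) (InKernel-decimate (All.lookup ks v∈) d) ∷ ks)
      where v′ = proj₁ (decimate-∑ v d)

LinRep⇒Regular : ∀ {w} → LinRep w → Regular 3 w
LinRep⇒Regular {w} (gs , closed , w∈) with coordinates w∈
... | v , e with kernel-generators w closed (v ∷ []) (Noeth-all _)
                   (ext (sym ∘ e) (gen (here refl))) (InKernel-ext w e (InKernel-self w) ∷ [])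
... | hs , closed′ , w∈′ , ks =
  length hs , Vec.fromList hs ,
  subst (All (InKernelModule 3 w)) (sym (Vec.toList∘fromList hs)) (All.map inModule ks) ,
  λ e r r< → Span⇒InSpan (kernel⊆Span w closed′ w∈′ e r r<)
  where
  inModule : ∀ {f} → InKernel 3 w f → InKernelModule 3 w f
  inModule {f} k = 1 , f ∷ [] , k ∷ [] , Span⇒InSpan {f ∷ []} (gen (here refl))

LinRep-ext : ∀ {f f′} → (∀ n → f n ≡ f′ n) → LinRep f → LinRep f′
LinRep-ext e (gs , c , p) = gs , c , ext e p

LinRep-scale : ∀ a {f} → LinRep f → LinRep (λ n → a ℤ.* f n)
LinRep-scale a (gs , c , p) = gs , c , scale a p

LinRep-zero : LinRep (λ _ → 0ℤ)
LinRep-zero = [] , (λ ()) , nil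

Span-++ˡ : ∀ {X : Set} {gs hs : List (X → ℤ)} {f} → Span gs f → Span (gs ++ hs) f
Span-++ˡ = Span-bind (gen ∘ ∈-++⁺ˡ)

Span-++ʳ : ∀ {X : Set} gs {hs : List (X → ℤ)} {f} → Span hs f → Span (gs ++ hs) f
Span-++ʳ gs = Span-bind (gen ∘ ∈-++⁺ʳ gs)

Closed-++ : ∀ {gs hs} → Closed gs → Closed hs → Closed (gs ++ hs)
Closed-++ {gs} c c′ g∈ d with ∈-++⁻ gs g∈
... | inj₁ g∈gs = Span-++ˡ (c g∈gs d)
... | inj₂ g∈hs = Span-++ʳ gs (c′ g∈hs d)

LinRep-add : ∀ {f f′} → LinRep f → LinRep f′ → LinRep (λ n → f n ℤ.+ f′ n)
LinRep-add (gs , c , p) (hs , c′ , p′) =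
  gs ++ hs , Closed-++ c c′ , add (Span-++ˡ p) (Span-++ʳ gs p′)

LinRep-decimate⁻ : ∀ {f} → (∀ d → LinRep (decimate f d)) → LinRep f
LinRep-decimate⁻ {f} lr with lr 0F | lr 1F | lr 2F
... | gs₀ , c₀ , p₀ | gs₁ , c₁ , p₁ | gs₂ , c₂ , p₂ =
  f ∷ hs , closed , gen (here refl)
  where
  hs : List Seq
  hs = gs₀ ++ (gs₁ ++ gs₂)
  closed : Closed (f ∷ hs)
  closed (here refl) 0F = Span-bind (gen ∘ there) (Span-++ˡ p₀)
  closed (here refl) 1F = Span-bind (gen ∘ there) (Span-++ʳ gs₀ (Span-++ˡ p₁))
  closed (here refl) 2F = Span-bind (gen ∘ there) (Span-++ʳ gs₀ (Span-++ʳ gs₁ p₂))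
  closed (there g∈)  d  = Span-bind (gen ∘ there) (Closed-++ c₀ (Closed-++ c₁ c₂) g∈ d)

-- Delays, integer quotients and periodic sequences

delay : Seq → Seq
delay f zero    = 0ℤ
delay f (suc n) = f n

delay-cong : ∀ {f f′} → (∀ n → f n ≡ f′ n) → ∀ n → delay f n ≡ delay f′ n
delay-cong e zero    = refl
delay-cong e (suc n) = e n

Span-delay : ∀ {gs f} → Span gs f → Span (map delay gs) (delay f)
Span-delay (gen g∈)    = gen (∈-map⁺ delay g∈)
Span-delay nil         = ext (λ { zero → refl ; (suc n) → refl }) nil
Span-delay (add p q)   = ext (λ { zero → refl ; (suc n) → refl }) (add (Span-delay p) (Span-delay q))
Span-delay (scale a p) = ext (λ { zero → ℤ.*-zeroʳ a ; (suc n) → refl }) (scale a (Span-delay p))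
Span-delay (ext e p)   = ext (delay-cong e) (Span-delay p)

-- At 3 n the delay reads f at 3 (n - 1) + 2, which is a delayed decimation; at 3 n + 1 and 3 n + 2
-- it reads plain decimations. So it suffices to adjoin the delays of the generators.
LinRep-delay : ∀ {f} → LinRep f → LinRep (delay f)
LinRep-delay {f} (gs , c , p) = gs ++ map delay gs , closed , Span-++ʳ gs (Span-delay p)
  where
  closed : Closed (gs ++ map delay gs)
  closed g∈ d with ∈-++⁻ gs g∈
  ... | inj₁ g∈gs = Span-++ˡ (c g∈gs d)
  ... | inj₂ g∈del with ∈-map⁻ delay g∈del
  closed g∈ 0F | inj₂ _ | g , g∈gs , refl = ext
    (λ { zero → refl ; (suc n) → cong (delay g) (lemma n) }) (Span-++ʳ gs (Span-delay (c g∈gs 2F)))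
    where
    lemma : ∀ n → suc (3 * n + 2) ≡ 3 * suc n + 0
    lemma = solve-∀
  closed g∈ 1F | inj₂ _ | g , g∈gs , refl = ext
    (λ n → cong (delay g) (lemma n)) (Span-++ˡ (c g∈gs 0F))
    where
    lemma : ∀ n → suc (3 * n + 0) ≡ 3 * n + 1
    lemma = solve-∀
  closed g∈ 2F | inj₂ _ | g , g∈gs , refl = ext
    (λ n → cong (delay g) (lemma n)) (Span-++ˡ (c g∈gs 1F))
    where
    lemma : ∀ n → suc (3 * n + 1) ≡ 3 * n + 2
    lemma = solve-∀

δ₀ : Seq
δ₀ zero    = 1ℤ
δ₀ (suc n) = 0ℤ

LinRep-δ₀ : LinRep δ₀
LinRep-δ₀ = δ₀ ∷ [] , closed , gen (here refl)
  where
  closed : Closed (δ₀ ∷ [])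
  closed (here refl) 0F = ext (λ { zero → refl ; (suc n) → refl }) (gen (here refl))
  closed (here refl) 1F = ext (λ n → cong δ₀ (ℕ.+-comm 1 (3 * n))) nil
  closed (here refl) 2F = ext (λ n → cong δ₀ (ℕ.+-comm 2 (3 * n))) nil

-- A sequence is the delay of its tail plus a multiple of δ₀. Iterated Q times, this admits the
-- irregular initial values of the complexity below Q.
LinRep-suc⁻ : ∀ {f} → LinRep (f ∘ suc) → LinRep f
LinRep-suc⁻ {f} lr = LinRep-ext
  (λ { zero → trans (ℤ.+-identityʳ _) (ℤ.*-identityʳ (f 0))
     ; (suc n) → trans (cong (ℤ._+ f (suc n)) (ℤ.*-zeroʳ (f 0))) (ℤ.+-identityˡ _) })
  (LinRep-add (LinRep-scale (f 0) LinRep-δ₀) (LinRep-delay lr))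

LinRep-shift⁻ : ∀ Q {f} → LinRep (λ n → f (Q + n)) → LinRep f
LinRep-shift⁻ zero    lr = lr
LinRep-shift⁻ (suc Q) lr = LinRep-suc⁻ (LinRep-shift⁻ Q lr)

LinRep-div3 : ∀ {f} → LinRep f → LinRep (λ n → f (n / 3))
LinRep-div3 {f} lr = LinRep-decimate⁻ λ d → LinRep-ext (λ n → cong f (sym (/-shape 3 n (Fin.toℕ<n d)))) lr

LinRep-div3^ : ∀ J .{{_ : NonZero (3 ^ J)}} {f} → LinRep f → LinRep (λ n → f (n / 3 ^ J))
LinRep-div3^ zero    {f} lr = LinRep-ext (λ n → cong f (sym (n/1≡n n))) lr
LinRep-div3^ (suc J) {f} lr = LinRep-ext (λ n → cong f (m/n/o≡m/[n*o] n 3 (3 ^ J)))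
  (LinRep-div3 (LinRep-div3^ J lr))
  where
  instance
    3^J≢0 : NonZero (3 ^ J)
    3^J≢0 = ℕ.m^n≢0 3 J

indicator : ℕ → Seq
indicator j m with m ℕ.≟ j
... | yes _ = 1ℤ
... | no  _ = 0ℤ

module _ (T : ℕ) .{{_ : NonZero T}} where

  residue : ℕ → Seq
  residue j n = indicator j (n % T)

  residues : List Seq
  residues = map residue (upTo T)

  -- A T-periodic function is the sum of its values times the indicators of the residue classes;
  -- `cut t` is the partial sum over the residues below t.
  Span-periodic : ∀ (F : ℕ → ℤ) → Span residues (λ n → F (n % T))
  Span-periodic F = ext (λ n → full n) (partial T ℕ.≤-refl)
    where
    cut : ℕ → Seq
    cut t n with n % T ℕ.<? t
    ... | yes _ = F (n % T)
    ... | no  _ = 0ℤ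
    full : ∀ n → cut T n ≡ F (n % T)
    full n with n % T ℕ.<? T
    ... | yes _ = refl
    ... | no ≮lt = contradiction (m%n<n n T) ≮lt
    cut-suc : ∀ t n → F t ℤ.* residue t n ℤ.+ cut t n ≡ cut (suc t) n
    cut-suc t n with n % T ℕ.≟ t | n % T ℕ.<? t | n % T ℕ.<? suc t
    ... | yes e | yes lt | _      = contradiction lt (ℕ.<-irrefl e)
    ... | yes e | no _  | yes _  = trans (ℤ.+-identityʳ _) (trans (ℤ.*-identityʳ (F t)) (cong F (sym e)))
    ... | yes e | no _  | no ≮lt   = contradiction (s≤s (ℕ.≤-reflexive e)) ≮lt
    ... | no _  | yes _ | yes _  = trans (cong (ℤ._+ F (n % T)) (ℤ.*-zeroʳ (F t))) (ℤ.+-identityˡ _)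
    ... | no _  | yes lt | no ≮lt   = contradiction (ℕ.m<n⇒m<1+n lt) ≮lt
    ... | no ≢t  | no ≮lt  | yes lt  = contradiction (ℕ.≤∧≢⇒< (ℕ.≤-pred lt) ≢t) ≮lt
    ... | no _  | no _  | no _   = trans (ℤ.+-identityʳ _) (ℤ.*-zeroʳ (F t))
    partial : ∀ t → t ≤ T → Span residues (cut t)
    partial zero    _  = ext (λ n → sym (none n)) nil
      where
      none : ∀ n → cut 0 n ≡ 0ℤ
      none n with n % T ℕ.<? 0
      ... | yes ()
      ... | no _ = refl
    partial (suc t) t< = ext (cut-suc t)
      (add (scale (F t) (gen (∈-map⁺ residue (∈-upTo⁺ t<)))) (partial t (ℕ.<⇒≤ t<)))

  LinRep-periodic : ∀ (F : ℕ → ℤ) → LinRep (λ n → F (n % T))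
  LinRep-periodic F = residues , closed , Span-periodic F
    where
    %-lemma : ∀ n d → (3 * (n % T) + d) % T ≡ (3 * n + d) % T
    %-lemma n d = begin
      (3 * (n % T) + d) % T                            ≡⟨ [m+kn]%n≡m%n (3 * (n % T) + d) (3 * (n / T)) T ⟨
      (3 * (n % T) + d + 3 * (n / T) * T) % T          ≡⟨ cong (_% T) (lemma (n % T) d (n / T) T) ⟩
      (3 * (n % T + n / T * T) + d) % T                ≡⟨ cong (λ x → (3 * x + d) % T) (m≡m%n+[m/n]*n n T) ⟨
      (3 * n + d) % T                                  ∎
      where
      open ≡-Reasoning
      lemma : ∀ m d q t → 3 * m + d + 3 * q * t ≡ 3 * (m + q * t) + d
      lemma = solve-∀
    closed : Closed residues
    closed g∈ d with ∈-map⁻ residue g∈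
    ... | j , j∈ , refl = ext (λ n → cong (indicator j) (%-lemma n (toℕ d)))
      (Span-periodic (λ m → residue j (3 * m + toℕ d)))

-- Positions of the letter 1

digitsAux : ℕ → ℕ → ℕ
digitsAux zero    h = 0
digitsAux (suc f) h = 3 * digitsAux f (h / 2) + h % 2

digitsAux-fuel : ∀ {f f′ h} → h ≤ f → h ≤ f′ → digitsAux f h ≡ digitsAux f′ h
digitsAux-fuel {zero}  {zero}   z≤n z≤n = refl
digitsAux-fuel {zero}  {suc f′} z≤n z≤n =
  cong (λ x → 3 * x + 0) (digitsAux-fuel {zero} {f′} z≤n z≤n)
digitsAux-fuel {suc f} {zero}   z≤n z≤n =
  cong (λ x → 3 * x + 0) (digitsAux-fuel {f} {zero} z≤n z≤n)
digitsAux-fuel {suc f} {suc f′} {h} p q =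
  cong (λ x → 3 * x + h % 2) (digitsAux-fuel (/-suc-≤ 2 (s≤s (s≤s z≤n)) p) (/-suc-≤ 2 (s≤s (s≤s z≤n)) q))

abstract
  -- The binary digits of h, read in base 3; the h-th position of a 1 in the Cantor sequence is 2 * digits h.
  digits : ℕ → ℕ
  digits h = digitsAux h h

  digits-zero : digits 0 ≡ 0
  digits-zero = refl

  digits-one : digits 1 ≡ 1
  digits-one = refl

  digits-bit : ∀ q {b} → b < 2 → digits (2 * q + b) ≡ 3 * digits q + b
  digits-bit q {b} b< = begin
    digits (2 * q + b)                                          ≡⟨ digitsAux-fuel ℕ.≤-refl (ℕ.n≤1+n h) ⟩
    3 * digitsAux h (h / 2) + h % 2                             ≡⟨ cong₂ (λ x y → 3 * digitsAux h x + y) (/-shape 2 q b<) (%-shape 2 q b<) ⟩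
    3 * digitsAux h q + b                                       ≡⟨ cong (λ x → 3 * x + b) (digitsAux-fuel q≤h ℕ.≤-refl) ⟩
    3 * digits q + b                                            ∎
    where
    open ≡-Reasoning
    h : ℕ
    h = 2 * q + b
    q≤h : q ≤ h
    q≤h = ℕ.≤-trans (ℕ.m≤m+n q (q + 0)) (ℕ.m≤m+n (2 * q) b)

pattern 0<2 = s≤s z≤n
pattern 1<2 = s≤s (s≤s z≤n)

data Binary : ℕ → Set where
  bit : ∀ q b → b < 2 → Binary (2 * q + b)

binary : ∀ h → Binary h
binary h = subst Binary (sym eq) (bit (h / 2) (h % 2) (m%n<n h 2))
  where
  eq : h ≡ 2 * (h / 2) + h % 2
  eq = trans (m≡m%n+[m/n]*n h 2) (trans (ℕ.+-comm (h % 2) _) (cong (_+ h % 2) (ℕ.*-comm (h / 2) 2)))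

digits-suc : ∀ h → digits h < digits (suc h)
digits-suc = <-rec (λ h → digits h < digits (suc h)) go
  where
  go : ∀ h → (∀ {y} → y < h → digits y < digits (suc y)) → digits h < digits (suc h)
  go h rec with binary h
  ... | bit q 0 _ = begin-strict
    digits (2 * q + 0)       ≡⟨ digits-bit q 0<2 ⟩
    3 * digits q + 0         <⟨ ℕ.+-monoʳ-< (3 * digits q) (s≤s z≤n) ⟩
    3 * digits q + 1         ≡⟨ digits-bit q 1<2 ⟨
    digits (2 * q + 1)       ≡⟨ cong digits (ℕ.+-suc (2 * q) 0) ⟩
    digits (suc (2 * q + 0)) ∎
    where open ℕ.≤-Reasoning
  ... | bit q 1 _ = begin-strict
    digits (2 * q + 1)       ≡⟨ digits-bit q 1<2 ⟩
    3 * digits q + 1         <⟨ l₂ (rec (≤-cert 0 (ℕ.m≤m+n (suc q) q) refl (l₁ q))) ⟩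
    3 * digits (suc q) + 0   ≡⟨ digits-bit (suc q) 0<2 ⟨
    digits (2 * suc q + 0)   ≡⟨ cong digits (l₃ q) ⟩
    digits (suc (2 * q + 1)) ∎
    where
    open ℕ.≤-Reasoning
    l₁ : ∀ q → suc q + q ≡ 2 * q + 1
    l₁ = solve-∀
    l₂ : ∀ {x y} → x < y → 3 * x + 1 < 3 * y + 0
    l₂ {x} lt = ℕ.<-≤-trans (≤-cert 0 (ℕ.n≤1+n (suc (3 * x + 1))) refl (l x))
      (ℕ.≤-trans (ℕ.*-monoʳ-≤ 3 lt) (ℕ.m≤m+n _ 0))
      where
      l : ∀ x → suc (suc (3 * x + 1)) ≡ 3 * suc x
      l = solve-∀
    l₃ : ∀ q → 2 * suc q + 0 ≡ suc (2 * q + 1)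
    l₃ = solve-∀
  ... | bit q (suc (suc _)) (s≤s (s≤s ()))

digits-mono-≤ : ∀ {a b} → a ≤ b → digits a ≤ digits b
digits-mono-≤ {a} {b} a≤b with ℕ.m≤n⇒∃[o]m+o≡n a≤b
... | d , refl = go d
  where
  go : ∀ d → digits a ≤ digits (a + d)
  go zero    = ℕ.≤-reflexive (cong digits (sym (ℕ.+-identityʳ a)))
  go (suc d) = ℕ.≤-trans (go d) (ℕ.≤-trans (ℕ.<⇒≤ (digits-suc (a + d)))
    (ℕ.≤-reflexive (cong digits (sym (ℕ.+-suc a d)))))

digits-mono-< : ∀ {a b} → a < b → digits a < digits b
digits-mono-< {a} a<b = ℕ.<-≤-trans (digits-suc a) (digits-mono-≤ a<b)

digits-cancel-< : ∀ {a b} → digits a < digits b → a < b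
digits-cancel-< lt = ℕ.≰⇒> λ b≤a → ℕ.<⇒≱ lt (digits-mono-≤ b≤a)

h≤digits : ∀ h → h ≤ digits h
h≤digits zero    = z≤n
h≤digits (suc h) = ℕ.≤-<-trans (h≤digits h) (digits-suc h)

half-bound : ∀ {N} q b → 2 * q + b ≤ suc N → q ≤ N
half-bound zero    b _  = z≤n
half-bound (suc q) b le = ℕ.≤-pred (ℕ.≤-trans (≤-cert 0 (ℕ.m≤m+n (suc (suc q)) (q + b)) refl (l q b)) le)
  where
  l : ∀ q b → suc (suc q) + (q + b) ≡ 2 * suc q + b
  l = solve-∀

bits-sum : ∀ q b q′ b′ → (2 * q + b) + (2 * q′ + b′) ≡ 2 * (q + q′) + (b + b′)
bits-sum = solve-∀

digits-sum : ∀ q {b} q′ {b′} → b < 2 → b′ < 2 →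
  digits (2 * q + b) + digits (2 * q′ + b′) ≡ 3 * (digits q + digits q′) + (b + b′)
digits-sum q {b} q′ {b′} b< b′< = trans (cong₂ _+_ (digits-bit q b<) (digits-bit q′ b′<))
  (lemma (digits q) b (digits q′) b′)
  where
  lemma : ∀ x b y b′ → (3 * x + b) + (3 * y + b′) ≡ 3 * (x + y) + (b + b′)
  lemma = solve-∀

-- Without a carry the last digits simply add up. With a carry a digit sum of 2 is traded for a unit
-- of the next place, worth 3, because `digits` is strictly increasing. The inequality bounds from
-- below the distance between blocks whose indices differ by h.
digits-superadditive : ∀ a b → digits a + digits b ≤ digits (a + b)
digits-superadditive a b = go (a + b) a b (ℕ.m≤m+n a b) (ℕ.m≤n+m b a)
  where
  carry : ∀ {x y z} → x ≤ y → suc y ≤ z → 3 * x + 2 ≤ 3 * z + 0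
  carry {x} p q = ℕ.≤-trans (≤-cert 0 (ℕ.n≤1+n (3 * x + 2)) refl (l x))
    (ℕ.≤-trans (ℕ.*-monoʳ-≤ 3 (ℕ.≤-trans (s≤s p) q)) (ℕ.m≤m+n _ 0))
    where
    l : ∀ x → suc (3 * x + 2) ≡ 3 * suc x
    l = solve-∀
  open ℕ.≤-Reasoning
  go : ∀ N a b → a ≤ N → b ≤ N → digits a + digits b ≤ digits (a + b)
  go zero zero zero z≤n z≤n = ℕ.≤-reflexive (cong (_+ digits 0) digits-zero)
  go (suc N) a b p p′ with binary a | binary b
  ... | bit q 1 _ | bit q′ 1 _ = begin
    digits (2 * q + 1) + digits (2 * q′ + 1) ≡⟨ digits-sum q q′ 1<2 1<2 ⟩
    3 * (digits q + digits q′) + 2           ≤⟨ carry (go N q q′ (half-bound q 1 p) (half-bound q′ 1 p′)) (digits-suc (q + q′)) ⟩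
    3 * digits (suc (q + q′)) + 0            ≡⟨ digits-bit (suc (q + q′)) 0<2 ⟨
    digits (2 * suc (q + q′) + 0)            ≡⟨ cong digits (l q q′) ⟩
    digits ((2 * q + 1) + (2 * q′ + 1))      ∎
    where
    l : ∀ q q′ → 2 * suc (q + q′) + 0 ≡ (2 * q + 1) + (2 * q′ + 1)
    l = solve-∀
  ... | bit q 0 _ | bit q′ b b< = begin
    digits (2 * q + 0) + digits (2 * q′ + b) ≡⟨ digits-sum q q′ 0<2 b< ⟩
    3 * (digits q + digits q′) + b           ≤⟨ ℕ.+-monoˡ-≤ b (ℕ.*-monoʳ-≤ 3 (go N q q′ (half-bound q 0 p) (half-bound q′ b p′))) ⟩
    3 * digits (q + q′) + b                  ≡⟨ digits-bit (q + q′) b< ⟨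
    digits (2 * (q + q′) + b)                ≡⟨ cong digits (bits-sum q 0 q′ b) ⟨
    digits ((2 * q + 0) + (2 * q′ + b))      ∎
  ... | bit q 1 _ | bit q′ 0 _ = begin
    digits (2 * q + 1) + digits (2 * q′ + 0) ≡⟨ digits-sum q q′ 1<2 0<2 ⟩
    3 * (digits q + digits q′) + 1           ≤⟨ ℕ.+-monoˡ-≤ 1 (ℕ.*-monoʳ-≤ 3 (go N q q′ (half-bound q 1 p) (half-bound q′ 0 p′))) ⟩
    3 * digits (q + q′) + 1                  ≡⟨ digits-bit (q + q′) 1<2 ⟨
    digits (2 * (q + q′) + 1)                ≡⟨ cong digits (bits-sum q 1 q′ 0) ⟨
    digits ((2 * q + 1) + (2 * q′ + 0))      ∎
  ... | bit q (suc (suc _)) (s≤s (s≤s ())) | _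
  ... | _ | bit q′ (suc (suc _)) (s≤s (s≤s ()))

-- Sums of two such numbers have base-3 digits 0, 1, 2 without carries, so they determine the sum of the indices.
digits-sidon : ∀ a b a′ b′ → digits a + digits b ≡ digits a′ + digits b′ → a + b ≡ a′ + b′
digits-sidon a b a′ b′ =
  go (a + b + (a′ + b′)) a b a′ b′ (ℕ.m≤n⇒m≤n+o (a′ + b′) (ℕ.m≤m+n a b)) (ℕ.m≤n⇒m≤n+o (a′ + b′) (ℕ.m≤n+m b a))
    (ℕ.m≤n⇒m≤o+n (a + b) (ℕ.m≤m+n a′ b′)) (ℕ.m≤n⇒m≤o+n (a + b) (ℕ.m≤n+m b′ a′))
  where
  sum<3 : ∀ {b b′} → b < 2 → b′ < 2 → b + b′ < 3
  sum<3 (s≤s p) (s≤s q) = s≤s (p ⊕ q)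
  go : ∀ N a b a′ b′ → a ≤ N → b ≤ N → a′ ≤ N → b′ ≤ N →
    digits a + digits b ≡ digits a′ + digits b′ → a + b ≡ a′ + b′
  go zero zero zero zero zero z≤n z≤n z≤n z≤n _ = refl
  go (suc N) a b a′ b′ p₁ p₂ p₃ p₄ e with binary a | binary b | binary a′ | binary b′
  ... | bit q₁ b₁ b₁< | bit q₂ b₂ b₂< | bit q₃ b₃ b₃< | bit q₄ b₄ b₄<
    with shape-unique 3 (sum<3 b₁< b₂<) (sum<3 b₃< b₄<)
           (trans (sym (digits-sum q₁ q₂ b₁< b₂<)) (trans e (digits-sum q₃ q₄ b₃< b₄<)))
  ... | eq , br = begin
    (2 * q₁ + b₁) + (2 * q₂ + b₂) ≡⟨ bits-sum q₁ b₁ q₂ b₂ ⟩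
    2 * (q₁ + q₂) + (b₁ + b₂)     ≡⟨ cong₂ (λ x y → 2 * x + y)
                                       (go N q₁ q₂ q₃ q₄ (half-bound q₁ b₁ p₁) (half-bound q₂ b₂ p₂) (half-bound q₃ b₃ p₃) (half-bound q₄ b₄ p₄) eq) br ⟩
    2 * (q₃ + q₄) + (b₃ + b₄)     ≡⟨ bits-sum q₃ b₃ q₄ b₄ ⟨
    (2 * q₃ + b₃) + (2 * q₄ + b₄) ∎
    where open ≡-Reasoning

digits-leading : ∀ M {h} → h < 2 ^ M → digits (2 ^ M + h) ≡ 3 ^ M + digits h
digits-leading zero    {zero} _ = trans digits-one (cong suc (sym digits-zero))
digits-leading zero    {suc h} (s≤s ())
digits-leading (suc M) {h} h< with binary h
... | bit q b b< = begin
  digits (2 ^ suc M + (2 * q + b))    ≡⟨ cong digits (l (2 ^ M) q b) ⟩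
  digits (2 * (2 ^ M + q) + b)        ≡⟨ digits-bit (2 ^ M + q) b< ⟩
  3 * digits (2 ^ M + q) + b          ≡⟨ cong (λ x → 3 * x + b) (digits-leading M q<) ⟩
  3 * (3 ^ M + digits q) + b          ≡⟨ l′ (3 ^ M) (digits q) b ⟩
  3 ^ suc M + (3 * digits q + b)      ≡⟨ cong (3 ^ suc M +_) (digits-bit q b<) ⟨
  3 ^ suc M + digits (2 * q + b)      ∎
  where
  open ≡-Reasoning
  q< : q < 2 ^ M
  q< = ℕ.*-cancelˡ-< 2 q (2 ^ M) (ℕ.≤-<-trans (ℕ.m≤m+n (2 * q) b) h<)
  l : ∀ p q b → 2 * p + (2 * q + b) ≡ 2 * (p + q) + b
  l = solve-∀
  l′ : ∀ p x b → 3 * (p + x) + b ≡ 3 * p + (3 * x + b)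
  l′ = solve-∀

-- Complementary binary expansions add up without carries.
digits-complement : ∀ M a b → suc (a + b) ≡ 2 ^ M → digits a + digits b ≡ digits (a + b)
digits-complement zero zero zero e = cong (_+ digits 0) digits-zero
digits-complement zero zero (suc b) ()
digits-complement zero (suc a) b ()
digits-complement (suc M) a b e with binary a | binary b
... | bit q c c< | bit q′ c′ c′< = begin
  digits (2 * q + c) + digits (2 * q′ + c′)  ≡⟨ digits-sum q q′ c< c′< ⟩
  3 * (digits q + digits q′) + (c + c′)      ≡⟨ cong (λ x → 3 * x + (c + c′)) (digits-complement M q q′ (proj₁ e′)) ⟩
  3 * digits (q + q′) + (c + c′)             ≡⟨ digits-bit (q + q′) (ℕ.≤-reflexive (cong suc (proj₂ e′))) ⟨
  digits (2 * (q + q′) + (c + c′))           ≡⟨ cong digits (bits-sum q c q′ c′) ⟨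
  digits ((2 * q + c) + (2 * q′ + c′))       ∎
  where
  open ≡-Reasoning
  s : ℕ
  s = q + q′
  e₁ : suc (2 * s + (c + c′)) ≡ 2 * 2 ^ M
  e₁ = trans (cong suc (sym (bits-sum q c q′ c′))) e
  -- The sum of the two numbers is odd, so exactly one of the last bits is 1, and the remaining bits
  -- are again complementary.
  cases : ∀ c c′ → c < 2 → c′ < 2 → suc (2 * s + (c + c′)) ≡ 2 * 2 ^ M → suc s ≡ 2 ^ M × c + c′ ≡ 1
  cases 0 0 _ _ e = contradiction (trans (cong suc (sym (ℕ.+-identityʳ _))) e) (odd≢even s (2 ^ M))
  cases 0 1 _ _ e = ℕ.*-cancelˡ-≡ (suc s) (2 ^ M) 2 (trans (l s) e) , refl
    where
    l : ∀ x → 2 * suc x ≡ suc (2 * x + 1)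
    l = solve-∀
  cases 1 0 _ _ e = ℕ.*-cancelˡ-≡ (suc s) (2 ^ M) 2 (trans (l s) e) , refl
    where
    l : ∀ x → 2 * suc x ≡ suc (2 * x + 1)
    l = solve-∀
  cases 1 1 _ _ e = contradiction (trans (cong suc (l s)) e) (odd≢even (suc s) (2 ^ M))
    where
    l : ∀ x → 2 * suc x ≡ 2 * x + 2
    l = solve-∀
  cases (suc (suc _)) _ (s≤s (s≤s ())) _ _
  cases 0 (suc (suc _)) _ (s≤s (s≤s ())) _
  cases 1 (suc (suc _)) _ (s≤s (s≤s ())) _
  e′ : suc s ≡ 2 ^ M × c + c′ ≡ 1
  e′ = cases c c′ c< c′< e₁

-- The expansion 1...1 with M digits has the value (3 ^ M - 1) / 2 in base 3. So the prefix of
-- length 3 ^ M ends in a 1, and the block with index 2 ^ M starts beyond twice the start of its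
-- predecessor.
digits-repunit : ∀ M {a} → suc a ≡ 2 ^ M → suc (2 * digits a) ≡ 3 ^ M
digits-repunit zero {zero} e = cong (λ x → suc (2 * x)) digits-zero
digits-repunit (suc M) {a} e with binary a
... | bit q 0 _ = contradiction
  (trans (cong suc (sym (ℕ.+-identityʳ (2 * q)))) e) (odd≢even q (2 ^ M))
... | bit q 1 _ = begin
  suc (2 * digits (2 * q + 1))  ≡⟨ cong (λ x → suc (2 * x)) (digits-bit q 1<2) ⟩
  suc (2 * (3 * digits q + 1))  ≡⟨ l (digits q) ⟩
  3 * suc (2 * digits q)        ≡⟨ cong (3 *_) (digits-repunit M (ℕ.*-cancelˡ-≡ (suc q) (2 ^ M) 2 (trans (l′ q) e))) ⟩
  3 ^ suc M                     ∎
  where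
  open ≡-Reasoning
  l : ∀ x → suc (2 * (3 * x + 1)) ≡ 3 * suc (2 * x)
  l = solve-∀
  l′ : ∀ q → 2 * suc q ≡ suc (2 * q + 1)
  l′ = solve-∀
... | bit q (suc (suc _)) (s≤s (s≤s ()))

-- The balanced ternary expansion of ρ: the digits 1 and −1 go to the two sides.
digits-difference : ∀ ρ → ∃₂ λ p p′ → digits (suc p′) ≡ digits (suc p) + ρ
digits-difference = <-rec (λ ρ → ∃₂ λ p p′ → digits (suc p′) ≡ digits (suc p) + ρ) go
  where
  open ≡-Reasoning
  shape : ∀ p {c} → c < 2 → digits (suc (2 * p + suc c)) ≡ 3 * digits (suc p) + c
  shape p {c} c< = trans (cong digits (l p c)) (digits-bit (suc p) c<)
    where
    l : ∀ p c → suc (2 * p + suc c) ≡ 2 * suc p + c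
    l = solve-∀
  go : ∀ ρ → (∀ {y} → y < ρ → ∃₂ λ p p′ → digits (suc p′) ≡ digits (suc p) + y) →
       ∃₂ λ p p′ → digits (suc p′) ≡ digits (suc p) + ρ
  go ρ rec with ρ divMod 3
  go ρ rec | result zero    0F refl = 0 , 0 , sym (ℕ.+-identityʳ (digits 1))
  go ρ rec | result (suc q) 0F refl with rec {suc q} (s≤s (≤-cert 0 (ℕ.m≤m+n (suc q) (suc (2 * q))) refl (l q)))
    where
    l : ∀ q → suc q + suc (2 * q) ≡ 2 + q * 3
    l = solve-∀
  ... | p , p′ , e = 2 * p + 1 , 2 * p′ + 1 , (begin
    digits (suc (2 * p′ + 1))               ≡⟨ shape p′ 0<2 ⟩
    3 * digits (suc p′) + 0                 ≡⟨ cong (λ x → 3 * x + 0) e ⟩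
    3 * (digits (suc p) + suc q) + 0        ≡⟨ l (digits (suc p)) q ⟩
    (3 * digits (suc p) + 0) + suc q * 3    ≡⟨ cong (_+ suc q * 3) (shape p 0<2) ⟨
    digits (suc (2 * p + 1)) + suc q * 3    ∎)
    where
    l : ∀ x q → 3 * (x + suc q) + 0 ≡ (3 * x + 0) + suc q * 3
    l = solve-∀
  go ρ rec | result q 1F refl with rec {q} (s≤s (ℕ.m≤m*n q 3))
  ... | p , p′ , e = 2 * p + 1 , 2 * p′ + 2 , (begin
    digits (suc (2 * p′ + 2))               ≡⟨ shape p′ 1<2 ⟩
    3 * digits (suc p′) + 1                 ≡⟨ cong (λ x → 3 * x + 1) e ⟩
    3 * (digits (suc p) + q) + 1            ≡⟨ l (digits (suc p)) q ⟩
    (3 * digits (suc p) + 0) + (1 + q * 3)  ≡⟨ cong (_+ (1 + q * 3)) (shape p 0<2) ⟨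
    digits (suc (2 * p + 1)) + (1 + q * 3)  ∎)
    where
    l : ∀ x q → 3 * (x + q) + 1 ≡ (3 * x + 0) + (1 + q * 3)
    l = solve-∀
  -- Here 2 + q * 3 = 3 (q + 1) - 1: the quotient is raised by one, and the digit -1 is placed as a
  -- bit 1 on the side of `suc p`.
  go ρ rec | result q 2F refl with rec {suc q} (s≤s (s≤s (ℕ.m≤m*n q 3)))
  ... | p , p′ , e = 2 * p + 2 , 2 * p′ + 1 , (begin
    digits (suc (2 * p′ + 1))               ≡⟨ shape p′ 0<2 ⟩
    3 * digits (suc p′) + 0                 ≡⟨ cong (λ x → 3 * x + 0) e ⟩
    3 * (digits (suc p) + suc q) + 0        ≡⟨ l (digits (suc p)) q ⟩
    (3 * digits (suc p) + 1) + (2 + q * 3)  ≡⟨ cong (_+ (2 + q * 3)) (shape p 1<2) ⟨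
    digits (suc (2 * p + 2)) + (2 + q * 3)  ∎)
    where
    l : ∀ x q → 3 * (x + suc q) + 0 ≡ (3 * x + 1) + (2 + q * 3)
    l = solve-∀

-- Letters read from ternary digits, and the number of 1s

cantorAux-fuel : ∀ {f f′ n} → n ≤ f → n ≤ f′ → cantorAux f n ≡ cantorAux f′ n
cantorAux-fuel {zero}  {zero}   z≤n z≤n = refl
cantorAux-fuel {zero}  {suc f′} z≤n z≤n = refl
cantorAux-fuel {suc f} {zero}   z≤n z≤n = refl
cantorAux-fuel {suc f} {suc f′} {zero}  p q = refl
cantorAux-fuel {suc f} {suc f′} {suc n} p q =
  cong (if (suc n % 3) ℕ.≡ᵇ 1 then false else_) (cantorAux-fuel (/-suc-≤ 3 (s≤s (s≤s z≤n)) p) (/-suc-≤ 3 (s≤s (s≤s z≤n)) q))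

cantor-digit : ∀ q (d : Fin 3) → cantor (3 * q + toℕ d) ≡ cantor q ∧ cantor (toℕ d)
cantor-digit zero    d = refl
cantor-digit (suc q) d = begin
  cantorAux h h                                      ≡⟨ cantorAux-fuel ℕ.≤-refl (ℕ.n≤1+n h) ⟩
  cantorAux (suc h) h                                ≡⟨⟩
  (if (h % 3) ℕ.≡ᵇ 1 then false else cantorAux h (h / 3))
    ≡⟨ cong₂ (λ r m → if r ℕ.≡ᵇ 1 then false else cantorAux h m) (%-shape 3 (suc q) (Fin.toℕ<n d)) (/-shape 3 (suc q) (Fin.toℕ<n d)) ⟩
  (if toℕ d ℕ.≡ᵇ 1 then false else cantorAux h (suc q))
    ≡⟨ cong (if toℕ d ℕ.≡ᵇ 1 then false else_) (cantorAux-fuel q≤h ℕ.≤-refl) ⟩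
  (if toℕ d ℕ.≡ᵇ 1 then false else cantor (suc q))   ≡⟨ by-digit d (cantor (suc q)) ⟩
  cantor (suc q) ∧ cantor (toℕ d)                    ∎
  where
  open ≡-Reasoning
  h : ℕ
  h = 3 * suc q + toℕ d
  q≤h : suc q ≤ h
  q≤h = ℕ.≤-trans (ℕ.m≤n*m (suc q) 3) (ℕ.m≤m+n (3 * suc q) (toℕ d))
  by-digit : ∀ (d : Fin 3) b → (if toℕ d ℕ.≡ᵇ 1 then false else b) ≡ b ∧ cantor (toℕ d)
  by-digit 0F b = sym (Bool.∧-identityʳ b)
  by-digit 1F b = sym (Bool.∧-zeroʳ b)
  by-digit 2F b = sym (Bool.∧-identityʳ b)

data Ternary : ℕ → Set where
  trit : ∀ q (d : Fin 3) → Ternary (3 * q + toℕ d)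

ternary : ∀ n → Ternary n
ternary n with n divMod 3
... | result q d e = subst Ternary (sym (trans e (trans (ℕ.+-comm (toℕ d) _) (cong (_+ toℕ d) (ℕ.*-comm q 3))))) (trit q d)

-- The word of length 3 ^ J at a multiple x * 3 ^ J is the J-fold image of the letter at x.
cantor-block : ∀ J x {z} → z < 3 ^ J → cantor (3 ^ J * x + z) ≡ cantor x ∧ cantor z
cantor-block zero x {zero} _ = trans (cong cantor (trans (ℕ.+-identityʳ _) (ℕ.*-identityˡ x))) (sym (Bool.∧-identityʳ _))
cantor-block zero x {suc z} (s≤s ())
cantor-block (suc J) x {z} z< with ternary z
... | trit q d = begin
  cantor (3 ^ suc J * x + (3 * q + toℕ d))      ≡⟨ cong cantor (l (3 ^ J) x q (toℕ d)) ⟩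
  cantor (3 * (3 ^ J * x + q) + toℕ d)          ≡⟨ cantor-digit (3 ^ J * x + q) d ⟩
  cantor (3 ^ J * x + q) ∧ cantor (toℕ d)       ≡⟨ cong (_∧ cantor (toℕ d)) (cantor-block J x q<) ⟩
  (cantor x ∧ cantor q) ∧ cantor (toℕ d)        ≡⟨ Bool.∧-assoc (cantor x) (cantor q) (cantor (toℕ d)) ⟩
  cantor x ∧ (cantor q ∧ cantor (toℕ d))        ≡⟨ cong (cantor x ∧_) (cantor-digit q d) ⟨
  cantor x ∧ cantor (3 * q + toℕ d)             ∎
  where
  open ≡-Reasoning
  q< : q < 3 ^ J
  q< = ℕ.*-cancelˡ-< 3 q (3 ^ J) (ℕ.≤-<-trans (ℕ.m≤m+n (3 * q) (toℕ d)) z<)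
  l : ∀ p x q d → 3 * p * x + (3 * q + d) ≡ 3 * (p * x + q) + d
  l = solve-∀

cantor-digits : ∀ h → cantor (2 * digits h) ≡ true
cantor-digits = <-rec (λ h → cantor (2 * digits h) ≡ true) go
  where
  go : ∀ h → (∀ {y} → y < h → cantor (2 * digits y) ≡ true) → cantor (2 * digits h) ≡ true
  go zero    rec = cong (λ x → cantor (2 * x)) digits-zero
  go (suc h) rec = go′ (binary (suc h)) rec (s≤s z≤n)
    where
    twice : ∀ (d : Fin 3) q b → b < 2 → 2 * b ≡ toℕ d → 2 * digits (2 * q + b) ≡ 3 * (2 * digits q) + toℕ d
    twice d q b b< e = trans (cong (2 *_) (digits-bit q b<)) (trans (l (digits q) b) (cong (3 * (2 * digits q) +_) e))
      where
      l : ∀ x b → 2 * (3 * x + b) ≡ 3 * (2 * x) + 2 * b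
      l = solve-∀
    q<h : ∀ q b → 0 < 2 * q + b → q < 2 * q + b
    q<h zero    b lt = lt
    q<h (suc q) b _  = ≤-cert 0 (ℕ.m≤m+n (suc (suc q)) (q + b)) refl (l q b)
      where
      l : ∀ q b → suc (suc q) + (q + b) ≡ 2 * suc q + b
      l = solve-∀
    step : ∀ (d : Fin 3) q b → b < 2 → 2 * b ≡ toℕ d → cantor (toℕ d) ≡ true →
      (∀ {y} → y < 2 * q + b → cantor (2 * digits y) ≡ true) → 0 < 2 * q + b → cantor (2 * digits (2 * q + b)) ≡ true
    step d q b b< e cd rec lt = trans (cong cantor (twice d q b b< e))
      (trans (cantor-digit (2 * digits q) d) (cong₂ _∧_ (rec (q<h q b lt)) cd))
    go′ : ∀ {h} → Binary h → (∀ {y} → y < h → cantor (2 * digits y) ≡ true) → 0 < h → cantor (2 * digits h) ≡ true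
    go′ (bit q 0 _) = step 0F q 0 0<2 refl refl
    go′ (bit q 1 _) = step 2F q 1 1<2 refl refl
    go′ (bit q (suc (suc _)) (s≤s (s≤s ())))

∧-trueˡ : ∀ {a b} → a ∧ b ≡ true → a ≡ true
∧-trueˡ {true} _ = refl

cantor-true : ∀ x → cantor x ≡ true → ∃ λ h → x ≡ 2 * digits h
cantor-true = <-rec (λ x → cantor x ≡ true → ∃ λ h → x ≡ 2 * digits h) go
  where
  l₀ : ∀ x → 3 * (2 * x) + 0 ≡ 2 * (3 * x + 0)
  l₀ = solve-∀
  l₂ : ∀ x → 3 * (2 * x) + 2 ≡ 2 * (3 * x + 1)
  l₂ = solve-∀
  q< : ∀ q d → suc q < 3 * suc q + d
  q< q d = ≤-cert 0 (ℕ.m≤m+n (suc (suc q)) (1 + 2 * q + d)) refl (l q d)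
    where
    l : ∀ q d → suc (suc q) + (1 + 2 * q + d) ≡ 3 * suc q + d
    l = solve-∀
  go : ∀ x → (∀ {y} → y < x → cantor y ≡ true → ∃ λ h → y ≡ 2 * digits h) → cantor x ≡ true → ∃ λ h → x ≡ 2 * digits h
  go x rec e with ternary x
  ... | trit q 1F = contradiction (trans (sym e) (trans (cantor-digit q 1F) (Bool.∧-zeroʳ (cantor q)))) λ ()
  ... | trit zero 0F = 0 , sym (cong (2 *_) digits-zero)
  ... | trit zero 2F = 1 , sym (cong (2 *_) digits-one)
  ... | trit (suc q) 0F with rec (q< q 0) (∧-trueˡ (trans (sym (cantor-digit (suc q) 0F)) e))
  ...   | h , eq = 2 * h + 0 , trans (cong (λ y → 3 * y + 0) eq) (trans (l₀ (digits h)) (sym (cong (2 *_) (digits-bit h 0<2))))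
  go x rec e | trit (suc q) 2F with rec (q< q 2) (∧-trueˡ (trans (sym (cantor-digit (suc q) 2F)) e))
  ...   | h , eq = 2 * h + 1 , trans (cong (λ y → 3 * y + 2) eq) (trans (l₂ (digits h)) (sym (cong (2 *_) (digits-bit h 1<2))))

bitℕ : Bool → ℕ
bitℕ b = if b then 1 else 0

count : ℕ → ℕ
count zero    = 1
count (suc x) = bitℕ (cantor (suc x)) + count x

-- The numbers 2 * digits h enumerate the positions of 1s in increasing order, so counting them is
-- adjoint to the enumeration. This turns bounds on `digits` into a regular sequence.
count-galois : ∀ x {h} → h < count x ⇔ 2 * digits h ≤ x
count-galois zero {h} = mk⇔ to from
  where
  to : ∀ {h} → h < 1 → 2 * digits h ≤ 0
  to {zero} _ = ℕ.≤-reflexive (cong (2 *_) digits-zero)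
  to {suc h} (s≤s ())
  from : ∀ {h} → 2 * digits h ≤ 0 → h < 1
  from {h} le = s≤s (ℕ.≤-trans (h≤digits h) (ℕ.≤-trans (ℕ.m≤m+n _ _) le))
count-galois (suc x) {h} with cantor (suc x) in c
... | false = mk⇔ (λ lt → ℕ.m≤n⇒m≤1+n (to lt)) (λ le → from (ℕ.≤-pred (ℕ.≤∧≢⇒< le ≢)))
  where
  open Equivalence (count-galois x {h})
  ≢ : 2 * digits h ≢ suc x
  ≢ e = contradiction (trans (sym (cantor-digits h)) (trans (cong cantor e) c)) λ ()
... | true with cantor-true (suc x) c
...   | h₀ , e = mk⇔ to′ from′
  where
  -- A smaller index would belong to a 1 at or before x; a larger one would leave room for the 1
  -- with index `count x` at or before x, where it is not counted.
  new : h₀ ≡ count x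
  new with ℕ.<-cmp h₀ (count x)
  ... | tri< lt _ _ = contradiction (subst (_≤ x) (sym e) (Equivalence.to (count-galois x) lt)) (ℕ.<-irrefl refl)
  ... | tri≈ _ eq _ = eq
  ... | tri> _ _ gt = contradiction (Equivalence.from (count-galois x)
      (ℕ.≤-pred (subst (2 * digits (count x) <_) (sym e) (ℕ.*-monoʳ-< 2 (digits-mono-< gt))))) (ℕ.<-irrefl refl)
  to′ : ∀ {h} → h < suc (count x) → 2 * digits h ≤ suc x
  to′ (s≤s le) = ℕ.≤-trans (ℕ.*-monoʳ-≤ 2 (digits-mono-≤ (subst (_ ≤_) (sym new) le))) (ℕ.≤-reflexive (sym e))
  from′ : ∀ {h} → 2 * digits h ≤ suc x → h < suc (count x)
  from′ {h} le = s≤s (subst (h ≤_) new (ℕ.≮⇒≥ λ lt →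
    ℕ.<⇒≱ (digits-mono-< lt) (ℕ.*-cancelˡ-≤ 2 (ℕ.≤-trans le (ℕ.≤-reflexive e)))))

-- Each 1 is replaced by 101 and each 0 by 000, and 3 n + 2 is the last position of the image of the
-- letter at n.
count-3n+2 : ∀ n → count (3 * n + 2) ≡ 2 * count n
count-3n+2 zero    = refl
count-3n+2 (suc n) = begin
  count (3 * suc n + 2)                                              ≡⟨ cong count (l n) ⟩
  count (suc (suc (suc (3 * n + 2))))                                ≡⟨⟩
  bitℕ (cantor (3 + (3 * n + 2))) + (bitℕ (cantor (2 + (3 * n + 2))) + (bitℕ (cantor (1 + (3 * n + 2))) + count (3 * n + 2)))
    ≡⟨ cong₂ _+_ (c 2F (l n)) (cong₂ _+_ (c 1F (l₁ n)) (cong₂ _+_ (c 0F (l₀ n)) (count-3n+2 n))) ⟩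
  bitℕ (cantor (suc n) ∧ true) + (bitℕ (cantor (suc n) ∧ false) + (bitℕ (cantor (suc n) ∧ true) + 2 * count n))
    ≡⟨ by-letter (cantor (suc n)) (count n) ⟩
  2 * count (suc n)                                                  ∎
  where
  open ≡-Reasoning
  l : ∀ n → 3 * suc n + 2 ≡ suc (suc (suc (3 * n + 2)))
  l = solve-∀
  l₁ : ∀ n → 3 * suc n + 1 ≡ suc (suc (3 * n + 2))
  l₁ = solve-∀
  l₀ : ∀ n → 3 * suc n + 0 ≡ suc (3 * n + 2)
  l₀ = solve-∀
  c : ∀ (d : Fin 3) {m} → 3 * suc n + toℕ d ≡ m → bitℕ (cantor m) ≡ bitℕ (cantor (suc n) ∧ cantor (toℕ d))
  c d refl = cong bitℕ (cantor-digit (suc n) d)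
  by-letter : ∀ b k → bitℕ (b ∧ true) + (bitℕ (b ∧ false) + (bitℕ (b ∧ true) + 2 * k)) ≡ 2 * (bitℕ b + k)
  by-letter false k = refl
  by-letter true  k = lt k
    where
    lt : ∀ k → 1 + (0 + (1 + 2 * k)) ≡ 2 * (1 + k)
    lt = solve-∀

count-3n+1 : ∀ n → bitℕ (cantor n) + count (3 * n + 1) ≡ 2 * count n
count-3n+1 n = begin
  bitℕ (cantor n) + count (3 * n + 1)                ≡⟨ cong (λ b → bitℕ b + count (3 * n + 1)) (Bool.∧-identityʳ (cantor n)) ⟨
  bitℕ (cantor n ∧ true) + count (3 * n + 1)         ≡⟨ cong (λ b → bitℕ b + count (3 * n + 1)) (cantor-digit n 2F) ⟨
  bitℕ (cantor (3 * n + 2)) + count (3 * n + 1)      ≡⟨ cong (λ m → bitℕ (cantor m) + count (3 * n + 1)) (ℕ.+-suc (3 * n) 1) ⟩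
  count (suc (3 * n + 1))                            ≡⟨ cong count (ℕ.+-suc (3 * n) 1) ⟨
  count (3 * n + 2)                                  ≡⟨ count-3n+2 n ⟩
  2 * count n                                        ∎
  where open ≡-Reasoning

count-3n : ∀ n → count (3 * n + 0) ≡ count (3 * n + 1)
count-3n n = begin
  count (3 * n + 0)                                   ≡⟨⟩
  0 + count (3 * n + 0)                               ≡⟨ cong (λ b → bitℕ b + count (3 * n + 0)) (trans (cantor-digit n 1F) (Bool.∧-zeroʳ (cantor n))) ⟨
  bitℕ (cantor (3 * n + 1)) + count (3 * n + 0)       ≡⟨ cong (λ m → bitℕ (cantor m) + count (3 * n + 0)) (ℕ.+-suc (3 * n) 0) ⟩
  count (suc (3 * n + 0))                             ≡⟨ cong count (ℕ.+-suc (3 * n) 0) ⟨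
  count (3 * n + 1)                                   ∎
  where open ≡-Reasoning

LinRep-count : LinRep (λ n → pos (count n))
LinRep-count = C ∷ L ∷ [] , closed , gen (here refl)
  where
  C L : Seq
  C n = pos (count n)
  L n = pos (bitℕ (cantor n))
  C∈ : Span (C ∷ L ∷ []) C
  C∈ = gen (here refl)
  L∈ : Span (C ∷ L ∷ []) L
  L∈ = gen (there (here refl))
  2C : ∀ n → pos 2 ℤ.* C n ≡ pos (2 * count n)
  2C n = sym (ℤ.pos-* 2 (count n))
  2C-L : ∀ n → pos 2 ℤ.* C n ℤ.- 1ℤ ℤ.* L n ≡ C (3 * n + 1)
  2C-L n = trans (cong (λ x → x ℤ.- 1ℤ ℤ.* L n) (trans (2C n) (trans (cong pos (sym (count-3n+1 n))) (ℤ.pos-+ (bitℕ (cantor n)) _))))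
    (l (L n) (C (3 * n + 1)))
    where
    l : ∀ x y → x ℤ.+ y ℤ.- 1ℤ ℤ.* x ≡ y
    l = ℤ-solve
  closed : Closed (C ∷ L ∷ [])
  closed (here refl) 0F = ext (λ n → trans (2C-L n) (cong pos (sym (count-3n n)))) (Span-sub 1ℤ (scale (pos 2) C∈) L∈)
  closed (here refl) 1F = ext 2C-L (Span-sub 1ℤ (scale (pos 2) C∈) L∈)
  closed (here refl) 2F = ext (λ n → trans (2C n) (cong pos (sym (count-3n+2 n)))) (scale (pos 2) C∈)
  closed (there (here refl)) 0F = ext (λ n → cong (pos ∘ bitℕ) (sym (trans (cantor-digit n 0F) (Bool.∧-identityʳ _)))) L∈
  closed (there (here refl)) 1F = ext (λ n → cong (pos ∘ bitℕ) (sym (trans (cantor-digit n 1F) (Bool.∧-zeroʳ _)))) nil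
  closed (there (here refl)) 2F = ext (λ n → cong (pos ∘ bitℕ) (sym (trans (cantor-digit n 2F) (Bool.∧-identityʳ _)))) L∈

module _ (J : ℕ) where

  private instance
    3^J≢0 : NonZero (3 ^ J)
    3^J≢0 = ℕ.m^n≢0 3 J

  -- The number of h with T * digits h + r ≤ n. It is defined by delays, to match `delay`, and is 0
  -- for n < r, where truncated subtraction would wrongly give `count 0`, which is 1.
  countFrom : ℕ → ℕ → ℕ
  countFrom zero    n       = count (n / 3 ^ J)
  countFrom (suc r) zero    = 0
  countFrom (suc r) (suc n) = countFrom r n

  countFrom-galois : ∀ r n {h} → h < countFrom r n ⇔ 2 * 3 ^ J * digits h + r ≤ n
  countFrom-galois zero n {h} = mk⇔
    (λ lt → ℕ.≤-trans (ℕ.≤-reflexive (l (3 ^ J) (digits h)))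
              (ℕ.≤-trans (ℕ.*-monoˡ-≤ (3 ^ J) (Equivalence.to (count-galois (n / 3 ^ J)) lt)) (m/n*n≤m n (3 ^ J))))
    (λ le → Equivalence.from (count-galois (n / 3 ^ J))
              (subst (_≤ n / 3 ^ J) (m*n/n≡m (2 * digits h) (3 ^ J))
                (/-monoˡ-≤ (3 ^ J) (ℕ.≤-trans (ℕ.≤-reflexive (sym (l (3 ^ J) (digits h)))) le))))
    where
    l : ∀ p x → 2 * p * x + 0 ≡ 2 * x * p
    l = solve-∀
  countFrom-galois (suc r) zero {h} = mk⇔ (λ ())
    (λ le → contradiction (ℕ.≤-trans (ℕ.m≤n+m (suc r) (2 * 3 ^ J * digits h)) le) λ ())
  countFrom-galois (suc r) (suc n) {h} = mk⇔
    (λ lt → ℕ.≤-trans (ℕ.≤-reflexive (ℕ.+-suc _ r)) (s≤s (Equivalence.to (countFrom-galois r n) lt)))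
    (λ le → Equivalence.from (countFrom-galois r n) (ℕ.≤-pred (ℕ.≤-trans (ℕ.≤-reflexive (sym (ℕ.+-suc _ r))) le)))

  LinRep-countFrom : ∀ r → LinRep (λ n → pos (countFrom r n))
  LinRep-countFrom zero    = LinRep-div3^ J LinRep-count
  LinRep-countFrom (suc r) = LinRep-ext (λ { zero → refl ; (suc n) → refl }) (LinRep-delay (LinRep-countFrom r))

-- Windows of the Cantor sequence

fac : ℕ → ℕ → Word
fac i zero    = []
fac i (suc n) = cantor i ∷ fac (suc i) n

factorAt≡fac : ∀ i n → factorAt i n ≡ fac i n
factorAt≡fac i n = trans (List.map-applyUpTo id (λ j → cantor (i + j)) n) (go i n (λ _ → refl))
  where
  go : ∀ i n {f : ℕ → Bool} → (∀ j → f j ≡ cantor (i + j)) → applyUpTo f n ≡ fac i n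
  go i zero    e = refl
  go i (suc n) e = cong₂ _∷_ (trans (e 0) (cong cantor (ℕ.+-identityʳ i)))
    (go (suc i) n (λ j → trans (e (suc j)) (cong cantor (ℕ.+-suc i j))))

length-fac : ∀ i n → length (fac i n) ≡ n
length-fac i zero    = refl
length-fac i (suc n) = cong suc (length-fac (suc i) n)

take-fac : ∀ i ℓ n → take ℓ (fac i (ℓ + n)) ≡ fac i ℓ
take-fac i zero    n = refl
take-fac i (suc ℓ) n = cong (cantor i ∷_) (take-fac (suc i) ℓ n)

drop-fac : ∀ i m ℓ → drop m (fac i (m + ℓ)) ≡ fac (i + m) ℓ
drop-fac i zero    ℓ = cong (λ x → fac x ℓ) (sym (ℕ.+-identityʳ i))
drop-fac i (suc m) ℓ = trans (drop-fac (suc i) m ℓ) (cong (λ x → fac x ℓ) (sym (ℕ.+-suc i m)))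

suff-fac : ∀ i Q n → suff Q (fac i (Q + n)) ≡ fac (i + n) Q
suff-fac i Q n = begin
  drop (length (fac i (Q + n)) ∸ Q) (fac i (Q + n)) ≡⟨ cong (λ l → drop (l ∸ Q) (fac i (Q + n))) (length-fac i (Q + n)) ⟩
  drop (Q + n ∸ Q) (fac i (Q + n))                  ≡⟨ cong₂ (λ l m → drop l (fac i m)) (ℕ.m+n∸m≡n Q n) (ℕ.+-comm Q n) ⟩
  drop n (fac i (n + Q))                            ≡⟨ drop-fac i n Q ⟩
  fac (i + n) Q                                     ∎
  where open ≡-Reasoning

fac-cong : ∀ {i i′} ℓ → (∀ j → j < ℓ → cantor (i + j) ≡ cantor (i′ + j)) → fac i ℓ ≡ fac i′ ℓ
fac-cong         zero    e = refl
fac-cong {i} {i′} (suc ℓ) e = cong₂ _∷_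
  (trans (cong cantor (sym (ℕ.+-identityʳ i))) (trans (e 0 (s≤s z≤n)) (cong cantor (ℕ.+-identityʳ i′))))
  (fac-cong ℓ λ j j< → trans (cong cantor (sym (ℕ.+-suc i j))) (trans (e (suc j) (s≤s j<)) (cong cantor (ℕ.+-suc i′ j))))

fac-cong⁻ : ∀ {i i′} ℓ → fac i ℓ ≡ fac i′ ℓ → ∀ j → j < ℓ → cantor (i + j) ≡ cantor (i′ + j)
fac-cong⁻ {i} {i′} (suc ℓ) e zero    _ = trans (cong cantor (ℕ.+-identityʳ i))
  (trans (List.∷-injectiveˡ e) (cong cantor (sym (ℕ.+-identityʳ i′))))
fac-cong⁻ {i} {i′} (suc ℓ) e (suc j) (s≤s j<) = trans (cong cantor (ℕ.+-suc i j))
  (trans (fac-cong⁻ ℓ (List.∷-injectiveʳ e) j j<) (cong cantor (sym (ℕ.+-suc i′ j))))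

zeros : ℕ → Word
zeros n = replicate n false

fac-zeros : ∀ i ℓ → (∀ j → j < ℓ → cantor (i + j) ≡ false) → fac i ℓ ≡ zeros ℓ
fac-zeros i zero    e = refl
fac-zeros i (suc ℓ) e = cong₂ _∷_ (trans (cong cantor (sym (ℕ.+-identityʳ i))) (e 0 (s≤s z≤n)))
  (fac-zeros (suc i) ℓ λ j j< → trans (cong cantor (sym (ℕ.+-suc i j))) (e (suc j) (s≤s j<)))

isPrefix-zeros : ∀ ℓ i j → j < ℓ → cantor (i + j) ≡ true → isPrefix (zeros ℓ) (fac i ℓ) ≡ false
isPrefix-zeros (suc ℓ) i zero    _        e rewrite trans (sym (cong cantor (ℕ.+-identityʳ i))) e = refl
isPrefix-zeros (suc ℓ) i (suc j) (s≤s j<) e with cantor i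
... | true  = refl
... | false = isPrefix-zeros ℓ (suc i) j j< (trans (cong cantor (sym (ℕ.+-suc i j))) e)

isPrefix-zeros-zeros : ∀ ℓ → isPrefix (zeros ℓ) (zeros ℓ) ≡ true
isPrefix-zeros-zeros zero    = refl
isPrefix-zeros-zeros (suc ℓ) = isPrefix-zeros-zeros ℓ

isPrefix-fac : ∀ w i n → isPrefix w (fac i (length w + n)) ≡ isPrefix w (fac i (length w))
isPrefix-fac []      i n = refl
isPrefix-fac (a ∷ w) i n with eqBool a (cantor i)
... | true  = isPrefix-fac w (suc i) n
... | false = refl

isPrefix-short : ∀ w u → length u < length w → isPrefix w u ≡ false
isPrefix-short (a ∷ w) []      _ = refl
isPrefix-short (a ∷ w) (b ∷ u) (s≤s lt) with eqBool a b
... | true  = isPrefix-short w u lt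
... | false = refl

occ-short : ∀ w u → length u < length w → occ w u ≡ 0
occ-short w []      lt rewrite isPrefix-short w [] lt = refl
occ-short w (x ∷ u) lt rewrite isPrefix-short w (x ∷ u) lt = occ-short w u (ℕ.<⇒≤ lt)

indicatorℤ : Bool → ℤ
indicatorℤ b = pos (bitℕ b)

module Windows (Q : ℕ) where

  -- Occurrences of w are counted relative to those in the zero word, so that
  -- stretches of zeros contribute nothing.
  weight : Word → ℕ → ℤ
  weight w t = indicatorℤ (isPrefix w (fac t (suc Q))) ℤ.- indicatorℤ (isPrefix w (zeros (suc Q)))

  -- The summatory function of the weights, so that the normalised number of occurrences in a factor
  -- is a difference of values at its two cuts.
  Φ : Word → ℕ → ℤ
  Φ w zero    = 0ℤ
  Φ w (suc t) = Φ w t ℤ.+ weight w t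

  occ-Φ : ∀ w → length w ≡ suc Q → ∀ i n →
    pos (occ w (fac i (Q + n))) ≡ (Φ w (i + n) ℤ.- Φ w i) ℤ.+ pos n ℤ.* indicatorℤ (isPrefix w (zeros (suc Q)))
  occ-Φ w len i zero = trans (cong pos (occ-short w (fac i (Q + 0)) short))
    (trans (l (Φ w i)) (cong (λ x → (Φ w x ℤ.- Φ w i) ℤ.+ 0ℤ) (sym (ℕ.+-identityʳ i))))
    where
    short : length (fac i (Q + 0)) < length w
    short = subst₂ _<_ (sym (trans (length-fac i (Q + 0)) (ℕ.+-identityʳ Q))) (sym len) ℕ.≤-refl
    l : ∀ x → 0ℤ ≡ (x ℤ.- x) ℤ.+ 0ℤ
    l = ℤ-solve
  occ-Φ w len i (suc n) = begin
    pos (occ w (fac i (Q + suc n)))                  ≡⟨ cong (pos ∘ occ w ∘ fac i) (ℕ.+-suc Q n) ⟩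
    pos (bitℕ (isPrefix w (fac i (suc (Q + n)))) + occ w (fac (suc i) (Q + n)))
      ≡⟨ ℤ.pos-+ (bitℕ (isPrefix w (fac i (suc (Q + n))))) _ ⟩
    indicatorℤ (isPrefix w (fac i (suc (Q + n)))) ℤ.+ pos (occ w (fac (suc i) (Q + n)))
      ≡⟨ cong₂ (λ b x → indicatorℤ b ℤ.+ x) prefix (occ-Φ w len (suc i) n) ⟩
    a ℤ.+ ((Φ w (suc i + n) ℤ.- (Φ w i ℤ.+ (a ℤ.- z))) ℤ.+ pos n ℤ.* z)
      ≡⟨ l a (Φ w (suc i + n)) (Φ w i) z (pos n) ⟩
    (Φ w (suc i + n) ℤ.- Φ w i) ℤ.+ (1ℤ ℤ.+ pos n) ℤ.* z
      ≡⟨ cong (λ x → (Φ w x ℤ.- Φ w i) ℤ.+ pos (suc n) ℤ.* z) (ℕ.+-suc i n) ⟨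
    (Φ w (i + suc n) ℤ.- Φ w i) ℤ.+ pos (suc n) ℤ.* z ∎
    where
    open ≡-Reasoning
    a z : ℤ
    a = indicatorℤ (isPrefix w (fac i (suc Q)))
    z = indicatorℤ (isPrefix w (zeros (suc Q)))
    prefix : isPrefix w (fac i (suc (Q + n))) ≡ isPrefix w (fac i (suc Q))
    prefix = subst (λ k → isPrefix w (fac i (k + n)) ≡ isPrefix w (fac i k)) len (isPrefix-fac w i n)
    l : ∀ a y x z n → a ℤ.+ ((y ℤ.- (x ℤ.+ (a ℤ.- z))) ℤ.+ n ℤ.* z) ≡ (y ℤ.- x) ℤ.+ (1ℤ ℤ.+ n) ℤ.* z
    l = ℤ-solve

  -- The relation `∼[ suc Q ]` for factors of length Q + n, read off at the cuts. Such factors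
  -- contain n windows of length Q + 1, so the correction term of `occ-Φ` is common to both sides
  -- and cancels.
  Similar : ℕ → ℕ → ℕ → Set
  Similar n i i′ =
    fac i Q ≡ fac i′ Q ×
    fac (i + n) Q ≡ fac (i′ + n) Q ×
    (∀ w → length w ≡ suc Q → Φ w (i + n) ℤ.- Φ w i ≡ Φ w (i′ + n) ℤ.- Φ w i′)

  Similar⇒∼ : ∀ {n i i′} → Similar n i i′ → factorAt i (Q + n) ∼[ suc Q ] factorAt i′ (Q + n)
  Similar⇒∼ {n} {i} {i′} (p , s , o)
    rewrite factorAt≡fac i (Q + n) | factorAt≡fac i′ (Q + n) =
    trans (take-fac i Q n) (trans p (sym (take-fac i′ Q n))) ,
    trans (suff-fac i Q n) (trans s (sym (suff-fac i′ Q n))) ,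
    λ w len → ℤ.+-injective (trans (occ-Φ w len i n) (trans
      (cong (λ x → x ℤ.+ pos n ℤ.* indicatorℤ (isPrefix w (zeros (suc Q)))) (o w len)) (sym (occ-Φ w len i′ n))))

  ∼⇒Similar : ∀ {n i i′} → factorAt i (Q + n) ∼[ suc Q ] factorAt i′ (Q + n) → Similar n i i′
  ∼⇒Similar {n} {i} {i′} sim
    rewrite factorAt≡fac i (Q + n) | factorAt≡fac i′ (Q + n) =
    let p , s , o = sim in
    trans (sym (take-fac i Q n)) (trans p (take-fac i′ Q n)) ,
    trans (sym (suff-fac i Q n)) (trans s (suff-fac i′ Q n)) ,
    λ w len → cancel (trans (sym (occ-Φ w len i n)) (trans (cong pos (o w len)) (occ-Φ w len i′ n)))
    where
    cancel : ∀ {x y z} → x ℤ.+ z ≡ y ℤ.+ z → x ≡ y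
    cancel {x} {y} {z} e = trans (l x z) (trans (cong (ℤ._- z) e) (sym (l y z)))
      where
      l : ∀ x z → x ≡ x ℤ.+ z ℤ.- z
      l = ℤ-solve

  weight-cong : ∀ w {t t′} → fac t (suc Q) ≡ fac t′ (suc Q) → weight w t ≡ weight w t′
  weight-cong w e = cong (λ u → indicatorℤ (isPrefix w u) ℤ.- indicatorℤ (isPrefix w (zeros (suc Q)))) e

  weight-zeros : ∀ w {t} → fac t (suc Q) ≡ zeros (suc Q) → weight w t ≡ 0ℤ
  weight-zeros w e = trans (cong (λ u → indicatorℤ (isPrefix w u) ℤ.- indicatorℤ (isPrefix w (zeros (suc Q)))) e)
    (ℤ.+-inverseʳ (indicatorℤ (isPrefix w (zeros (suc Q)))))

  -- The surroundings of a block, and the two kinds of cuts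

  module Cuts (J : ℕ) (Q≤B : Q ≤ 3 ^ J) where

    -- A window of length Q + 1 meets the block at position Y exactly if it starts in the interval
    -- from Y - Q to Y + B - 1, so R₁ = B + Q windows meet it. The number s₀ is the first such start
    -- for the block with index 1, the model for all others; block 0 has no gap before it.
    B T R₁ s₀ : ℕ
    B  = 3 ^ J
    T  = 2 * B
    R₁ = B + Q
    s₀ = T ∸ Q

    private instance
      B≢0 : NonZero B
      B≢0 = ℕ.m^n≢0 3 J

    B>0 : 0 < B
    B>0 = ℕ.m^n>0 3 J

    Q≤T : Q ≤ T
    Q≤T = ℕ.m≤n⇒m≤n+o (B + 0) Q≤B

    s₀+Q : s₀ + Q ≡ T
    s₀+Q = ℕ.m∸n+n≡m Q≤T

    T-digits-suc : ∀ g → T * digits g + T ≤ T * digits (suc g)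
    T-digits-suc g = ℕ.≤-trans (ℕ.≤-reflexive (l T (digits g))) (ℕ.*-monoʳ-≤ T (digits-suc g))
      where
      l : ∀ t x → t * x + t ≡ t * suc x
      l = solve-∀

    -- A 1 at x would lie in some block h, where x / B is 2 * digits h; the two bounds on x would
    -- then put h strictly between g and suc g.
    gap : ∀ g x → T * digits g + B ≤ x → x < T * digits (suc g) → cantor x ≡ false
    gap g x lo hi = Bool.¬-not λ e →
      let h , eq = cantor-true (x / B) (∧-trueˡ (trans (sym (cantor-block J (x / B) (m%n<n x B))) (trans (cong cantor (sym x≡)) e)))
      in ℕ.<⇒≱ (lower h eq) (ℕ.≤-pred (upper h eq))
      where
      x≡ : x ≡ B * (x / B) + x % B
      x≡ = trans (m≡m%n+[m/n]*n x B) (trans (ℕ.+-comm (x % B) _) (cong (_+ x % B) (ℕ.*-comm (x / B) B)))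
      upper : ∀ h → x / B ≡ 2 * digits h → h < suc g
      upper h eq = digits-cancel-< (ℕ.*-cancelˡ-< T (digits h) (digits (suc g))
        (ℕ.≤-<-trans (ℕ.≤-trans (ℕ.≤-reflexive (trans (l B (digits h)) (cong (B *_) (sym eq))))
          (ℕ.≤-trans (ℕ.m≤m+n _ (x % B)) (ℕ.≤-reflexive (sym x≡)))) hi))
        where
        l : ∀ p x → 2 * p * x ≡ p * (2 * x)
        l = solve-∀
      lower : ∀ h → x / B ≡ 2 * digits h → g < h
      lower h eq = digits-cancel-< (ℕ.*-cancelˡ-< T (digits g) (digits h)
        (ℕ.+-cancelʳ-< B (T * digits g) (T * digits h) (ℕ.≤-<-trans lo
          (ℕ.<-≤-trans (ℕ.<-≤-trans (s≤s (ℕ.≤-reflexive x≡)) (ℕ.+-monoʳ-< (B * (x / B)) (m%n<n x B)))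
            (ℕ.≤-reflexive (trans (cong (λ y → B * y + B) eq) (cong (_+ B) (l B (digits h)))))))))
        where
        l : ∀ p x → p * (2 * x) ≡ 2 * p * x
        l = solve-∀

    module _ {g x} (x≡ : x + Q ≡ T * digits (suc g)) where

      private
        low : T * digits g + B ≤ x
        low = ℕ.+-cancelʳ-≤ Q (T * digits g + B) x (begin
          T * digits g + B + Q     ≤⟨ ℕ.+-monoʳ-≤ (T * digits g + B) Q≤B ⟩
          T * digits g + B + B     ≡⟨ l (T * digits g) B ⟩
          T * digits g + T         ≤⟨ T-digits-suc g ⟩
          T * digits (suc g)       ≡⟨ x≡ ⟨
          x + Q                    ∎)
          where
          open ℕ.≤-Reasoning
          l : ∀ y b → y + b + b ≡ y + 2 * b
          l = solve-∀

      cell-before : ∀ y → y < Q → cantor (x + y) ≡ false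
      cell-before y y< = gap g (x + y) (ℕ.m≤n⇒m≤n+o y low)
        (ℕ.<-≤-trans (ℕ.+-monoʳ-< x y<) (ℕ.≤-reflexive x≡))

      cell-inside : ∀ z → z < B → cantor (x + (Q + z)) ≡ cantor z
      cell-inside z z< = begin
        cantor (x + (Q + z))                     ≡⟨ cong cantor (ℕ.+-assoc x Q z) ⟨
        cantor (x + Q + z)                       ≡⟨ cong (λ y → cantor (y + z)) (trans x≡ (l B (digits (suc g)))) ⟩
        cantor (B * (2 * digits (suc g)) + z)    ≡⟨ cantor-block J (2 * digits (suc g)) z< ⟩
        cantor (2 * digits (suc g)) ∧ cantor z   ≡⟨ cong (_∧ cantor z) (cantor-digits (suc g)) ⟩
        cantor z                                 ∎
        where
        open ≡-Reasoning
        l : ∀ p x → 2 * p * x ≡ p * (2 * x)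
        l = solve-∀

      cell-after : ∀ y → Q + B ≤ y → y < Q + (B + B) → cantor (x + y) ≡ false
      cell-after y lo hi = gap (suc g) (x + y)
        (begin
          T * digits (suc g) + B     ≡⟨ cong (_+ B) (sym x≡) ⟩
          x + Q + B                  ≡⟨ ℕ.+-assoc x Q B ⟩
          x + (Q + B)                ≤⟨ ℕ.+-monoʳ-≤ x lo ⟩
          x + y                      ∎)
        (begin-strict
          x + y                      <⟨ ℕ.+-monoʳ-< x hi ⟩
          x + (Q + (B + B))          ≡⟨ l x Q B ⟩
          x + Q + T                  ≡⟨ cong (_+ T) x≡ ⟩
          T * digits (suc g) + T     ≤⟨ T-digits-suc (suc g) ⟩
          T * digits (suc (suc g))   ∎)
        where
        open ℕ.≤-Reasoning
        l : ∀ x q b → x + (q + (b + b)) ≡ x + q + 2 * b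
        l = solve-∀

    -- Every gap has length at least B ≥ Q, so a block is surrounded by Q zeros on either side, and
    -- these surroundings do not depend on its index.
    cell-cong : ∀ {g g′ x x′} → x + Q ≡ T * digits (suc g) → x′ + Q ≡ T * digits (suc g′) →
      ∀ y → y < R₁ + Q → cantor (x + y) ≡ cantor (x′ + y)
    cell-cong {x = x} {x′} e e′ y y< with y ℕ.<? Q
    ... | yes y<Q = trans (cell-before e y y<Q) (sym (cell-before e′ y y<Q))
    ... | no  y≮Q with ℕ.m≤n⇒∃[o]m+o≡n (ℕ.≮⇒≥ y≮Q)
    ...   | z , refl with z ℕ.<? B
    ...     | yes z<B = trans (cell-inside e z z<B) (sym (cell-inside e′ z z<B))
    ...     | no  z≮B = trans (cell-after e (Q + z) lo hi) (sym (cell-after e′ (Q + z) lo hi))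
      where
      lo : Q + B ≤ Q + z
      lo = ℕ.+-monoʳ-≤ Q (ℕ.≮⇒≥ z≮B)
      hi : Q + z < Q + (B + B)
      hi = ℕ.<-≤-trans y< (ℕ.≤-trans (ℕ.+-monoˡ-≤ Q (ℕ.+-monoʳ-≤ B Q≤B)) (ℕ.≤-reflexive (ℕ.+-comm (B + B) Q)))

    fac-cell-cong : ∀ {g g′ x x′} → x + Q ≡ T * digits (suc g) → x′ + Q ≡ T * digits (suc g′) →
      ∀ r ℓ → r + ℓ ≤ R₁ + Q → fac (x + r) ℓ ≡ fac (x′ + r) ℓ
    fac-cell-cong {x = x} {x′} e e′ r ℓ le = fac-cong ℓ λ j j< →
      trans (cong cantor (ℕ.+-assoc x r j)) (trans
        (cell-cong e e′ (r + j) (ℕ.<-≤-trans (ℕ.+-monoʳ-< r j<) le)) (cong cantor (sym (ℕ.+-assoc x′ r j))))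

    Φ-local : ∀ {g g′ x x′} → x + Q ≡ T * digits (suc g) → x′ + Q ≡ T * digits (suc g′) →
      ∀ w r → r ≤ R₁ → Φ w (x + r) ℤ.- Φ w x ≡ Φ w (x′ + r) ℤ.- Φ w x′
    Φ-local {x = x} {x′} e e′ w zero _ = trans (start x) (sym (start x′))
      where
      start : ∀ x → Φ w (x + 0) ℤ.- Φ w x ≡ 0ℤ
      start x = trans (cong (λ y → Φ w y ℤ.- Φ w x) (ℕ.+-identityʳ x)) (ℤ.+-inverseʳ (Φ w x))
    Φ-local {x = x} {x′} e e′ w (suc r) r< = begin
      Φ w (x + suc r) ℤ.- Φ w x                         ≡⟨ step x ⟩
      (Φ w (x + r) ℤ.- Φ w x) ℤ.+ weight w (x + r)      ≡⟨ cong₂ ℤ._+_ (Φ-local e e′ w r (ℕ.<⇒≤ r<))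
                                                           (weight-cong w (fac-cell-cong e e′ r (suc Q) le)) ⟩
      (Φ w (x′ + r) ℤ.- Φ w x′) ℤ.+ weight w (x′ + r)   ≡⟨ step x′ ⟨
      Φ w (x′ + suc r) ℤ.- Φ w x′                       ∎
      where
      open ≡-Reasoning
      le : r + suc Q ≤ R₁ + Q
      le = ℕ.≤-trans (ℕ.≤-reflexive (ℕ.+-suc r Q)) (ℕ.+-monoˡ-≤ Q r<)
      l : ∀ a b c → (a ℤ.+ b) ℤ.- c ≡ (a ℤ.- c) ℤ.+ b
      l = ℤ-solve
      step : ∀ x → Φ w (x + suc r) ℤ.- Φ w x ≡ (Φ w (x + r) ℤ.- Φ w x) ℤ.+ weight w (x + r)
      step x = trans (cong (λ y → Φ w y ℤ.- Φ w x) (ℕ.+-suc x r)) (l (Φ w (x + r)) (weight w (x + r)) (Φ w x))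

    Φ-gap : ∀ g w a d → T * digits g + B ≤ a → a + d + Q ≤ T * digits (suc g) → Φ w (a + d) ≡ Φ w a
    Φ-gap g w a zero    lo hi = cong (Φ w) (ℕ.+-identityʳ a)
    Φ-gap g w a (suc d) lo hi = begin
      Φ w (a + suc d)                   ≡⟨ cong (Φ w) (ℕ.+-suc a d) ⟩
      Φ w (a + d) ℤ.+ weight w (a + d)  ≡⟨ cong₂ ℤ._+_ (Φ-gap g w a d lo (ℕ.<⇒≤ hi′)) (weight-zeros w (fac-zeros (a + d) (suc Q) cells)) ⟩
      Φ w a ℤ.+ 0ℤ                      ≡⟨ ℤ.+-identityʳ (Φ w a) ⟩
      Φ w a                             ∎
      where
      open ≡-Reasoning
      hi′ : a + d + Q < T * digits (suc g)
      hi′ = ℕ.≤-trans (ℕ.≤-reflexive (cong (_+ Q) (sym (ℕ.+-suc a d)))) hi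
      cells : ∀ j → j < suc Q → cantor (a + d + j) ≡ false
      cells j (s≤s j≤) = gap g (a + d + j) (ℕ.m≤n⇒m≤n+o j (ℕ.m≤n⇒m≤n+o d lo))
        (ℕ.≤-<-trans (ℕ.+-monoʳ-≤ (a + d) j≤) hi′)

    Φ-gap-≤ : ∀ g w {a b} → T * digits g + B ≤ a → a ≤ b → b + Q ≤ T * digits (suc g) → Φ w b ≡ Φ w a
    Φ-gap-≤ g w {a} lo a≤b hi with ℕ.m≤n⇒∃[o]m+o≡n a≤b
    ... | d , refl = Φ-gap g w a d lo hi

    base : ℕ → ℕ
    base g = T * digits (suc g) ∸ Q

    base+Q : ∀ g → base g + Q ≡ T * digits (suc g)
    base+Q g = ℕ.m∸n+n≡m (ℕ.≤-trans Q≤T (ℕ.≤-trans (ℕ.m≤n+m T (T * digits g)) (T-digits-suc g)))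

    s₀-base : s₀ + Q ≡ T * digits 1
    s₀-base = trans s₀+Q (sym (trans (cong (T *_) digits-one) (ℕ.*-identityʳ T)))

    base+R₁ : ∀ g → base g + R₁ ≡ T * digits (suc g) + B
    base+R₁ g = trans (l (base g) B Q) (cong (_+ B) (base+Q g))
      where
      l : ∀ x b q → x + (b + q) ≡ x + q + b
      l = solve-∀

    -- The total weight of the R₁ windows that meet one block, hence what passing a whole block adds
    -- to Φ.
    κ : Word → ℤ
    κ w = Φ w (s₀ + R₁) ℤ.- Φ w s₀

    -- Block g ends before T * digits g + B. Thus the whole window of length Q at i, and not only
    -- its first letter, lies in the gap between blocks g and suc g.
    record GapAt (i g : ℕ) : Set where
      constructor gapAt
      field
        lower : T * digits g + B ≤ i
        upper : i + Q ≤ T * digits (suc g)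

    -- Stated with i + Q to avoid the subtraction in `base`. The offsets 0 and R₁ are the adjacent
    -- ends of the two gaps (`gap-end`, `gap-start`); only those between are `Inner` later.
    ExactAt : ℕ → ℕ → ℕ → Set
    ExactAt i g r = i + Q ≡ T * digits (suc g) + r

    gap-end : ∀ g → GapAt (base g) g
    gap-end g = gapAt (ℕ.+-cancelʳ-≤ Q _ _ (begin
        T * digits g + B + Q     ≤⟨ ℕ.+-monoʳ-≤ (T * digits g + B) Q≤B ⟩
        T * digits g + B + B     ≡⟨ l (T * digits g) B ⟩
        T * digits g + T         ≤⟨ T-digits-suc g ⟩
        T * digits (suc g)       ≡⟨ base+Q g ⟨
        base g + Q               ∎))
      (ℕ.≤-reflexive (base+Q g))
      where
      open ℕ.≤-Reasoning
      l : ∀ y b → y + b + b ≡ y + 2 * b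
      l = solve-∀

    gap-start : ∀ g → GapAt (base g + R₁) (suc g)
    gap-start g = gapAt (ℕ.≤-reflexive (sym (base+R₁ g))) (begin
        base g + R₁ + Q                ≡⟨ cong (_+ Q) (base+R₁ g) ⟩
        T * digits (suc g) + B + Q     ≤⟨ ℕ.+-monoʳ-≤ (T * digits (suc g) + B) Q≤B ⟩
        T * digits (suc g) + B + B     ≡⟨ l (T * digits (suc g)) B ⟩
        T * digits (suc g) + T         ≤⟨ T-digits-suc (suc g) ⟩
        T * digits (suc (suc g))       ∎)
      where
      open ℕ.≤-Reasoning
      l : ∀ y b → y + b + b ≡ y + 2 * b
      l = solve-∀

    fac-gap : ∀ {i g} → GapAt i g → fac i Q ≡ zeros Q
    fac-gap {i} {g} (gapAt lo hi) = fac-zeros i Q λ j j< →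
      gap g (i + j) (ℕ.m≤n⇒m≤n+o j lo) (ℕ.<-≤-trans (ℕ.+-monoʳ-< i j<) hi)

    s₀≡base0 : s₀ ≡ base 0
    s₀≡base0 = ℕ.+-cancelʳ-≡ Q s₀ (base 0) (trans s₀-base (sym (base+Q 0)))

    Φ-base : ∀ w g → Φ w (base g) ≡ κ w ℤ.* pos g ℤ.+ Φ w s₀
    Φ-base w zero = trans (cong (Φ w) (sym s₀≡base0)) (sym (trans (cong (λ x → x ℤ.+ Φ w s₀) (ℤ.*-zeroʳ (κ w))) (ℤ.+-identityˡ _)))
    Φ-base w (suc g) = begin
      Φ w (base (suc g))                                       ≡⟨ Φ-gap-≤ (suc g) w (GapAt.lower (gap-start g)) le (GapAt.upper (gap-end (suc g))) ⟩
      Φ w (base g + R₁)                                        ≡⟨ l (Φ w (base g + R₁)) (Φ w (base g)) ⟩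
      (Φ w (base g + R₁) ℤ.- Φ w (base g)) ℤ.+ Φ w (base g)    ≡⟨ cong₂ ℤ._+_ (Φ-local (base+Q g) s₀-base w R₁ ℕ.≤-refl) (Φ-base w g) ⟩
      κ w ℤ.+ (κ w ℤ.* pos g ℤ.+ Φ w s₀)                       ≡⟨ l′ (κ w) (pos g) (Φ w s₀) ⟩
      κ w ℤ.* (1ℤ ℤ.+ pos g) ℤ.+ Φ w s₀                        ∎
      where
      open ≡-Reasoning
      le : base g + R₁ ≤ base (suc g)
      le = ℕ.+-cancelʳ-≤ Q _ _ (ℕ.≤-trans (GapAt.upper (gap-start g)) (ℕ.≤-reflexive (sym (base+Q (suc g)))))
      l : ∀ x y → x ≡ (x ℤ.- y) ℤ.+ y
      l = ℤ-solve
      l′ : ∀ k g s → k ℤ.+ (k ℤ.* g ℤ.+ s) ≡ k ℤ.* (1ℤ ℤ.+ g) ℤ.+ s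
      l′ = ℤ-solve

    -- Up to the contributions κ of whole blocks, the cut at i looks like the cut at s₀ + r at the first block.
    record Cut (i g r : ℕ) : Set where
      constructor cut
      field
        window : fac i Q ≡ fac (s₀ + r) Q
        height : ∀ w → Φ w i ≡ κ w ℤ.* pos g ℤ.+ Φ w (s₀ + r)

    exact-position : ∀ {i g r} → ExactAt i g r → i ≡ base g + r
    exact-position {i} {g} {r} e = ℕ.+-cancelʳ-≡ Q i (base g + r) (trans e
      (trans (cong (_+ r) (sym (base+Q g))) (l (base g) Q r)))
      where
      l : ∀ x q r → x + q + r ≡ x + r + q
      l = solve-∀

    exact-cut : ∀ {i g r} → r ≤ R₁ → ExactAt i g r → Cut i g r
    exact-cut {i} {g} {r} r≤ e with exact-position {i} {g} {r} e
    ... | refl = cut (fac-cell-cong (base+Q g) s₀-base r Q (ℕ.+-monoˡ-≤ Q r≤)) λ w → begin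
      Φ w (base g + r)                                         ≡⟨ l (Φ w (base g + r)) (Φ w (base g)) ⟩
      (Φ w (base g + r) ℤ.- Φ w (base g)) ℤ.+ Φ w (base g)     ≡⟨ cong₂ ℤ._+_ (Φ-local (base+Q g) s₀-base w r r≤) (Φ-base w g) ⟩
      (Φ w (s₀ + r) ℤ.- Φ w s₀) ℤ.+ (κ w ℤ.* pos g ℤ.+ Φ w s₀) ≡⟨ l′ (Φ w (s₀ + r)) (Φ w s₀) (κ w ℤ.* pos g) ⟩
      κ w ℤ.* pos g ℤ.+ Φ w (s₀ + r)                           ∎
      where
      open ≡-Reasoning
      l : ∀ x y → x ≡ (x ℤ.- y) ℤ.+ y
      l = ℤ-solve
      l′ : ∀ x s k → (x ℤ.- s) ℤ.+ (k ℤ.+ s) ≡ k ℤ.+ x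
      l′ = ℤ-solve

    -- A cut in a gap has two descriptions, since Φ is constant there: offset 0 at the next block,
    -- or offset R₁ at the previous one (`gap-cut₁`). Which one fits depends on the side of the
    -- factor.
    gap-cut₀ : ∀ {i g} → GapAt i g → Cut i g 0
    gap-cut₀ {i} {g} G@(gapAt lo hi) = cut
      (trans (fac-gap G) (sym (trans (cong (λ x → fac x Q) s₀+0) (fac-gap (gap-end 0)))))
      λ w → trans (sym (Φ-gap-≤ g w lo le (GapAt.upper (gap-end g))))
        (trans (Φ-base w g) (cong (λ x → κ w ℤ.* pos g ℤ.+ Φ w x) (sym (ℕ.+-identityʳ s₀))))
      where
      s₀+0 : s₀ + 0 ≡ base 0
      s₀+0 = trans (ℕ.+-identityʳ s₀) s₀≡base0
      le : i ≤ base g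
      le = ℕ.+-cancelʳ-≤ Q i (base g) (ℕ.≤-trans hi (ℕ.≤-reflexive (sym (base+Q g))))

    gap-cut₁ : ∀ {i g} → GapAt i (suc g) → Cut i g R₁
    gap-cut₁ {i} {g} G@(gapAt lo hi) with exact-cut {base g + R₁} {g} {R₁} ℕ.≤-refl e
      where
      e : base g + R₁ + Q ≡ T * digits (suc g) + R₁
      e = trans (l (base g) R₁ Q) (cong (_+ R₁) (base+Q g))
        where
        l : ∀ x r q → x + r + q ≡ x + q + r
        l = solve-∀
    ... | cut win hgt = cut
      (trans (fac-gap G) (trans (sym (fac-gap (gap-start g))) win))
      λ w → trans (Φ-gap-≤ (suc g) w (GapAt.lower (gap-start g))
        (ℕ.≤-trans (ℕ.≤-reflexive (base+R₁ g)) lo) hi) (hgt w)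

-- The least block length and recurrence of factors

least-power : ∀ Q → ∃ λ J → Q ≤ 3 ^ J × (∀ J′ → J ≡ suc J′ → 3 ^ J′ < Q)
least-power Q = descend Q (ℕ.<⇒≤ (n<3^n Q))
  where
  descend : ∀ J → Q ≤ 3 ^ J → ∃ λ J → Q ≤ 3 ^ J × (∀ J′ → J ≡ suc J′ → 3 ^ J′ < Q)
  descend zero    le = 0 , le , λ _ ()
  descend (suc J) le with Q ℕ.≤? 3 ^ J
  ... | yes le′ = descend J le′
  ... | no  ≰   = suc J , le , λ { _ refl → ℕ.≰⇒> ≰ }

cantor-last : ∀ J {z} → suc z ≡ 3 ^ J → cantor z ≡ true
cantor-last J {z} e = trans (cong cantor (ℕ.suc-injective (trans e (sym (digits-repunit J {a} a≡))))) (cantor-digits a)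
  where
  a : ℕ
  a = 2 ^ J ∸ 1
  a≡ : suc a ≡ 2 ^ J
  a≡ = ℕ.m+[n∸m]≡n (ℕ.m^n>0 2 J)

-- Minimality of J makes every run of zeros inside the J-th block shorter than Q.
one-nearby : ∀ J {Q r} → (∀ J′ → J ≡ suc J′ → 3 ^ J′ < Q) → 1 ≤ r → r < 3 ^ J + Q →
  ∃ λ z → z < 3 ^ J × cantor z ≡ true × z < r × r ≤ z + Q
one-nearby zero {Q} {r} least 1≤r r< = 0 , s≤s z≤n , refl , 1≤r , ℕ.≤-pred r<
-- The candidates are the ends of the outer thirds: 0, 3 ^ J′ - 1, 2 * 3 ^ J′ and 3 ^ suc J′ - 1.
-- All carry a 1, and the widest step between neighbours, 3 ^ J′ + 1 in the middle, is at most Q by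
-- minimality.
one-nearby (suc J′) {Q} {r} least 1≤r r< with r ℕ.≤? Q | r ℕ.≤? 3 ^ J′ ∸ 1 + Q | r ℕ.≤? 3 ^ J′ * 2 + Q
...   | yes r≤ | _ | _ = 0 , ℕ.m^n>0 3 (suc J′) , refl , 1≤r , r≤
...   | no r≰ | yes r≤ | _ =
  z , ℕ.≤-trans (ℕ.≤-reflexive z+1) (ℕ.m≤m+n (3 ^ J′) _) , cantor-last J′ z+1 ,
  ℕ.≤-trans (ℕ.≤-reflexive z+1) (ℕ.≤-trans (ℕ.<⇒≤ (least J′ refl)) (ℕ.<⇒≤ (ℕ.≰⇒> r≰))) , r≤
  where
  z : ℕ
  z = 3 ^ J′ ∸ 1
  z+1 : suc z ≡ 3 ^ J′
  z+1 = ℕ.m+[n∸m]≡n (ℕ.m^n>0 3 J′)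
...   | no _ | no r≰ | yes r≤ =
  3 ^ J′ * 2 , ≤-cert 0 (ℕ.+-monoʳ-≤ (3 ^ J′ * 2) (ℕ.m^n>0 3 J′)) (l₁ (3 ^ J′)) (l₂ (3 ^ J′)) ,
  trans (cong cantor (sym (ℕ.+-identityʳ (3 ^ J′ * 2)))) (cantor-block J′ 2 (ℕ.m^n>0 3 J′)) ,
  ℕ.≤-<-trans 2p≤ (ℕ.≰⇒> r≰) , r≤
  where
  z+1 : suc (3 ^ J′ ∸ 1) ≡ 3 ^ J′
  z+1 = ℕ.m+[n∸m]≡n (ℕ.m^n>0 3 J′)
  2p≤ : 3 ^ J′ * 2 ≤ 3 ^ J′ ∸ 1 + Q
  2p≤ = ℕ.≤-trans (ℕ.≤-reflexive (trans (l (3 ^ J′)) (trans (cong (_+ 3 ^ J′) (sym z+1)) (sym (ℕ.+-suc (3 ^ J′ ∸ 1) (3 ^ J′))))))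
    (ℕ.+-monoʳ-≤ (3 ^ J′ ∸ 1) (least J′ refl))
    where
    l : ∀ p → p * 2 ≡ p + p
    l = solve-∀
  l₁ : ∀ p → p * 2 + 1 ≡ 0 + suc (p * 2)
  l₁ = solve-∀
  l₂ : ∀ p → p * 2 + p ≡ 0 + 3 * p
  l₂ = solve-∀
...   | no _ | no _ | no r≰ =
  3 ^ suc J′ ∸ 1 , ℕ.≤-reflexive z+1 , cantor-last (suc J′) z+1 ,
  ℕ.≤-trans (ℕ.≤-reflexive z+1) (ℕ.<⇒≤ (ℕ.≤-<-trans 3p≤ (ℕ.≰⇒> r≰))) ,
  ℕ.≤-pred (ℕ.≤-trans r< (ℕ.≤-reflexive (cong (_+ Q) (sym z+1))))
  where
  z+1 : suc (3 ^ suc J′ ∸ 1) ≡ 3 ^ suc J′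
  z+1 = ℕ.m+[n∸m]≡n (ℕ.m^n>0 3 (suc J′))
  3p≤ : 3 ^ suc J′ ≤ 3 ^ J′ * 2 + Q
  3p≤ = ℕ.≤-trans (ℕ.≤-reflexive (l (3 ^ J′))) (ℕ.+-monoʳ-≤ (3 ^ J′ * 2) (ℕ.<⇒≤ (least J′ refl)))
    where
    l : ∀ p → 3 * p ≡ p * 2 + p
    l = solve-∀

-- The letter at 2 is a 1, so the prefix of length 3 ^ M recurs at 2 * 3 ^ M. Hence any factor may
-- be taken behind block 0, where every cut is covered by `cover`.
fac-shift : ∀ i n M → i + n ≤ 3 ^ M → factorAt i n ≡ factorAt (3 ^ M * 2 + i) n
fac-shift i n M le = trans (factorAt≡fac i n) (trans (fac-cong n cells) (sym (factorAt≡fac (3 ^ M * 2 + i) n)))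
  where
  cells : ∀ j → j < n → cantor (i + j) ≡ cantor (3 ^ M * 2 + i + j)
  cells j j< = sym (trans (cong cantor (ℕ.+-assoc (3 ^ M * 2) i j))
    (cantor-block M 2 (ℕ.<-≤-trans (ℕ.+-monoʳ-< i j<) le)))

-- What prefix, suffix and counts reveal about the cuts

module Classes (Q J : ℕ) (Q≤B : Q ≤ 3 ^ J) (least : ∀ J′ → J ≡ suc J′ → 3 ^ J′ < Q) where

  open Windows Q
  open Cuts J Q≤B

  private instance
    B≢0 : NonZero B
    B≢0 = ℕ.m^n≢0 3 J
    T≢0 : NonZero T
    T≢0 = ℕ.m*n≢0 2 B

  R : ℕ
  R = R₁ ∸ 1

  R₁>0 : 0 < R₁
  R₁>0 = ℕ.m≤n⇒m≤n+o Q B>0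

  suc-R : suc R ≡ R₁
  suc-R = ℕ.m+[n∸m]≡n R₁>0

  R₁≤T : R₁ ≤ T
  R₁≤T = ℕ.+-monoʳ-≤ B (ℕ.m≤n⇒m≤n+o 0 Q≤B)

  private instance
    R₁≢0 : NonZero R₁
    R₁≢0 = ℕ.>-nonZero R₁>0

  Inner : ℕ → Set
  Inner r = 1 ≤ r × r < R₁

  Covered : ℕ → Set
  Covered i = ∃ λ g → GapAt i g ⊎ ∃ λ r → Inner r × ExactAt i g r

  settle : ∀ {i g r} → 1 ≤ r → r ≤ R₁ → ExactAt i g r → Covered i
  settle {i} {g} {r} 1≤r r≤ e with r ℕ.<? R₁
  ... | yes r< = g , inj₂ (r , (1≤r , r<) , e)
  ... | no  r≮ with ℕ.≤-antisym r≤ (ℕ.≮⇒≥ r≮)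
  ...   | refl = suc g , inj₁ (subst (λ x → GapAt x (suc g)) (sym (exact-position e)) (gap-start g))

  cover-from : ∀ d → Covered (B + d)
  cover-from zero = 0 , inj₁ (gapAt
    (ℕ.≤-reflexive (trans (cong (λ x → T * x + B) digits-zero) (l T B)))
    (ℕ.≤-trans (ℕ.≤-reflexive (cong (_+ Q) (ℕ.+-identityʳ B)))
      (ℕ.≤-trans R₁≤T (ℕ.≤-reflexive (sym (trans (cong (T *_) digits-one) (ℕ.*-identityʳ T)))))))
    where
    l : ∀ t b → t * 0 + b ≡ b + 0
    l = solve-∀
  cover-from (suc d) rewrite ℕ.+-suc B d with cover-from d
  ... | g , inj₂ (r , (1≤r , r<) , e) = settle (s≤s z≤n) r< (trans (cong suc e) (sym (ℕ.+-suc _ r)))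
  ... | g , inj₁ (gapAt lo hi) with B + d + Q ℕ.<? T * digits (suc g)
  ...   | yes lt = g , inj₁ (gapAt (ℕ.m≤n⇒m≤1+n lo) lt)
  ...   | no  ≮  = settle (s≤s z≤n) R₁>0 (trans (cong suc (ℕ.≤-antisym hi (ℕ.≮⇒≥ ≮))) (ℕ.+-comm 1 _))

  cover : ∀ {i} → B ≤ i → Covered i
  cover B≤i with ℕ.m≤n⇒∃[o]m+o≡n B≤i
  ... | d , refl = cover-from d

  ones-cell : ∀ g {r} → Inner r → ∃₂ λ j z → j < Q × z < B × r + j ≡ Q + z × cantor (base g + r + j) ≡ true
  ones-cell g {r} inner with one-nearby J least (proj₁ inner) (proj₂ inner)
  ... | z , z<B , cz , z<r , r≤ with ℕ.m≤n⇒∃[o]m+o≡n r≤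
  ... | j , e = j , z , j< , z<B , e′ ,
    trans (cong cantor (trans (ℕ.+-assoc (base g) r j) (cong (base g +_) e′))) (trans (cell-inside (base+Q g) z z<B) cz)
    where
    e′ : r + j ≡ Q + z
    e′ = trans e (ℕ.+-comm z Q)
    j< : j < Q
    j< = ℕ.+-cancelˡ-< r j Q (ℕ.<-≤-trans (s≤s (ℕ.≤-reflexive e′))
      (ℕ.≤-trans (ℕ.≤-reflexive (sym (ℕ.+-suc Q z))) (ℕ.≤-trans (ℕ.+-monoʳ-≤ Q z<r) (ℕ.≤-reflexive (ℕ.+-comm Q r)))))

  -- This is what minimality of J is for: a cut in a gap shows a zero window and an inner cut does
  -- not, so equivalent factors have cuts of the same kinds.
  fac-inner : ∀ {r} → Inner r → fac (s₀ + r) Q ≢ zeros Q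
  fac-inner {r} inner e with ones-cell 0 inner
  ... | j , z , j< , _ , _ , c = contradiction
    (trans (sym (isPrefix-zeros Q (s₀ + r) j j< (subst (λ x → cantor (x + r + j) ≡ true) (sym s₀≡base0) c)))
      (trans (cong (isPrefix (zeros Q)) e) (isPrefix-zeros-zeros Q))) λ ()

  -- The window at r has a 1 from position z < B of the block. The equal letter in the other window
  -- cannot belong to the Q zeros before the block, so it lies at least Q behind `base`, and the two
  -- offsets differ by less than B in this direction.
  inner-close : ∀ {r r′} → Inner r → fac (s₀ + r) Q ≡ fac (s₀ + r′) Q → r < r′ + B
  inner-close {r} {r′} inner e with ones-cell 0 inner
  ... | j , z , j< , z<B , r+j , c with r′ + j ℕ.<? Q
  ...   | yes lt = contradiction
    (trans (sym c) (trans (subst (λ x → cantor (x + r + j) ≡ cantor (x + r′ + j)) s₀≡base0 (fac-cong⁻ Q e j j<))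
      (trans (cong cantor (ℕ.+-assoc (base 0) r′ j)) (cell-before (base+Q 0) (r′ + j) lt)))) λ ()
  ...   | no ≮ = ℕ.+-cancelʳ-< j r (r′ + B) (begin-strict
    r + j         ≡⟨ r+j ⟩
    Q + z         <⟨ ℕ.+-monoʳ-< Q z<B ⟩
    Q + B         ≤⟨ ℕ.+-monoˡ-≤ B (ℕ.≮⇒≥ ≮) ⟩
    r′ + j + B    ≡⟨ l r′ j B ⟩
    r′ + B + j    ∎)
    where
    open ℕ.≤-Reasoning
    l : ∀ a b c → a + b + c ≡ a + c + b
    l = solve-∀

  window-hit : ∀ r → r < R₁ → ∃ λ j → j < suc Q × cantor (s₀ + r + j) ≡ true
  window-hit (suc r) r< with ones-cell 0 (s≤s z≤n , r<)
  ... | j , _ , j< , _ , _ , c = j , ℕ.m<n⇒m<1+n j< , subst (λ x → cantor (x + suc r + j) ≡ true) (sym s₀≡base0) c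
  -- At offset 0 the first Q letters are zeros; the additional letter of the longer window is the
  -- first letter of the block, a 1.
  window-hit zero _ = Q , ℕ.≤-refl , trans (cong cantor (l s₀ Q))
    (subst (λ x → cantor (x + (Q + 0)) ≡ true) (sym s₀≡base0) (cell-inside (base+Q 0) 0 B>0))
    where
    l : ∀ x q → x + 0 + q ≡ x + (q + 0)
    l = solve-∀

  w₀ : Word
  w₀ = zeros (suc Q)

  -- Each of the first R₁ windows of length Q + 1 from s₀ on contains a 1 and so has weight -1 for
  -- the zero word. This word alone therefore measures offsets.
  Φ-zeros : ∀ r → r ≤ R₁ → Φ w₀ (s₀ + r) ≡ Φ w₀ s₀ ℤ.- pos r
  Φ-zeros zero    _  = trans (cong (Φ w₀) (ℕ.+-identityʳ s₀)) (sym (ℤ.+-identityʳ _))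
  Φ-zeros (suc r) r< = begin
    Φ w₀ (s₀ + suc r)                          ≡⟨ cong (Φ w₀) (ℕ.+-suc s₀ r) ⟩
    Φ w₀ (s₀ + r) ℤ.+ weight w₀ (s₀ + r)       ≡⟨ cong₂ ℤ._+_ (Φ-zeros r (ℕ.<⇒≤ r<)) weight≡ ⟩
    (Φ w₀ s₀ ℤ.- pos r) ℤ.+ (0ℤ ℤ.- 1ℤ)        ≡⟨ l (Φ w₀ s₀) (pos r) ⟩
    Φ w₀ s₀ ℤ.- (1ℤ ℤ.+ pos r)                 ∎
    where
    open ≡-Reasoning
    l : ∀ x y → (x ℤ.- y) ℤ.+ (0ℤ ℤ.- 1ℤ) ≡ x ℤ.- (1ℤ ℤ.+ y)
    l = ℤ-solve
    weight≡ : weight w₀ (s₀ + r) ≡ 0ℤ ℤ.- 1ℤ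
    weight≡ = let j , j< , c = window-hit r r< in
      cong₂ (λ a b → indicatorℤ a ℤ.- indicatorℤ b) (isPrefix-zeros (suc Q) (s₀ + r) j j< c) (isPrefix-zeros-zeros (suc Q))

  cuts-Φ : ∀ {i e g g′ r r′} → Cut i g r → Cut e g′ r′ → ∀ w →
    Φ w e ℤ.- Φ w i ≡ κ w ℤ.* (pos g′ ℤ.- pos g) ℤ.+ (Φ w (s₀ + r′) ℤ.- Φ w (s₀ + r))
  cuts-Φ {g = g} {g′} {r} {r′} (cut _ h) (cut _ h′) w =
    trans (cong₂ ℤ._-_ (h′ w) (h w)) (l (κ w) (pos g′) (pos g) (Φ w (s₀ + r′)) (Φ w (s₀ + r)))
    where
    l : ∀ k a b x y → (k ℤ.* a ℤ.+ x) ℤ.- (k ℤ.* b ℤ.+ y) ≡ k ℤ.* (a ℤ.- b) ℤ.+ (x ℤ.- y)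
    l = ℤ-solve

  cuts⇒Similar : ∀ {n i i₂ g g′ g₂ g₂′ r r′} → Cut i g r → Cut (i + n) g′ r′ → Cut i₂ g₂ r → Cut (i₂ + n) g₂′ r′ →
    g′ + g₂ ≡ g₂′ + g → Similar n i i₂
  cuts⇒Similar {g = g} {g′} {g₂} {g₂′} {r} {r′} c c′ c₂ c₂′ e =
    trans (Cut.window c) (sym (Cut.window c₂)) ,
    trans (Cut.window c′) (sym (Cut.window c₂′)) ,
    λ w _ → trans (cuts-Φ c c′ w)
      (trans (cong (λ x → κ w ℤ.* x ℤ.+ (Φ w (s₀ + r′) ℤ.- Φ w (s₀ + r))) steps) (sym (cuts-Φ c₂ c₂′ w)))
    where
    steps : pos g′ ℤ.- pos g ≡ pos g₂′ ℤ.- pos g₂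
    steps = trans (l (pos g′) (pos g) (pos g₂)) (trans (cong (λ x → x ℤ.- pos g ℤ.- pos g₂)
      (trans (sym (ℤ.pos-+ g′ g₂)) (trans (cong pos e) (ℤ.pos-+ g₂′ g)))) (l′ (pos g₂′) (pos g) (pos g₂)))
      where
      l : ∀ a b c → a ℤ.- b ≡ (a ℤ.+ c) ℤ.- b ℤ.- c
      l = ℤ-solve
      l′ : ∀ a b c → (a ℤ.+ b) ℤ.- b ℤ.- c ≡ a ℤ.- c
      l′ = ℤ-solve

  -- The number of windows of length suc Q that contain a 1.
  Index : ℕ → ℕ → ℕ → Set
  Index n i v = Φ w₀ (i + n) ℤ.- Φ w₀ i ≡ ℤ.- pos v

  Index-unique : ∀ {n i i₂ v v₂} → Similar n i i₂ → Index n i v → Index n i₂ v₂ → v ≡ v₂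
  Index-unique (_ , _ , o) e e₂ =
    ℤ.+-injective (ℤ.neg-injective (trans (sym e) (trans (o w₀ (List.length-replicate (suc Q))) e₂)))

  -- For the zero word a whole block contributes -R₁ and an offset r contributes -r. The last
  -- hypothesis says v = R₁ * h + r′ - r without subtraction.
  cuts⇒Index : ∀ {n i g h r r′ v} → r ≤ R₁ → r′ ≤ R₁ → Cut i g r → Cut (i + n) (g + h) r′ →
    v + r ≡ R₁ * h + r′ → Index n i v
  cuts⇒Index {n} {i} {g} {h} {r} {r′} {v} r≤ r′≤ (cut _ ht) (cut _ ht′) e = begin
    Φ w₀ (i + n) ℤ.- Φ w₀ i
      ≡⟨ cong₂ ℤ._-_ (full (i + n) ht′ r′≤) (full i ht r≤) ⟩
    (κ₀ ℤ.* pos (g + h) ℤ.+ (c ℤ.- pos r′)) ℤ.- (κ₀ ℤ.* pos g ℤ.+ (c ℤ.- pos r))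
      ≡⟨ cong (λ x → (κ₀ ℤ.* x ℤ.+ (c ℤ.- pos r′)) ℤ.- (κ₀ ℤ.* pos g ℤ.+ (c ℤ.- pos r))) (ℤ.pos-+ g h) ⟩
    (κ₀ ℤ.* (pos g ℤ.+ pos h) ℤ.+ (c ℤ.- pos r′)) ℤ.- (κ₀ ℤ.* pos g ℤ.+ (c ℤ.- pos r))
      ≡⟨ l κ₀ (pos g) (pos h) c (pos r′) (pos r) ⟩
    κ₀ ℤ.* pos h ℤ.- pos r′ ℤ.+ pos r
      ≡⟨ cong (λ k → k ℤ.* pos h ℤ.- pos r′ ℤ.+ pos r) κ₀≡ ⟩
    (ℤ.- pos R₁) ℤ.* pos h ℤ.- pos r′ ℤ.+ pos r
      ≡⟨ l′ (pos R₁) (pos h) (pos r′) (pos r) ⟩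
    ℤ.- ((pos R₁ ℤ.* pos h ℤ.+ pos r′) ℤ.- pos r)
      ≡⟨ cong (λ x → ℤ.- (x ℤ.- pos r)) v+r ⟩
    ℤ.- ((pos v ℤ.+ pos r) ℤ.- pos r)
      ≡⟨ cong ℤ.-_ (l″ (pos v) (pos r)) ⟩
    ℤ.- pos v ∎
    where
    open ≡-Reasoning
    κ₀ c : ℤ
    κ₀ = κ w₀
    c = Φ w₀ s₀
    l : ∀ k g h c a b → (k ℤ.* (g ℤ.+ h) ℤ.+ (c ℤ.- a)) ℤ.- (k ℤ.* g ℤ.+ (c ℤ.- b)) ≡ k ℤ.* h ℤ.- a ℤ.+ b
    l = ℤ-solve
    l′ : ∀ k h a b → (ℤ.- k) ℤ.* h ℤ.- a ℤ.+ b ≡ ℤ.- ((k ℤ.* h ℤ.+ a) ℤ.- b)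
    l′ = ℤ-solve
    l″ : ∀ v r → (v ℤ.+ r) ℤ.- r ≡ v
    l″ = ℤ-solve
    full : ∀ i {g r} → (∀ w → Φ w i ≡ κ w ℤ.* pos g ℤ.+ Φ w (s₀ + r)) → r ≤ R₁ → Φ w₀ i ≡ κ₀ ℤ.* pos g ℤ.+ (c ℤ.- pos r)
    full i {g} {r} ht r≤ = trans (ht w₀) (cong (λ x → κ₀ ℤ.* pos g ℤ.+ x) (Φ-zeros r r≤))
    κ₀≡ : κ₀ ≡ ℤ.- pos R₁
    κ₀≡ = trans (cong (ℤ._- c) (Φ-zeros R₁ ℕ.≤-refl)) (l‴ c (pos R₁))
      where
      l‴ : ∀ c r → (c ℤ.- r) ℤ.- c ≡ ℤ.- r
      l‴ = ℤ-solve
    v+r : pos R₁ ℤ.* pos h ℤ.+ pos r′ ≡ pos v ℤ.+ pos r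
    v+r = trans (cong (λ x → x ℤ.+ pos r′) (sym (ℤ.pos-* R₁ h))) (trans (sym (ℤ.pos-+ (R₁ * h) r′))
      (trans (cong pos (sym e)) (ℤ.pos-+ v r)))

-- Representatives of the classes

module _ {A K : Set} (_≟_ : DecidableEquality K) (key : A → K) where

  representatives : List A → List A
  representatives = deduplicate (λ x y → key x ≟ key y)

  representatives-distinct : ∀ xs → AllPairs (λ x y → key x ≢ key y) (representatives xs)
  representatives-distinct = Unique.deduplicate-! (On.decSetoid (≡.decSetoid _≟_) key)

  representatives-complete : ∀ {xs x} → x ∈ xs → ∃ λ y → y ∈ representatives xs × key x ≡ key y
  representatives-complete x∈ = find (Any.deduplicate⁺ (λ x y → key x ≟ key y)
    (λ e e′ → trans e′ (sym e)) (Any.map (cong key) x∈))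

  representatives-⊆ : ∀ xs {x} → x ∈ representatives xs → x ∈ xs
  representatives-⊆ = ∈-deduplicate⁻ (λ x y → key x ≟ key y)

total : (ℕ → ℕ) → ℕ → ℕ
total c zero    = 0
total c (suc k) = c (suc k) + total c k

module _ (f : ℕ → ℕ → ℕ) (c : ℕ → ℕ) where

  rows : ℕ → List ℕ
  rows zero    = []
  rows (suc k) = applyUpTo (λ h → f h (suc k)) (c (suc k)) ++ rows k

  length-rows : ∀ k → length (rows k) ≡ total c k
  length-rows zero    = refl
  length-rows (suc k) = trans (List.length-++ (applyUpTo (λ h → f h (suc k)) (c (suc k))))
    (cong₂ _+_ (List.length-applyUpTo _ (c (suc k))) (length-rows k))

  ∈-rows⁺ : ∀ k {h r} → 1 ≤ r → r ≤ k → h < c r → f h r ∈ rows k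
  ∈-rows⁺ zero    {r = suc r} _ () _
  ∈-rows⁺ (suc k) {h} {r} 1≤r r≤ h< with r ℕ.≟ suc k
  ... | yes refl = ∈-++⁺ˡ (∈-applyUpTo⁺ (λ h → f h (suc k)) h<)
  ... | no  r≢   = ∈-++⁺ʳ (applyUpTo (λ h → f h (suc k)) (c (suc k)))
    (∈-rows⁺ k 1≤r (ℕ.≤-pred (ℕ.≤∧≢⇒< r≤ r≢)) h<)

  ∈-rows⁻ : ∀ k {x} → x ∈ rows k → ∃₂ λ h r → 1 ≤ r × r ≤ k × h < c r × x ≡ f h r
  ∈-rows⁻ (suc k) x∈ with ∈-++⁻ (applyUpTo (λ h → f h (suc k)) (c (suc k))) x∈
  ... | inj₁ x∈₁ with ∈-applyUpTo⁻ (λ h → f h (suc k)) x∈₁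
  ...   | h , h< , e = h , suc k , s≤s z≤n , ℕ.≤-refl , h< , e
  ∈-rows⁻ (suc k) x∈ | inj₂ x∈₂ with ∈-rows⁻ k x∈₂
  ...   | h , r , 1≤r , r≤ , h< , e = h , r , 1≤r , ℕ.m≤n⇒m≤1+n r≤ , h< , e

  rows-distinct : ∀ {D : ℕ → ℕ → Set} k →
    (∀ {h r h′ r′} → 1 ≤ r → r ≤ k → h < c r → 1 ≤ r′ → r′ ≤ k → h′ < c r′ →
      ¬ (h ≡ h′ × r ≡ r′) → D (f h r) (f h′ r′)) →
    AllPairs D (rows k)
  rows-distinct zero    d = []
  rows-distinct (suc k) d = AllPairs.++⁺
    (AllPairs.applyUpTo⁺₁ (λ h → f h (suc k)) (c (suc k))
      λ i<j j< → d (s≤s z≤n) ℕ.≤-refl (ℕ.<-trans i<j j<) (s≤s z≤n) ℕ.≤-refl j< (λ { (e , _) → ℕ.<-irrefl e i<j }))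
    (rows-distinct k λ 1≤r r≤ h< 1≤r′ r′≤ h′< → d 1≤r (ℕ.m≤n⇒m≤1+n r≤) h< 1≤r′ (ℕ.m≤n⇒m≤1+n r′≤) h′<)
    (All.applyUpTo⁺₁ (λ h → f h (suc k)) (c (suc k)) λ {h} h< → All.tabulate λ x∈ →
      cross h< (∈-rows⁻ k x∈))
    where
    cross : ∀ {h x} → h < c (suc k) → (∃₂ λ h′ r′ → 1 ≤ r′ × r′ ≤ k × h′ < c r′ × x ≡ f h′ r′) → _
    cross h< (h′ , r′ , 1≤r′ , r′≤ , h′< , refl) =
      d (s≤s z≤n) ℕ.≤-refl h< 1≤r′ (ℕ.m≤n⇒m≤1+n r′≤) h′< (λ { (_ , refl) → ℕ.<-irrefl refl r′≤ })

words : ℕ → List Word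
words zero    = [] ∷ []
words (suc k) = map (true ∷_) (words k) ++ map (false ∷_) (words k)

∈-words⁺ : ∀ k w → length w ≡ k → w ∈ words k
∈-words⁺ zero    []          _ = here refl
∈-words⁺ (suc k) (true ∷ w)  e = ∈-++⁺ˡ (∈-map⁺ (true ∷_) (∈-words⁺ k w (ℕ.suc-injective e)))
∈-words⁺ (suc k) (false ∷ w) e = ∈-++⁺ʳ (map (true ∷_) (words k)) (∈-map⁺ (false ∷_) (∈-words⁺ k w (ℕ.suc-injective e)))

∈-words⁻ : ∀ k {w} → w ∈ words k → length w ≡ k
∈-words⁻ zero    (here refl) = refl
∈-words⁻ (suc k) w∈ with ∈-++⁻ (map (true ∷_) (words k)) w∈
... | inj₁ w∈₁ with ∈-map⁻ (true ∷_) w∈₁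
...   | v , v∈ , refl = cong suc (∈-words⁻ k v∈)
∈-words⁻ (suc k) w∈ | inj₂ w∈₂ with ∈-map⁻ (false ∷_) w∈₂
...   | v , v∈ , refl = cong suc (∈-words⁻ k v∈)

map-≡⁻ : ∀ {A C : Set} {f g : A → C} {xs} → map f xs ≡ map g xs → ∀ {x} → x ∈ xs → f x ≡ g x
map-≡⁻ {xs = x ∷ xs} e (here refl) = List.∷-injectiveˡ e
map-≡⁻ {xs = x ∷ xs} e (there x∈)  = map-≡⁻ (List.∷-injectiveʳ e) x∈

map-≡⁺ : ∀ {A C : Set} {f g : A → C} {xs} → (∀ {x} → x ∈ xs → f x ≡ g x) → map f xs ≡ map g xs
map-≡⁺ {xs = []}     h = refl
map-≡⁺ {xs = x ∷ xs} h = cong₂ _∷_ (h (here refl)) (map-≡⁺ (h ∘ there))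

-- Extremal factors next to a long gap

module Counting (Q J : ℕ) (Q≤B : Q ≤ 3 ^ J) (least : ∀ J′ → J ≡ suc J′ → 3 ^ J′ < Q) where

  open Windows Q
  open Cuts J Q≤B
  open Classes Q J Q≤B least

  private instance
    B≢0 : NonZero B
    B≢0 = ℕ.m^n≢0 3 J
    T≢0 : NonZero T
    T≢0 = ℕ.m*n≢0 2 B
    R₁≢0 : NonZero R₁
    R₁≢0 = ℕ.>-nonZero R₁>0

  repunit : ℕ → ℕ
  repunit M = 2 ^ M ∸ 1

  suc-repunit : ∀ M → suc (repunit M) ≡ 2 ^ M
  suc-repunit M = ℕ.m+[n∸m]≡n (ℕ.m^n>0 2 M)

  n≤repunit : ∀ {n M} → n ≤ M → n ≤ repunit M
  n≤repunit {n} {M} n≤M = ℕ.≤-pred (ℕ.≤-trans (s≤s n≤M) (ℕ.≤-trans (n<2^n M) (ℕ.≤-reflexive (sym (suc-repunit M)))))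

  digits-2^ : ∀ M {h} → h < 2 ^ M → digits (suc (repunit M + h)) ≡ 3 ^ M + digits h
  digits-2^ M {h} h< = trans (cong (λ x → digits (x + h)) (suc-repunit M)) (digits-leading M h<)

  digits-suc-repunit : ∀ M → digits (suc (repunit M)) ≡ 3 ^ M
  digits-suc-repunit M = trans (cong (digits ∘ suc) (sym (ℕ.+-identityʳ (repunit M))))
    (trans (digits-2^ M (ℕ.m^n>0 2 M)) (trans (cong (3 ^ M +_) digits-zero) (ℕ.+-identityʳ (3 ^ M))))

  -- With x = digits (repunit M) one has 3 ^ M = 2 x + 1, so one T is left for R₁ and T * x ≥ n for
  -- the length.
  long-gap : ∀ {n M} → n ≤ M → T * digits (repunit M) + (R₁ + n) ≤ T * 3 ^ M
  long-gap {n} {M} n≤M = begin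
    T * x + (R₁ + n)                    ≤⟨ ℕ.+-monoʳ-≤ (T * x) (R₁≤T ⊕ n≤) ⟩
    T * x + (T + T * x)                 ≡⟨ l T x ⟩
    T * suc (2 * x)                     ≡⟨ cong (T *_) (digits-repunit M (suc-repunit M)) ⟩
    T * 3 ^ M                           ∎
    where
    open ℕ.≤-Reasoning
    x : ℕ
    x = digits (repunit M)
    n≤ : n ≤ T * x
    n≤ = ℕ.≤-trans (n≤repunit n≤M) (ℕ.≤-trans (h≤digits (repunit M)) (ℕ.m≤n*m x T))
    l : ∀ t x → t * x + (t + t * x) ≡ t * suc (2 * x)
    l = solve-∀

  -- Preceded by a long run of zeros, a factor may contain the prefix of length T * digits h + r of the sequence.
  posˡ : ℕ → ℕ → ℕ → ℕ
  posˡ n h r = T * 3 ^ (n + h) ∸ (Q + (n ∸ (T * digits h + r)))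

  module _ {n h r} (le : T * digits h + r ≤ n) where

    private
      M o : ℕ
      -- Large enough for both purposes: n ≤ M makes the gap before block 2 ^ M long enough, and h <
      -- 2 ^ M keeps h below the leading bit.
      M = n + h
      o = n ∸ (T * digits h + r)

      sum : posˡ n h r + (Q + o) ≡ T * 3 ^ M
      sum = ℕ.m∸n+n≡m (begin
        Q + o                                ≤⟨ ℕ.m≤n+m Q B ⊕ ℕ.m∸n≤m n (T * digits h + r) ⟩
        R₁ + n                               ≤⟨ ℕ.m≤n+m (R₁ + n) (T * digits (repunit M)) ⟩
        T * digits (repunit M) + (R₁ + n)    ≤⟨ long-gap (ℕ.m≤m+n n h) ⟩
        T * 3 ^ M                            ∎)
        where open ℕ.≤-Reasoning

    posˡ-gap : GapAt (posˡ n h r) (repunit M)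
    posˡ-gap = gapAt (ℕ.+-cancelʳ-≤ (Q + o) _ _ (begin
        T * digits (repunit M) + B + (Q + o)   ≤⟨ ℕ.+-monoʳ-≤ (T * digits (repunit M) + B) (ℕ.+-monoʳ-≤ Q (ℕ.m∸n≤m n (T * digits h + r))) ⟩
        T * digits (repunit M) + B + (Q + n)   ≡⟨ l (T * digits (repunit M)) B Q n ⟩
        T * digits (repunit M) + (R₁ + n)      ≤⟨ long-gap (ℕ.m≤m+n n h) ⟩
        T * 3 ^ M                              ≡⟨ sum ⟨
        posˡ n h r + (Q + o)                   ∎))
      (begin
        posˡ n h r + Q                         ≤⟨ ℕ.+-monoʳ-≤ (posˡ n h r) (ℕ.m≤m+n Q o) ⟩
        posˡ n h r + (Q + o)                   ≡⟨ sum ⟩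
        T * 3 ^ M                              ≡⟨ cong (T *_) (digits-suc-repunit M) ⟨
        T * digits (suc (repunit M))           ∎)
      where
      open ℕ.≤-Reasoning
      l : ∀ a b q n → a + b + (q + n) ≡ a + (b + q + n)
      l = solve-∀

    posˡ-exact : ExactAt (posˡ n h r + n) (repunit M + h) r
    posˡ-exact = begin
      posˡ n h r + n + Q                              ≡⟨ cong (λ x → posˡ n h r + x + Q) (ℕ.m+[n∸m]≡n le) ⟨
      posˡ n h r + (T * digits h + r + o) + Q         ≡⟨ l (posˡ n h r) (T * digits h) r o Q ⟩
      posˡ n h r + (Q + o) + T * digits h + r         ≡⟨ cong (λ x → x + T * digits h + r) sum ⟩
      T * 3 ^ M + T * digits h + r                    ≡⟨ cong (_+ r) (ℕ.*-distribˡ-+ T (3 ^ M) (digits h)) ⟨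
      T * (3 ^ M + digits h) + r                      ≡⟨ cong (λ x → T * x + r) (digits-2^ M (ℕ.≤-<-trans (ℕ.m≤n+m h n) (n<2^n M))) ⟨
      T * digits (suc (repunit M + h)) + r            ∎
      where
      open ≡-Reasoning
      l : ∀ p a r o q → p + (a + r + o) + q ≡ p + (q + o) + a + r
      l = solve-∀

  -- The mirror image of posˡ: the factor runs into a long run of zeros.
  posʳ : ℕ → ℕ → ℕ → ℕ
  posʳ n h r = base (repunit (suc (n + h)) ∸ suc h) + (R₁ ∸ r)

  module _ {n h r} (r≤ : r ≤ R₁) (le : T * digits h + r ≤ n) where

    private
      M G g : ℕ
      -- The additional `suc` ensures suc h ≤ G, so the subtraction in g is a true one.
      M = suc (n + h)
      G = repunit M
      g = G ∸ suc h

      G≡ : suc (g + h) ≡ G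
      G≡ = trans (sym (ℕ.+-suc g h)) (ℕ.m∸n+n≡m (n≤repunit (s≤s (ℕ.m≤n+m h n))))

      -- The indices suc g and h are complementary in the M bits of G, so the blocks suc g and G are
      -- exactly T * digits h apart, the least distance that superadditivity allows.
      digits-G : digits (suc g) + digits h ≡ digits G
      digits-G = trans (digits-complement M (suc g) h (trans (cong suc G≡) (suc-repunit M))) (cong digits G≡)

    posʳ-exact : ExactAt (posʳ n h r) g (R₁ ∸ r)
    posʳ-exact = trans (l (base g) (R₁ ∸ r) Q) (cong (_+ (R₁ ∸ r)) (base+Q g))
      where
      l : ∀ x r q → x + r + q ≡ x + q + r
      l = solve-∀

    posʳ-gap : GapAt (posʳ n h r + n) (suc (g + h))
    posʳ-gap = subst (GapAt (posʳ n h r + n)) (sym G≡) (gapAt (ℕ.+-cancelʳ-≤ Q _ _ (begin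
        T * digits G + B + Q                          ≡⟨ cong (λ x → T * x + B + Q) digits-G ⟨
        T * (digits (suc g) + digits h) + B + Q       ≡⟨ l T (digits (suc g)) (digits h) B Q ⟩
        T * digits (suc g) + T * digits h + R₁        ≡⟨ cong (λ x → T * digits (suc g) + T * digits h + x) (ℕ.m∸n+n≡m r≤) ⟨
        T * digits (suc g) + T * digits h + (R₁ ∸ r + r) ≡⟨ l′ (T * digits (suc g)) (T * digits h) (R₁ ∸ r) r ⟩
        T * digits (suc g) + (R₁ ∸ r) + (T * digits h + r) ≤⟨ ℕ.+-monoʳ-≤ (T * digits (suc g) + (R₁ ∸ r)) le ⟩
        T * digits (suc g) + (R₁ ∸ r) + n             ≡⟨ end ⟨
        posʳ n h r + n + Q                            ∎))
      (begin
        posʳ n h r + n + Q                            ≡⟨ end ⟩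
        T * digits (suc g) + (R₁ ∸ r) + n             ≤⟨ ℕ.+-monoˡ-≤ n (ℕ.*-monoʳ-≤ T (digits-mono-≤ sg≤G) ⊕ ℕ.m∸n≤m R₁ r) ⟩
        T * digits G + R₁ + n                         ≡⟨ ℕ.+-assoc (T * digits G) R₁ n ⟩
        T * digits G + (R₁ + n)                       ≤⟨ long-gap (ℕ.m≤n⇒m≤1+n (ℕ.m≤m+n n h)) ⟩
        T * 3 ^ M                                     ≡⟨ cong (T *_) (digits-suc-repunit M) ⟨
        T * digits (suc G)                            ∎))
      where
      open ℕ.≤-Reasoning
      sg≤G : suc g ≤ G
      sg≤G = ℕ.≤-trans (s≤s (ℕ.m≤m+n g h)) (ℕ.≤-reflexive G≡)
      l : ∀ t a b c q → t * (a + b) + c + q ≡ t * a + t * b + (c + q)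
      l = solve-∀
      l′ : ∀ a b c r → a + b + (c + r) ≡ a + c + (b + r)
      l′ = solve-∀
      end : posʳ n h r + n + Q ≡ T * digits (suc g) + (R₁ ∸ r) + n
      end = trans (l″ (posʳ n h r) n Q) (cong (_+ n) posʳ-exact)
        where
        l″ : ∀ x n q → x + n + q ≡ x + q + n
        l″ = solve-∀

-- A list with one position for each class

module Representatives (Q J : ℕ) (Q≤B : Q ≤ 3 ^ J) (least : ∀ J′ → J ≡ suc J′ → 3 ^ J′ < Q) where

  open Windows Q
  open Cuts J Q≤B
  open Classes Q J Q≤B least
  open Counting Q J Q≤B least

  private instance
    B≢0 : NonZero B
    B≢0 = ℕ.m^n≢0 3 J
    T≢0 : NonZero T
    T≢0 = ℕ.m*n≢0 2 B
    R₁≢0 : NonZero R₁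
    R₁≢0 = ℕ.>-nonZero R₁>0

  Apart : ℕ → ℕ → ℕ → Set
  Apart n x y = ¬ Similar n x y

  index-injective : ∀ {h r h′ r′} → 1 ≤ r → r ≤ R₁ → 1 ≤ r′ → r′ ≤ R₁ → R₁ * h + r ≡ R₁ * h′ + r′ → h ≡ h′ × r ≡ r′
  index-injective {h} {suc r} {h′} {suc r′} _ r< _ r′< e =
    let eh , er = shape-unique R₁ r< r′< (ℕ.suc-injective (trans (sym (ℕ.+-suc (R₁ * h) r)) (trans e (ℕ.+-suc (R₁ * h′) r′))))
    in eh , cong suc er

  -- The three kinds exclude each other by their end windows. Factors with zeros at both ends belong
  -- to this one, which leaves the right window open.
  record Leftᶻ (n x v : ℕ) : Set where
    field
      left  : fac x Q ≡ zeros Q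
      index : Index n x v

  record Rightᶻ (n x v : ℕ) : Set where
    field
      left  : fac x Q ≢ zeros Q
      right : fac (x + n) Q ≡ zeros Q
      index : Index n x v

  record Mixed (n x : ℕ) : Set where
    field
      left  : fac x Q ≢ zeros Q
      right : fac (x + n) Q ≢ zeros Q

  posˡ-kind : ∀ {n h r} → r ≤ R₁ → T * digits h + r ≤ n → Leftᶻ n (posˡ n h r) (R₁ * h + r)
  posˡ-kind {n} {h} {r} r≤ le = record
    { left  = fac-gap (posˡ-gap le)
    ; index = cuts⇒Index z≤n r≤ (gap-cut₀ (posˡ-gap le)) (exact-cut r≤ (posˡ-exact le)) (ℕ.+-identityʳ _)
    }

  complement-inner : ∀ {r} → Inner r → Inner (R₁ ∸ r)
  complement-inner {r} (1≤r , r<) = ℕ.m<n⇒0<n∸m r< , ℕ.∸-monoʳ-< 1≤r (ℕ.<⇒≤ r<)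

  exact-inner : ∀ {i g r} → Inner r → ExactAt i g r → fac i Q ≢ zeros Q
  exact-inner inner e z = fac-inner inner (trans (sym (Cut.window (exact-cut (ℕ.<⇒≤ (proj₂ inner)) e))) z)

  posʳ-kind : ∀ {n h r} → Inner r → T * digits h + r ≤ n → Rightᶻ n (posʳ n h r) (R₁ * h + r)
  posʳ-kind {n} {h} {r} inner@(1≤r , r<) le = record
    { left  = exact-inner (complement-inner inner) (posʳ-exact (ℕ.<⇒≤ r<) le)
    ; right = fac-gap (posʳ-gap (ℕ.<⇒≤ r<) le)
    ; index = cuts⇒Index (ℕ.m∸n≤m R₁ r) ℕ.≤-refl
        (exact-cut (ℕ.m∸n≤m R₁ r) (posʳ-exact (ℕ.<⇒≤ r<) le)) (gap-cut₁ (posʳ-gap (ℕ.<⇒≤ r<) le))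
        (trans (ℕ.+-assoc (R₁ * h) r (R₁ ∸ r)) (cong (R₁ * h +_) (ℕ.m+[n∸m]≡n (ℕ.<⇒≤ r<))))
    }

  Similar-trans : ∀ {n x y z} → Similar n x y → Similar n y z → Similar n x z
  Similar-trans (p , q , o) (p′ , q′ , o′) = trans p p′ , trans q q′ , λ w len → trans (o w len) (o′ w len)

  -- Factors with a 1 in both end windows: the right cut is determined by the left one modulo T.
  right : ℕ → ℕ → ℕ
  right n r = (r + n) % T

  right-% : ∀ n r → right (n % T) r ≡ right n r
  right-% n r = begin
    (r + n % T) % T                 ≡⟨ [m+kn]%n≡m%n (r + n % T) (n / T) T ⟨
    (r + n % T + n / T * T) % T     ≡⟨ cong (_% T) (ℕ.+-assoc r (n % T) (n / T * T)) ⟩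
    (r + (n % T + n / T * T)) % T   ≡⟨ cong (λ x → (r + x) % T) (m≡m%n+[m/n]*n n T) ⟨
    (r + n) % T                     ∎
    where open ≡-Reasoning

  -- Every quotient is a difference of two values of `digits`, so an offset r occurs as soon as r
  -- and `right n r` are inner.
  blocks : ∀ n r → ∃₂ λ p p′ → digits (suc p′) ≡ digits (suc p) + (r + n) / T
  blocks n r = digits-difference ((r + n) / T)

  posᵐ : ℕ → ℕ → ℕ
  posᵐ n r = base (proj₁ (blocks n r)) + r

  posᵐ-exact : ∀ n r → ExactAt (posᵐ n r) (proj₁ (blocks n r)) r
  posᵐ-exact n r = trans (l (base p) r Q) (cong (_+ r) (base+Q p))
    where
    p : ℕ
    p = proj₁ (blocks n r)
    l : ∀ x r q → x + r + q ≡ x + q + r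
    l = solve-∀

  posᵐ-exactʳ : ∀ n r → ExactAt (posᵐ n r + n) (proj₁ (proj₂ (blocks n r))) (right n r)
  posᵐ-exactʳ n r with blocks n r
  ... | p , p′ , e = begin
    base p + r + n + Q                                            ≡⟨ l (base p) r n Q ⟩
    base p + Q + (r + n)                                          ≡⟨ cong₂ _+_ (base+Q p) (m≡m%n+[m/n]*n (r + n) T) ⟩
    T * digits (suc p) + (right n r + (r + n) / T * T)            ≡⟨ l′ T (digits (suc p)) (right n r) ((r + n) / T) ⟩
    T * (digits (suc p) + (r + n) / T) + right n r                ≡⟨ cong (λ x → T * x + right n r) e ⟨
    T * digits (suc p′) + right n r                               ∎
    where
    open ≡-Reasoning
    l : ∀ x r n q → x + r + n + q ≡ x + q + (r + n)
    l = solve-∀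
    l′ : ∀ t x r q → t * x + (r + q * t) ≡ t * (x + q) + r
    l′ = solve-∀

  Admissible : ℕ → ℕ → Set
  Admissible n r = Inner r × Inner (right n r)

  Inner? : ∀ r → Dec (Inner r)
  Inner? r = (1 ℕ.≤? r) ×-dec (r ℕ.<? R₁)

  Admissible? : ∀ n r → Dec (Admissible n r)
  Admissible? n r = Inner? r ×-dec Inner? (right n r)

  posᵐ-kind : ∀ {n r} → Admissible n r → Mixed n (posᵐ n r)
  posᵐ-kind {n} {r} (inner , inner′) = record
    { left  = exact-inner inner (posᵐ-exact n r)
    ; right = exact-inner inner′ (posᵐ-exactʳ n r)
    }

  Key : Set
  Key = Word × Word × List ℤ

  _≟ᴷ_ : DecidableEquality Key
  _≟ᴷ_ = Product.≡-dec (List.≡-dec Bool._≟_) (Product.≡-dec (List.≡-dec Bool._≟_) (List.≡-dec ℤ._≟_))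

  jump : ℕ → ℕ → Word → ℤ
  jump n r w = Φ w (s₀ + right n r) ℤ.- Φ w (s₀ + r)

  -- The contribution of whole blocks is omitted: it depends on the quotient (r + n) / T, which
  -- agreeing end windows force to agree. The rest depends on n modulo T only, and so does the
  -- number of classes.
  key : ℕ → ℕ → Key
  key n r = fac (s₀ + r) Q , fac (s₀ + right n r) Q , map (jump n r) (words (suc Q))

  key-% : ∀ n r → key (n % T) r ≡ key n r
  key-% n r = cong (λ x → fac (s₀ + r) Q , fac (s₀ + x) Q , map (λ w → Φ w (s₀ + x) ℤ.- Φ w (s₀ + r)) (words (suc Q)))
    (right-% n r)

  -- A larger quotient would require the left offset to grow, and the right offset to drop, by T = 2
  -- * B in total, but each of them changes by less than B.
  quotient-≤ : ∀ {n r r₂} → r₂ < r + B → right n r < right n r₂ + B → (r₂ + n) / T ≤ (r + n) / T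
  quotient-≤ {n} {r} {r₂} lt lt′ = ℕ.≮⇒≥ λ q< → ℕ.<-irrefl refl (begin-strict
    (r₂ + n) + right n r                       <⟨ ℕ.+-mono-< (ℕ.+-monoˡ-< n lt) lt′ ⟩
    (r + B + n) + (right n r₂ + B)             ≡⟨ l r B n (right n r₂) ⟩
    (r + n) + (right n r₂ + T)                 ≡⟨ cong (_+ (right n r₂ + T)) (m≡m%n+[m/n]*n (r + n) T) ⟩
    (right n r + q * T) + (right n r₂ + T)     ≡⟨ l′ (right n r) q T (right n r₂) ⟩
    (right n r₂ + suc q * T) + right n r       ≤⟨ ℕ.+-monoˡ-≤ (right n r) (ℕ.+-monoʳ-≤ (right n r₂) (ℕ.*-monoˡ-≤ T q<)) ⟩
    (right n r₂ + (r₂ + n) / T * T) + right n r ≡⟨ cong (_+ right n r) (m≡m%n+[m/n]*n (r₂ + n) T) ⟨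
    (r₂ + n) + right n r                       ∎)
    where
    open ℕ.≤-Reasoning
    q : ℕ
    q = (r + n) / T
    l : ∀ r b n x → (r + b + n) + (x + b) ≡ (r + n) + (x + 2 * b)
    l = solve-∀
    l′ : ∀ x q t y → (x + q * t) + (y + t) ≡ (y + suc q * t) + x
    l′ = solve-∀

  module _ {n r r₂} (adm : Admissible n r) (adm₂ : Admissible n r₂)
    (left≡ : fac (s₀ + r) Q ≡ fac (s₀ + r₂) Q) (right≡ : fac (s₀ + right n r) Q ≡ fac (s₀ + right n r₂) Q) where

    private
      quotient-≡ : (r + n) / T ≡ (r₂ + n) / T
      quotient-≡ = ℕ.≤-antisym
        (quotient-≤ {n} {r₂} {r} (inner-close (proj₁ adm) left≡) (inner-close (proj₂ adm₂) (sym right≡)))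
        (quotient-≤ {n} {r} {r₂} (inner-close (proj₁ adm₂) (sym left≡)) (inner-close (proj₂ adm) right≡))

      p p′ : ℕ
      p  = proj₁ (blocks n r)
      p′ = proj₁ (proj₂ (blocks n r))

    jump-posᵐ : ∀ w → ∃ λ c →
      Φ w (posᵐ n r + n) ℤ.- Φ w (posᵐ n r) ≡ c ℤ.+ jump n r w ×
      Φ w (posᵐ n r₂ + n) ℤ.- Φ w (posᵐ n r₂) ≡ c ℤ.+ jump n r₂ w
    jump-posᵐ w = κ w ℤ.* (pos p′ ℤ.- pos p) ,
      cuts-Φ (exact-cut (ℕ.<⇒≤ (proj₂ (proj₁ adm))) (posᵐ-exact n r))
             (exact-cut (ℕ.<⇒≤ (proj₂ (proj₂ adm))) (posᵐ-exactʳ n r)) w ,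
      trans (cuts-Φ (exact-cut (ℕ.<⇒≤ (proj₂ (proj₁ adm₂))) (posᵐ-exact n r₂))
                    (exact-cut (ℕ.<⇒≤ (proj₂ (proj₂ adm₂))) (posᵐ-exactʳ n r₂)) w)
        -- The blocks are chosen as a function of the quotient, so equal quotients give the same
        -- pair of blocks and the same multiple of κ.
        (cong (λ q → κ w ℤ.* (pos (proj₁ (proj₂ (digits-difference q))) ℤ.- pos (proj₁ (digits-difference q))) ℤ.+ jump n r₂ w)
          (sym quotient-≡))

  posᵐ-window : ∀ {n r} → Admissible n r →
    fac (posᵐ n r) Q ≡ fac (s₀ + r) Q × fac (posᵐ n r + n) Q ≡ fac (s₀ + right n r) Q
  posᵐ-window {n} {r} ((_ , r<) , (_ , r′<)) =
    Cut.window (exact-cut (ℕ.<⇒≤ r<) (posᵐ-exact n r)) , Cut.window (exact-cut (ℕ.<⇒≤ r′<) (posᵐ-exactʳ n r))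

  key-≡⇒Similar : ∀ {n r r₂} → Admissible n r → Admissible n r₂ → key n r ≡ key n r₂ → Similar n (posᵐ n r) (posᵐ n r₂)
  key-≡⇒Similar {n} {r} {r₂} adm adm₂ e =
    trans (proj₁ (posᵐ-window adm)) (trans le (sym (proj₁ (posᵐ-window adm₂)))) ,
    trans (proj₂ (posᵐ-window adm)) (trans re (sym (proj₂ (posᵐ-window adm₂)))) ,
    λ w len → let c , e₁ , e₂ = jump-posᵐ adm adm₂ le re w in
      trans e₁ (trans (cong (λ x → c ℤ.+ x) (map-≡⁻ je (∈-words⁺ (suc Q) w len))) (sym e₂))
    where
    le : fac (s₀ + r) Q ≡ fac (s₀ + r₂) Q
    le = cong proj₁ e
    re : fac (s₀ + right n r) Q ≡ fac (s₀ + right n r₂) Q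
    re = cong (proj₁ ∘ proj₂) e
    je : map (jump n r) (words (suc Q)) ≡ map (jump n r₂) (words (suc Q))
    je = cong (proj₂ ∘ proj₂) e

  Similar⇒key-≡ : ∀ {n r r₂} → Admissible n r → Admissible n r₂ → Similar n (posᵐ n r) (posᵐ n r₂) → key n r ≡ key n r₂
  Similar⇒key-≡ {n} {r} {r₂} adm adm₂ (p , q , o) = cong₂ _,_ le (cong₂ _,_ re (map-≡⁺ λ {w} w∈ →
    let c , e₁ , e₂ = jump-posᵐ adm adm₂ le re w in
    ℤ+-cancelˡ c (trans (sym e₁) (trans (o w (∈-words⁻ (suc Q) w∈)) e₂))))
    where
    ℤ+-cancelˡ : ∀ c {x y} → c ℤ.+ x ≡ c ℤ.+ y → x ≡ y
    ℤ+-cancelˡ c {x} {y} e = trans (l c x) (trans (cong (λ z → z ℤ.- c) e) (sym (l c y)))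
      where
      l : ∀ c x → x ≡ (c ℤ.+ x) ℤ.- c
      l = ℤ-solve
    le : fac (s₀ + r) Q ≡ fac (s₀ + r₂) Q
    le = trans (sym (proj₁ (posᵐ-window adm))) (trans p (proj₁ (posᵐ-window adm₂)))
    re : fac (s₀ + right n r) Q ≡ fac (s₀ + right n r₂) Q
    re = trans (sym (proj₂ (posᵐ-window adm))) (trans q (proj₂ (posᵐ-window adm₂)))

  mixed : ℕ → List ℕ
  mixed ν = representatives _≟ᴷ_ (key ν) (filter (Admissible? ν) (upTo T))

  mixed-admissible : ∀ n {r} → r ∈ mixed (n % T) → Admissible n r
  mixed-admissible n {r} r∈ with ∈-filter⁻ (Admissible? (n % T)) {xs = upTo T}
      (representatives-⊆ _≟ᴷ_ (key (n % T)) (filter (Admissible? (n % T)) (upTo T)) r∈)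
  ... | _ , inner , inner′ = inner , subst Inner (right-% n r) inner′

  mixed-complete : ∀ n {r} → Admissible n r → ∃ λ r₂ → r₂ ∈ mixed (n % T) × key n r ≡ key n r₂
  mixed-complete n {r} (inner , inner′) with representatives-complete _≟ᴷ_ (key (n % T))
      (∈-filter⁺ (Admissible? (n % T)) (∈-upTo⁺ (ℕ.<-≤-trans (proj₂ inner) R₁≤T))
        (inner , subst Inner (sym (right-% n r)) inner′))
  ... | r₂ , r₂∈ , e = r₂ , r₂∈ , trans (sym (key-% n r)) (trans e (key-% n r₂))

  mixed-distinct : ∀ n → AllPairs (Apart n) (map (posᵐ n) (mixed (n % T)))
  mixed-distinct n = AllPairs.map⁺ (go (All.tabulate (mixed-admissible n))
    (representatives-distinct _≟ᴷ_ (key (n % T)) (filter (Admissible? (n % T)) (upTo T))))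
    where
    go : ∀ {rs} → All (Admissible n) rs → AllPairs (λ r r₂ → key (n % T) r ≢ key (n % T) r₂) rs →
      AllPairs (λ r r₂ → Apart n (posᵐ n r) (posᵐ n r₂)) rs
    go []           []           = []
    go (adm ∷ adms) (ne ∷ nes) = All.zipWith (λ { {r₂} (adm₂ , k≢) sim →
        k≢ (trans (key-% n _) (trans (Similar⇒key-≡ adm adm₂ sim) (sym (key-% n r₂)))) }) (adms , ne) ∷ go adms nes

  -- The numbers R₁ * h + r with 1 ≤ r ≤ R₁ are the positive integers, each once; the head has index
  -- 0. For `posʳ` the offset r stops at R, because r = R₁ would put the left cut into a gap, a kind
  -- already listed.
  positions : ℕ → List ℕ
  positions n = posˡ n 0 0 ∷ (rows (posˡ n) (λ r → countFrom J r n) R₁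
    ++ (rows (posʳ n) (λ r → countFrom J r n) R ++ map (posᵐ n) (mixed (n % T))))

  complexity : ℕ → ℕ
  complexity n = suc (total (λ r → countFrom J r n) R₁ + (total (λ r → countFrom J r n) R + length (mixed (n % T))))

  length-positions : ∀ n → length (positions n) ≡ complexity n
  length-positions n = cong suc (trans (List.length-++ (rows (posˡ n) _ R₁)) (cong₂ _+_ (length-rows _ _ R₁)
    (trans (List.length-++ (rows (posʳ n) _ R)) (cong₂ _+_ (length-rows _ _ R) (List.length-map _ (mixed (n % T)))))))

  0-valid : ∀ n → T * digits 0 + 0 ≤ n
  0-valid n = ℕ.≤-trans (ℕ.≤-reflexive (trans (cong (λ x → T * x + 0) digits-zero) (l T))) z≤n
    where
    l : ∀ t → t * 0 + 0 ≡ 0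
    l = solve-∀

  valid : ∀ {n h r} → h < countFrom J r n → T * digits h + r ≤ n
  valid {n} {h} {r} = Equivalence.to (countFrom-galois J r n)

  r≤R⇒inner : ∀ {r} → 1 ≤ r → r ≤ R → Inner r
  r≤R⇒inner 1≤r r≤ = 1≤r , ℕ.≤-trans (s≤s r≤) (ℕ.≤-reflexive suc-R)

  positions-distinct : ∀ n → AllPairs (Apart n) (positions n)
  positions-distinct n =
    All.++⁺ (All.tabulate (0-left ∘ ∈-rows⁻ (posˡ n) _ R₁))
      (All.++⁺ (All.tabulate (left-right (posˡ-kind z≤n (0-valid n)) ∘ ∈-rows⁻ (posʳ n) _ R))
        (All.tabulate (left-mixed (posˡ-kind z≤n (0-valid n)))))
    ∷ AllPairs.++⁺ (rows-distinct (posˡ n) _ R₁ left-left)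
        (AllPairs.++⁺ (rows-distinct (posʳ n) _ R right-right) (mixed-distinct n)
          (All.tabulate (λ x∈ → All.tabulate (right-mixed (∈-rows⁻ (posʳ n) _ R x∈)))))
        (All.tabulate λ x∈ → All.++⁺
          (All.tabulate (λ y∈ → left-right (proj₂ (left-kind (∈-rows⁻ (posˡ n) _ R₁ x∈))) (∈-rows⁻ (posʳ n) _ R y∈)))
          (All.tabulate (left-mixed (proj₂ (left-kind (∈-rows⁻ (posˡ n) _ R₁ x∈))))))
    where
    c : ℕ → ℕ
    c r = countFrom J r n
    Row : (ℕ → ℕ → ℕ) → ℕ → ℕ → Set
    Row f k x = ∃₂ λ h r → 1 ≤ r × r ≤ k × h < c r × x ≡ f h r
    left-kind : ∀ {x} → Row (posˡ n) R₁ x → ∃ λ v → Leftᶻ n x v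
    left-kind (h , r , _ , r≤ , h< , refl) = R₁ * h + r , posˡ-kind r≤ (valid {n} {h} {r} h<)
    left-left : ∀ {h r h′ r′} → 1 ≤ r → r ≤ R₁ → h < c r → 1 ≤ r′ → r′ ≤ R₁ → h′ < c r′ →
      ¬ (h ≡ h′ × r ≡ r′) → Apart n (posˡ n h r) (posˡ n h′ r′)
    left-left {h} {r} {h′} {r′} 1≤r r≤ h< 1≤r′ r′≤ h′< ne sim = ne (index-injective 1≤r r≤ 1≤r′ r′≤
      (Index-unique sim (Leftᶻ.index (posˡ-kind r≤ (valid {n} {h} {r} h<))) (Leftᶻ.index (posˡ-kind r′≤ (valid {n} {h′} {r′} h′<)))))
    0-left : ∀ {x} → Row (posˡ n) R₁ x → Apart n (posˡ n 0 0) x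
    0-left (h , r , 1≤r , r≤ , h< , refl) sim = ℕ.<-irrefl
      (trans (l R₁) (Index-unique sim (Leftᶻ.index (posˡ-kind z≤n (0-valid n))) (Leftᶻ.index (posˡ-kind r≤ (valid {n} {h} {r} h<)))))
      (ℕ.≤-trans 1≤r (ℕ.m≤n+m r (R₁ * h)))
      where
      l : ∀ k → 0 ≡ k * 0 + 0
      l = solve-∀
    right-right : ∀ {h r h′ r′} → 1 ≤ r → r ≤ R → h < c r → 1 ≤ r′ → r′ ≤ R → h′ < c r′ →
      ¬ (h ≡ h′ × r ≡ r′) → Apart n (posʳ n h r) (posʳ n h′ r′)
    right-right {h} {r} {h′} {r′} 1≤r r≤ h< 1≤r′ r′≤ h′< ne sim =
      ne (index-injective 1≤r (ℕ.<⇒≤ (proj₂ i)) 1≤r′ (ℕ.<⇒≤ (proj₂ i′))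
        (Index-unique sim (Rightᶻ.index (posʳ-kind i (valid {n} {h} {r} h<))) (Rightᶻ.index (posʳ-kind i′ (valid {n} {h′} {r′} h′<)))))
      where
      i : Inner r
      i = r≤R⇒inner 1≤r r≤
      i′ : Inner r′
      i′ = r≤R⇒inner 1≤r′ r′≤
    left-right : ∀ {x v y} → Leftᶻ n x v → Row (posʳ n) R y → Apart n x y
    left-right k (h , r , 1≤r , r≤ , h< , refl) (p , _) =
      Rightᶻ.left (posʳ-kind (r≤R⇒inner 1≤r r≤) (valid {n} {h} {r} h<)) (trans (sym p) (Leftᶻ.left k))
    left-mixed : ∀ {x v y} → Leftᶻ n x v → y ∈ map (posᵐ n) (mixed (n % T)) → Apart n x y
    left-mixed k y∈ (p , _) with ∈-map⁻ (posᵐ n) y∈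
    ... | r , r∈ , refl = Mixed.left (posᵐ-kind (mixed-admissible n r∈)) (trans (sym p) (Leftᶻ.left k))
    right-mixed : ∀ {x y} → Row (posʳ n) R x → y ∈ map (posᵐ n) (mixed (n % T)) → Apart n x y
    right-mixed (h , r , 1≤r , r≤ , h< , refl) y∈ (_ , q , _) with ∈-map⁻ (posᵐ n) y∈
    ... | r₂ , r∈ , refl = Mixed.right (posᵐ-kind (mixed-admissible n r∈))
      (trans (sym q) (Rightᶻ.right (posʳ-kind (r≤R⇒inner 1≤r r≤) (valid {n} {h} {r} h<))))

-- Completeness of the list, short factors and regularity

module Cardinality (Q J : ℕ) (Q≤B : Q ≤ 3 ^ J) (least : ∀ J′ → J ≡ suc J′ → 3 ^ J′ < Q) where

  open Windows Q
  open Cuts J Q≤B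
  open Classes Q J Q≤B least
  open Counting Q J Q≤B least
  open Representatives Q J Q≤B least

  private instance
    B≢0 : NonZero B
    B≢0 = ℕ.m^n≢0 3 J
    T≢0 : NonZero T
    T≢0 = ℕ.m*n≢0 2 B

  T-digits-mono : ∀ {a b} → a ≤ b → T * digits a ≤ T * digits b
  T-digits-mono a≤b = ℕ.*-monoʳ-≤ T (digits-mono-≤ a≤b)

  gap-gap-≤ : ∀ {i e g g′} → GapAt i g → GapAt e g′ → i ≤ e → g ≤ g′
  gap-gap-≤ {i} {e} {g} {g′} (gapAt lo _) (gapAt _ hi) i≤e = ℕ.≮⇒≥ λ lt → ℕ.<-irrefl refl (begin-strict
    T * digits g         <⟨ ℕ.m<m+n (T * digits g) B>0 ⟩
    T * digits g + B     ≤⟨ lo ⟩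
    i                    ≤⟨ i≤e ⟩
    e                    ≤⟨ ℕ.m≤m+n e Q ⟩
    e + Q                ≤⟨ hi ⟩
    T * digits (suc g′)  ≤⟨ T-digits-mono lt ⟩
    T * digits g         ∎)
    where open ℕ.≤-Reasoning

  gap-exact-≤ : ∀ {i e g g′ r} → r < R₁ → GapAt i g → ExactAt e g′ r → i ≤ e → g ≤ g′
  gap-exact-≤ {i} {e} {g} {g′} {r} r< (gapAt lo _) ex i≤e = ℕ.≮⇒≥ λ lt → ℕ.<-irrefl refl (begin-strict
    T * digits g + B + Q     ≤⟨ ℕ.+-monoˡ-≤ Q (ℕ.≤-trans lo i≤e) ⟩
    e + Q                    ≡⟨ ex ⟩
    T * digits (suc g′) + r  <⟨ ℕ.+-mono-≤-< (T-digits-mono lt) r< ⟩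
    T * digits g + R₁        ≡⟨ ℕ.+-assoc (T * digits g) B Q ⟨
    T * digits g + B + Q     ∎)
    where open ℕ.≤-Reasoning

  exact-gap-< : ∀ {i e g g′ r} → 1 ≤ r → ExactAt i g r → GapAt e g′ → i ≤ e → g < g′
  exact-gap-< {i} {e} {g} {g′} {r} 1≤r ex (gapAt _ hi) i≤e = ℕ.≰⇒> λ le → ℕ.<-irrefl refl (begin-strict
    T * digits (suc g)       <⟨ ℕ.m<m+n (T * digits (suc g)) 1≤r ⟩
    T * digits (suc g) + r   ≡⟨ ex ⟨
    i + Q                    ≤⟨ ℕ.+-monoˡ-≤ Q i≤e ⟩
    e + Q                    ≤⟨ hi ⟩
    T * digits (suc g′)      ≤⟨ T-digits-mono (s≤s le) ⟩
    T * digits (suc g)       ∎)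
    where open ℕ.≤-Reasoning

  T-digits-+ : ∀ g h → T * digits (suc g) + T * digits h ≤ T * digits (suc (g + h))
  T-digits-+ g h = ℕ.≤-trans (ℕ.≤-reflexive (sym (ℕ.*-distribˡ-+ T (digits (suc g)) (digits h))))
    (ℕ.*-monoʳ-≤ T (digits-superadditive (suc g) h))

  Located : ℕ → ℕ → Set
  Located n i = ∃ λ x → x ∈ positions n × Similar n i x

  -- Superadditivity gives T * digits h + r ≤ n for any factor passing h blocks, so `posˡ n h r` is
  -- in the list, and it passes equally many blocks. The last hypothesis is an inequality so as to
  -- include right cuts in a gap, taken with r = R₁.
  located-left : ∀ {n i g h r} → 1 ≤ r → r ≤ R₁ → GapAt i g → Cut (i + n) (g + h) r →
    T * digits (suc (g + h)) + r ≤ i + n + Q → Located n i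
  located-left {n} {i} {g} {h} {r} 1≤r r≤ gap@(gapAt _ hi) c le =
    posˡ n h r , there (∈-++⁺ˡ (∈-rows⁺ (posˡ n) _ R₁ 1≤r r≤ (Equivalence.from (countFrom-galois J r n) bound))) ,
    cuts⇒Similar (gap-cut₀ gap) c (gap-cut₀ (posˡ-gap bound)) (exact-cut r≤ (posˡ-exact bound))
      (l g h (repunit (n + h)))
    where
    open ℕ.≤-Reasoning
    l : ∀ a b c → (a + b) + c ≡ (c + b) + a
    l = solve-∀
    l′ : ∀ x n q → x + n + q ≡ x + q + n
    l′ = solve-∀
    bound : T * digits h + r ≤ n
    bound = ℕ.+-cancelˡ-≤ (T * digits (suc g)) _ _ (begin
      T * digits (suc g) + (T * digits h + r)   ≡⟨ ℕ.+-assoc (T * digits (suc g)) (T * digits h) r ⟨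
      T * digits (suc g) + T * digits h + r     ≤⟨ ℕ.+-monoˡ-≤ r (T-digits-+ g h) ⟩
      T * digits (suc (g + h)) + r              ≤⟨ le ⟩
      i + n + Q                                 ≡⟨ l′ i n Q ⟩
      i + Q + n                                 ≤⟨ ℕ.+-monoˡ-≤ n hi ⟩
      T * digits (suc g) + n                    ∎)

  located-zero : ∀ {n i g} → GapAt i g → GapAt (i + n) g → Located n i
  located-zero {n} {i} {g} gap gap′ = posˡ n 0 0 , here refl ,
    cuts⇒Similar (gap-cut₀ gap) (gap-cut₀ gap′) (gap-cut₀ (posˡ-gap (0-valid n))) (exact-cut z≤n (posˡ-exact (0-valid n)))
      (l g (repunit (n + 0)))
    where
    l : ∀ a c → a + c ≡ (c + 0) + a
    l = solve-∀

  -- The mirrored argument: a left cut at offset r leaves R₁ ∸ r windows of its block, and this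
  -- number takes over the role of the offset.
  located-right : ∀ {n i g h r} → Inner r → ExactAt i g r → GapAt (i + n) (suc (g + h)) → Located n i
  located-right {n} {i} {g} {h} {r} inner@(1≤r , r<) ex gap@(gapAt lo _) =
    posʳ n h r̃ , there (∈-++⁺ʳ (rows (posˡ n) _ R₁) (∈-++⁺ˡ
      (∈-rows⁺ (posʳ n) _ R (proj₁ inner̃) r̃≤R (Equivalence.from (countFrom-galois J r̃ n) bound)))) ,
    cuts⇒Similar (exact-cut (ℕ.<⇒≤ r<) ex) (gap-cut₁ gap)
      (subst (Cut (posʳ n h r̃) G) r̃̃ (exact-cut (ℕ.m∸n≤m R₁ r̃) (posʳ-exact r̃≤ bound)))
      (gap-cut₁ (posʳ-gap r̃≤ bound)) (l g h G)
    where
    open ℕ.≤-Reasoning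
    r̃ G : ℕ
    r̃ = R₁ ∸ r
    G = repunit (suc (n + h)) ∸ suc h
    inner̃ : Inner r̃
    inner̃ = complement-inner inner
    r̃≤ : r̃ ≤ R₁
    r̃≤ = ℕ.m∸n≤m R₁ r
    r̃≤R : r̃ ≤ R
    r̃≤R = ℕ.≤-pred (ℕ.≤-trans (proj₂ inner̃) (ℕ.≤-reflexive (sym suc-R)))
    r̃̃ : R₁ ∸ r̃ ≡ r
    r̃̃ = ℕ.m∸[m∸n]≡n (ℕ.<⇒≤ r<)
    l : ∀ a b c → (a + b) + c ≡ (c + b) + a
    l = solve-∀
    l′ : ∀ x n q → x + n + q ≡ x + q + n
    l′ = solve-∀
    l₁ : ∀ a b c r → a + r + (b + c) ≡ a + b + (c + r)
    l₁ = solve-∀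
    bound : T * digits h + r̃ ≤ n
    bound = ℕ.+-cancelˡ-≤ (T * digits (suc g) + r) _ _ (begin
      T * digits (suc g) + r + (T * digits h + r̃)    ≡⟨ l₁ (T * digits (suc g)) (T * digits h) r̃ r ⟩
      T * digits (suc g) + T * digits h + (r̃ + r)    ≡⟨ cong (T * digits (suc g) + T * digits h +_) (ℕ.m∸n+n≡m (ℕ.<⇒≤ r<)) ⟩
      T * digits (suc g) + T * digits h + R₁         ≤⟨ ℕ.+-monoˡ-≤ R₁ (T-digits-+ g h) ⟩
      T * digits (suc (g + h)) + R₁                  ≡⟨ ℕ.+-assoc (T * digits (suc (g + h))) B Q ⟨
      T * digits (suc (g + h)) + B + Q               ≤⟨ ℕ.+-monoˡ-≤ Q lo ⟩
      i + n + Q                                      ≡⟨ l′ i n Q ⟩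
      i + Q + n                                      ≡⟨ cong (_+ n) ex ⟩
      T * digits (suc g) + r + n                     ∎)

  exact-exact : ∀ {n i g g′ r r′} → Inner r′ → ExactAt i g r → ExactAt (i + n) g′ r′ →
    digits (suc g′) ≡ digits (suc g) + (r + n) / T × r′ ≡ right n r
  exact-exact {n} {i} {g} {g′} {r} {r′} inner′ ex ex′ = shape-unique T (ℕ.<-≤-trans (proj₂ inner′) R₁≤T) (m%n<n (r + n) T) (begin
    T * digits (suc g′) + r′                              ≡⟨ ex′ ⟨
    i + n + Q                                             ≡⟨ l i n Q ⟩
    i + Q + n                                             ≡⟨ cong (_+ n) ex ⟩
    T * digits (suc g) + r + n                            ≡⟨ ℕ.+-assoc (T * digits (suc g)) r n ⟩
    T * digits (suc g) + (r + n)                          ≡⟨ cong (T * digits (suc g) +_) (m≡m%n+[m/n]*n (r + n) T) ⟩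
    T * digits (suc g) + (right n r + (r + n) / T * T)    ≡⟨ l′ T (digits (suc g)) (right n r) ((r + n) / T) ⟩
    T * (digits (suc g) + (r + n) / T) + right n r        ∎)
    where
    open ≡-Reasoning
    l : ∀ x n q → x + n + q ≡ x + q + n
    l = solve-∀
    l′ : ∀ t x r q → t * x + (r + q * t) ≡ t * (x + q) + r
    l′ = solve-∀

  -- The quotient fixes the difference of the `digits` of the two blocks, and `digits-sidon` turns
  -- this into the difference of their indices. So the factor is equivalent to the chosen one at
  -- `posᵐ n r`, although it may lie between other blocks.
  located-mixed : ∀ {n i g g′ r r′} → Inner r → ExactAt i g r → Inner r′ → ExactAt (i + n) g′ r′ → Located n i
  located-mixed {n} {i} {g} {g′} {r} {r′} inner ex inner′ ex′ with exact-exact {g = g} {g′} inner′ ex ex′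
  ... | quotient≡ , refl with mixed-complete n (inner , inner′)
  ...   | r₂ , r₂∈ , e = posᵐ n r₂ ,
    there (∈-++⁺ʳ (rows (posˡ n) _ R₁) (∈-++⁺ʳ (rows (posʳ n) _ R) (∈-map⁺ (posᵐ n) r₂∈))) ,
    Similar-trans same (key-≡⇒Similar (inner , inner′) (mixed-admissible n r₂∈) e)
    where
    p p′ : ℕ
    p  = proj₁ (blocks n r)
    p′ = proj₁ (proj₂ (blocks n r))
    steps : g′ + p ≡ p′ + g
    steps = ℕ.suc-injective (ℕ.suc-injective (trans (l g′ p) (trans
      (digits-sidon (suc g′) (suc p) (suc p′) (suc g) (trans (cong (_+ digits (suc p)) quotient≡)
        (trans (l′ (digits (suc g)) ((r + n) / T) (digits (suc p))) (cong (_+ digits (suc g)) (sym (proj₂ (proj₂ (blocks n r))))))))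
      (sym (l p′ g)))))
      where
      l : ∀ a b → suc (suc (a + b)) ≡ suc a + suc b
      l a b = cong suc (sym (ℕ.+-suc a b))
      l′ : ∀ x q y → x + q + y ≡ y + q + x
      l′ = solve-∀
    same : Similar n i (posᵐ n r)
    same = cuts⇒Similar (exact-cut (ℕ.<⇒≤ (proj₂ inner)) ex) (exact-cut (ℕ.<⇒≤ (proj₂ inner′)) ex′)
      (exact-cut (ℕ.<⇒≤ (proj₂ inner)) (posᵐ-exact n r)) (exact-cut (ℕ.<⇒≤ (proj₂ inner′)) (posᵐ-exactʳ n r)) steps

  locate : ∀ n {i} → B ≤ i → Located n i
  locate n {i} B≤i with cover B≤i | cover (ℕ.≤-trans B≤i (ℕ.m≤m+n i n))
  ... | g , inj₁ gap | g′ , inj₂ (r′ , inner′ , ex′)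
    with ℕ.m≤n⇒∃[o]m+o≡n (gap-exact-≤ {g = g} {g′} {r′} (proj₂ inner′) gap ex′ (ℕ.m≤m+n i n))
  ...   | h , refl = located-left (proj₁ inner′) (ℕ.<⇒≤ (proj₂ inner′)) gap
    (exact-cut (ℕ.<⇒≤ (proj₂ inner′)) ex′) (ℕ.≤-reflexive (sym ex′))
  locate n {i} B≤i | g , inj₁ gap | g′ , inj₁ gap′ with ℕ.m≤n⇒∃[o]m+o≡n (gap-gap-≤ gap gap′ (ℕ.m≤m+n i n))
  ...   | zero  , e = located-zero gap (subst (GapAt (i + n)) (trans (sym e) (ℕ.+-identityʳ g)) gap′)
  -- The right cut counts as offset R₁ at block suc (g + h), the last block passed.
  ...   | suc h , refl = located-left R₁>0 ℕ.≤-refl gap (gap-cut₁ gap″)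
    (ℕ.≤-trans (ℕ.≤-reflexive (sym (ℕ.+-assoc _ B Q))) (ℕ.+-monoˡ-≤ Q (GapAt.lower gap″)))
    where
    gap″ : GapAt (i + n) (suc (g + h))
    gap″ = subst (GapAt (i + n)) (ℕ.+-suc g h) gap′
  locate n {i} B≤i | g , inj₂ (r , inner , ex) | g′ , inj₁ gap′
    with ℕ.m≤n⇒∃[o]m+o≡n (exact-gap-< {g = g} (proj₁ inner) ex gap′ (ℕ.m≤m+n i n))
  ...   | h , refl = located-right inner ex gap′
  locate n {i} B≤i | g , inj₂ (r , inner , ex) | g′ , inj₂ (r′ , inner′ , ex′) =
    located-mixed {g = g} {g′} inner ex inner′ ex′

  module _ (n : ℕ) where

    shifted : ℕ → ℕ
    -- The exponent puts the factor inside the copied prefix and the copy beyond B.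
    shifted i = 3 ^ (B + (i + n)) * 2 + i

    B≤shifted : ∀ i → B ≤ shifted i
    B≤shifted i = ℕ.m≤n⇒m≤n+o i (ℕ.≤-trans (ℕ.m≤m+n B (i + n))
      (ℕ.≤-trans (ℕ.<⇒≤ (n<3^n (B + (i + n)))) (ℕ.m≤m*n (3 ^ (B + (i + n))) 2)))

    factorAt-shifted : ∀ i → factorAt i n ≡ factorAt (shifted i) n
    factorAt-shifted i = fac-shift i n (B + (i + n)) (ℕ.≤-trans (ℕ.m≤n+m (i + n) B) (ℕ.<⇒≤ (n<3^n (B + (i + n)))))

  abCard-long : ∀ n → AbCard (suc Q) (Q + n) (complexity n)
  abCard-long n =
    map f (positions n) ,
    trans (List.length-map f (positions n)) (length-positions n) ,
    All.map⁺ (All.universal (λ i → i , refl) (positions n)) ,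
    AllPairs.map⁺ (AllPairs.map (λ {x} {y} apart sim → apart (∼⇒Similar {n} {x} {y} sim)) (positions-distinct n)) ,
    complete
    where
    f : ℕ → Word
    f i = factorAt i (Q + n)
    complete : ∀ u → IsFactor (Q + n) u → Any.Any (λ v → u ∼[ suc Q ] v) (map f (positions n))
    complete u (i , refl) with locate n (B≤shifted (Q + n) i)
    ... | x , x∈ , sim = lose (∈-map⁺ f x∈)
      (subst (_∼[ suc Q ] f x) (sym (factorAt-shifted (Q + n) i)) (Similar⇒∼ {n} {shifted (Q + n) i} {x} sim))

  short-classes : ℕ → List ℕ
  short-classes n = representatives (List.≡-dec Bool._≟_) (λ r → factorAt (s₀ + r) n) (upTo R₁)

  -- A word of length at most Q is its own prefix of length Q, so equivalence is equality. All such
  -- factors begin some window of length Q at an offset below R₁, which makes the search finite.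
  abCard-short : ∀ n → n ≤ Q → AbCard (suc Q) n (length (short-classes n))
  abCard-short n n≤Q =
    map f (short-classes n) ,
    List.length-map f (short-classes n) ,
    All.map⁺ (All.universal (λ r → s₀ + r , refl) (short-classes n)) ,
    AllPairs.map⁺ (AllPairs.map (λ {r} {r′} ne sim → ne (trans (sym (whole r)) (trans (proj₁ sim) (whole r′))))
      (representatives-distinct (List.≡-dec Bool._≟_) f (upTo R₁))) ,
    complete
    where
    f : ℕ → Word
    f r = factorAt (s₀ + r) n
    whole : ∀ r → take Q (f r) ≡ f r
    whole r = List.take-all Q (f r) (ℕ.≤-trans (ℕ.≤-reflexive
      (trans (cong length (factorAt≡fac (s₀ + r) n)) (length-fac (s₀ + r) n))) n≤Q)
    nearby : ∀ {i} → B ≤ i → ∃ λ r → r < R₁ × fac i Q ≡ fac (s₀ + r) Q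
    nearby B≤i with cover B≤i
    ... | g , inj₁ gap                  = 0 , R₁>0 , Cut.window (gap-cut₀ gap)
    ... | g , inj₂ (r , (_ , r<) , ex)  = r , r< , Cut.window (exact-cut (ℕ.<⇒≤ r<) ex)
    complete : ∀ u → IsFactor n u → Any.Any (λ v → u ∼[ suc Q ] v) (map f (short-classes n))
    complete u (i , refl) with nearby (B≤shifted n i)
    ... | r , r< , e with representatives-complete (List.≡-dec Bool._≟_) f (∈-upTo⁺ r<)
    ... | r′ , r′∈ , e′ = lose (∈-map⁺ f r′∈) (subst (factorAt i n ∼[ suc Q ]_) u≡ (refl , refl , λ _ _ → refl))
      where
      u≡ : factorAt i n ≡ f r′
      u≡ = trans (factorAt-shifted n i) (trans (factorAt≡fac (shifted n i) n)
        (trans (fac-cong n λ j j< → fac-cong⁻ Q e j (ℕ.<-≤-trans j< n≤Q))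
          (trans (sym (factorAt≡fac (s₀ + r) n)) e′)))

  LinRep-total : ∀ k → LinRep (λ n → pos (total (λ r → countFrom J r n) k))
  LinRep-total zero    = LinRep-zero
  LinRep-total (suc k) = LinRep-ext (λ n → sym (ℤ.pos-+ (countFrom J (suc k) n) _))
    (LinRep-add (LinRep-countFrom J (suc k)) (LinRep-total k))

  LinRep-complexity : LinRep (λ n → pos (complexity n))
  LinRep-complexity = LinRep-ext (λ n → trans (cong (λ x → 1ℤ ℤ.+ x) (trans
      (cong (λ x → pos (left n) ℤ.+ x) (sym (ℤ.pos-+ (rightᶻ n) (mid n)))) (sym (ℤ.pos-+ (left n) _)))) (sym (ℤ.pos-+ 1 _)))
    -- The constant 1 stands for the head of `positions`.
    (LinRep-add (LinRep-periodic 1 (λ _ → 1ℤ)) (LinRep-add (LinRep-total R₁)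
      (LinRep-add (LinRep-total R) (LinRep-periodic T (λ ν → pos (length (mixed ν)))))))
    where
    left rightᶻ mid : ℕ → ℕ
    left n   = total (λ r → countFrom J r n) R₁
    rightᶻ n = total (λ r → countFrom J r n) R
    mid n    = length (mixed (n % T))

  complexity′ : ℕ → ℕ
  complexity′ n with n ℕ.<? Q
  ... | yes _ = length (short-classes n)
  ... | no  _ = complexity (n ∸ Q)

  abCard : ∀ n → AbCard (suc Q) n (complexity′ n)
  abCard n with n ℕ.<? Q
  ... | yes n<Q = abCard-short n (ℕ.<⇒≤ n<Q)
  ... | no  n≮Q = subst (λ m → AbCard (suc Q) m (complexity (n ∸ Q))) (ℕ.m+[n∸m]≡n (ℕ.≮⇒≥ n≮Q)) (abCard-long (n ∸ Q))

  complexity′-shift : ∀ n → complexity′ (Q + n) ≡ complexity n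
  complexity′-shift n with Q + n ℕ.<? Q
  ... | yes lt = contradiction lt (ℕ.≤⇒≯ (ℕ.m≤m+n Q n))
  ... | no  _  = cong complexity (ℕ.m+n∸m≡n Q n)

  regular : Regular 3 (λ n → pos (complexity′ n))
  regular = LinRep⇒Regular (LinRep-shift⁻ Q {λ n → pos (complexity′ n)} (LinRep-ext (λ n → cong pos (sym (complexity′-shift n))) LinRep-complexity))

open import Data.Integer using (+_)

theorem1p3 : (k : ℕ) → 1 ≤ k →
    Σ (ℕ → ℕ) λ P →
    ((n : ℕ) → 1 ≤ n → AbCard k n (P n)) × Regular 3 (λ n → + (P n))
theorem1p3 (suc Q) _ with least-power Q
... | J , Q≤3^J , least = complexity′ , (λ n _ → abCard n) , regular
  where open Cardinality Q J Q≤3^J least
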